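{- Let $n\ge1$. The type $C$ zeta map $(\pi,\sigma)\mapsto\zeta(\pi,\sigma)$ is a bijection from the set of vertically $\mathfrak H_n$-labelled lattice paths onto the set of diagonally $\mathfrak H_n$-labelled ballot paths, and $\operatorname{dinv}'(\pi,\sigma)=\operatorname{area}'(\zeta(\pi,\sigma))$ for every vertically $\mathfrak H_n$-labelled path $(\pi,\sigma)$.
   Context: $\mathfrak H_n$: signed permutations (bijections $\sigma$ of $\{\pm1,\dots,\pm n\}$ with $\sigma(-k)=-\sigma(k)$), $\sigma_i=\sigma(i)$. $\mathcal L_{n,n}$: lattice paths $(0,0)\to(n,n)$ with steps $N=(0,1)$, $E=(1,0)$. $i$ is a rise if the $i$-th North step is followed by a North step; $(i,j)$ is a valley if the $i$-th East step is followed by the $j$-th North step. A vertically $\mathfrak H_n$-labelled path is $(\pi,\sigma)$ with $\pi\in\mathcal L_{n,n}$, $\sigma\in\mathfrak H_n$, $\sigma_i<\sigma_{i+1}$ for each rise $i$, and $\sigma_1>0$ if $\pi$ starts with a North step; $\sigma_i$ labels row $i$ (the $i$-th North step). Type $C$ area vector: $a_i=i-b_i$, $b_i$ the $x$-coordinate of the $i$-th North step. $\operatorname{dinv}'(\pi,\sigma)=\#\{(i,j):i<j,a_i=a_j,\sigma_i<\sigma_j\}+\#\{(i,j):i<j,a_i=a_j+1,\sigma_i>\sigma_j\}+\#\{(i,j):i<j,a_i=-a_j,\sigma_i<-\sigma_j\}+\#\{(i,j):i<j,a_i=-a_j+1,\sigma_i>-\sigma_j\}+\#\{i:a_i=0,\sigma_i<0\}$.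 Ballot paths $\mathcal B_n$: paths from $(0,0)$ with $2n$ steps in $\{N,E\}$ never below $x=y$. For $\tau\in\mathfrak H_n$, $w^\tau$ is the word with $w^\tau_i=\tau(n+1-i)$ for $1\le i\le n$ and $w^\tau_i=\tau(n-i)$ for $n+1\le i\le 2n$. A diagonally $\mathfrak H_n$-labelled ballot path is $(\beta,w^\tau)$ with $\beta\in\mathcal B_n$ such that $w^\tau_i>w^\tau_j$ for every valley $(i,j)$ of $\beta$ and $w^\tau_i>0$ if the final step of $\beta$ is its $i$-th East step. $\operatorname{area}'(\beta,w)$ is the number of pairs $(i,j)$ with $1\le i<j$, $i+j\le 2n+1$, such that $\beta$ has at least $j$ North steps, its $j$-th North step has $x$-coordinate at most $i-1$, and $w_i>w_j$. The map $\zeta_C$ on paths: given area vector $(a_1,\dots,a_n)$, start at $(0,0)$ with $i=n$; read the area vector left to right drawing $E$ for each entry $-i-1$ and $N$ for each entry $-i$, then right to left drawing $E$ for each entry $i+1$ and $N$ for each entry $i$; decrease $i$ by $1$ and repeat, stopping once $2n$ steps are drawn. The type $C$ zeta map: $\zeta(\pi,\sigma)=(\beta,w)$ with $\beta=\zeta_C(\pi)$, and $w$ built as follows: for $i=n,n-1,\dots,1$, append the labels $\sigma_k$ of the rows $k$ with $a_k=i$ read from top to bottom (decreasing $k$), then append the negatives $-\sigma_k$ of the labels of rows $k$ with $a_k=-i+1$ read from bottom to top (increasing $k$); this gives $u_1,\dots,u_n$, and $w=(u_1,\dots,u_n,-u_n,\dots,-u_1)$. -}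

module Defs where

open import Data.Bool using (Bool; true; false; if_then_else_; _∧_)
open import Data.Nat as ℕ using (ℕ; zero; suc; _+_; _<ᵇ_)
open import Data.Integer as ℤ using (ℤ; +_; -_; _-_; ∣_∣)
open import Data.List using (List; []; _∷_; _++_; map; reverse; concatMap; take; length; upTo; downFrom)
open import Data.List.Relation.Binary.Permutation.Propositional using (_↭_)
open import Data.Maybe using (Maybe; just; nothing)
open import Data.Product using (_×_; _,_)
open import Relation.Nullary using (does)
open import Relation.Binary.PropositionalEquality using (_≡_)

data Step : Set where
  N E : Step

Path : Set
Path = List Step

numN : Path → ℕ
numN []      = 0
numN (N ∷ p) = suc (numN p)
numN (E ∷ p) = numN p

numE : Path → ℕ
numE []      = 0
numE (N ∷ p) = numE p
numE (E ∷ p) = suc (numE p)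

headStep : Path → Maybe Step
headStep []      = nothing
headStep (s ∷ _) = just s

lastStep : Path → Maybe Step
lastStep []          = nothing
lastStep (s ∷ [])    = just s
lastStep (_ ∷ t ∷ p) = lastStep (t ∷ p)

isN : Maybe Step → Bool
isN (just N) = true
isN _        = false

IsLatticePath : ℕ → Path → Set
IsLatticePath n π = (numN π ≡ n) × (numE π ≡ n)

IsBallotPath : ℕ → Path → Set
IsBallotPath n β = (length β ≡ n + n) × (∀ k → numE (take k β) ℕ.≤ numN (take k β))

-- i-th entry (1-indexed); default 0 out of range (never used in range-checked places)
at : List ℤ → ℕ → ℤ
at []       _             = + 0
at (x ∷ xs) zero          = + 0
at (x ∷ xs) (suc zero)    = x
at (x ∷ xs) (suc (suc i)) = at xs (suc i)

nth : {A : Set} → List A → ℕ → Maybe A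
nth []       _             = nothing
nth (x ∷ xs) zero          = nothing
nth (x ∷ xs) (suc zero)    = just x
nth (x ∷ xs) (suc (suc i)) = nth xs (suc i)

count : {A : Set} → (A → Bool) → List A → ℕ
count f []       = 0
count f (x ∷ xs) = if f x then suc (count f xs) else count f xs

oneTo : ℕ → List ℕ
oneTo n = map suc (upTo n)

pairsIn : List ℕ → List (ℕ × ℕ)
pairsIn xs = concatMap (λ i → map (λ j → (i , j)) xs) xs

infix 4 _=ᶻ_ _<ᶻ_

_=ᶻ_ : ℤ → ℤ → Bool
x =ᶻ y = does (x ℤ.≟ y)

_<ᶻ_ : ℤ → ℤ → Bool
x <ᶻ y = does (x ℤ.<? y)

-- Signed permutations in one-line notation (σ₁, …, σₙ);
-- σ(-k) = -σ(k) is implicit. (|σ₁|,…,|σₙ|) is a permutation of 1..n.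

IsSignedPerm : ℕ → List ℤ → Set
IsSignedPerm n σ = map ∣_∣ σ ↭ oneTo n

nXs : ℕ → Path → List ℕ
nXs x []      = []
nXs x (N ∷ p) = x ∷ nXs x p
nXs x (E ∷ p) = nXs (suc x) p

areaAux : ℕ → ℕ → Path → List ℤ
areaAux k x []      = []
areaAux k x (N ∷ p) = ((+ suc k) - (+ x)) ∷ areaAux (suc k) x p
areaAux k x (E ∷ p) = areaAux k (suc x) p

areaVec : Path → List ℤ
areaVec = areaAux 0 0

risesAux : ℕ → Path → List ℕ
risesAux k []      = []
risesAux k (N ∷ p) = (if isN (headStep p) then suc k ∷ [] else []) ++ risesAux (suc k) p
risesAux k (E ∷ p) = risesAux k p

rises : Path → List ℕ
rises = risesAux 0

valleysAux : ℕ → ℕ → Path → List (ℕ × ℕ)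
valleysAux e k []      = []
valleysAux e k (N ∷ p) = valleysAux e (suc k) p
valleysAux e k (E ∷ p) =
  (if isN (headStep p) then (suc e , suc k) ∷ [] else []) ++ valleysAux (suc e) k p

valleys : Path → List (ℕ × ℕ)
valleys = valleysAux 0 0

open import Data.List.Membership.Propositional using (_∈_)

IsVertLabelled : ℕ → Path → List ℤ → Set
IsVertLabelled n π σ =
  IsLatticePath n π × IsSignedPerm n σ
  × (∀ i → i ∈ rises π → at σ i ℤ.< at σ (suc i))
  × (headStep π ≡ just N → + 0 ℤ.< at σ 1)

wOf : List ℤ → List ℤ
wOf τ = reverse τ ++ map -_ τ

IsDiagLabelled : ℕ → Path → List ℤ → Set
IsDiagLabelled n β τ =
  IsBallotPath n β × IsSignedPerm n τ
  × (∀ i j → (i , j) ∈ valleys β → at (wOf τ) j ℤ.< at (wOf τ) i)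
  × (lastStep β ≡ just E → + 0 ℤ.< at (wOf τ) (numE β))

dinv′ : ℕ → Path → List ℤ → ℕ
dinv′ n π σ =
    count (λ { (i , j) → (i <ᵇ j) ∧ (a i =ᶻ a j) ∧ (s i <ᶻ s j) }) P
  + count (λ { (i , j) → (i <ᵇ j) ∧ (a i =ᶻ (a j ℤ.+ + 1)) ∧ (s j <ᶻ s i) }) P
  + count (λ { (i , j) → (i <ᵇ j) ∧ (a i =ᶻ (- a j)) ∧ (s i <ᶻ (- s j)) }) P
  + count (λ { (i , j) → (i <ᵇ j) ∧ (a i =ᶻ ((- a j) ℤ.+ + 1)) ∧ ((- s j) <ᶻ s i) }) P
  + count (λ i → (a i =ᶻ (+ 0)) ∧ (s i <ᶻ (+ 0))) (oneTo n)
  where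
    a : ℕ → ℤ
    a = at (areaVec π)
    s : ℕ → ℤ
    s = at σ
    P : List (ℕ × ℕ)
    P = pairsIn (oneTo n)

nStepLeftOf : Path → ℕ → ℕ → Bool
nStepLeftOf β j i with nth (nXs 0 β) j
... | just x  = x <ᵇ i
... | nothing = false

area′ : ℕ → Path × List ℤ → ℕ
area′ n (β , w) =
  count (λ { (i , j) → (i <ᵇ j) ∧ ((i + j) <ᵇ suc (suc (n + n)))
                       ∧ nStepLeftOf β j i ∧ (at w j <ᶻ at w i) })
        (pairsIn (oneTo (suc (n + n))))

zetaRound : List ℤ → ℕ → Path
zetaRound a i =
     concatMap (λ x → if x =ᶻ (- (+ i) - + 1) then E ∷ []
                      else if x =ᶻ (- (+ i)) then N ∷ [] else []) a
  ++ concatMap (λ x → if x =ᶻ (+ suc i) then E ∷ []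
                      else if x =ᶻ (+ i) then N ∷ [] else []) (reverse a)

zetaC : ℕ → Path → Path
zetaC n π = take (n + n) (concatMap (zetaRound (areaVec π)) (downFrom (suc n)))

zetaLabels : ℕ → Path → List ℤ → ℕ → List ℤ
zetaLabels n π σ i =
     concatMap (λ k → if a k =ᶻ (+ i) then at σ k ∷ [] else []) (reverse (oneTo n))
  ++ concatMap (λ k → if a k =ᶻ ((- (+ i)) ℤ.+ + 1) then (- at σ k) ∷ [] else []) (oneTo n)
  where
    a : ℕ → ℤ
    a = at (areaVec π)

zetaU : ℕ → Path → List ℤ → List ℤ
zetaU n π σ = concatMap (zetaLabels n π σ) (reverse (oneTo n))

zeta : ℕ → Path → List ℤ → Path × List ℤ
zeta n π σ = zetaC n π , (zetaU n π σ ++ map -_ (reverse (zetaU n π σ)))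

{-# OPTIONS --safe #-}
-- A lattice path from (0,0) to (n,n) is a sequence of excursions above and below the diagonal,
-- and an excursion is a plane tree whose nodes at depth d are rows of area d + 1 (above) or
-- - d (below). Read in the order of the zeta map, the trees above and below form one forest,
-- and ζ lists its nodes level by level, deepest level first: a node with e children
-- contributes E^e N to the ballot path and its (signed) label to w. The first n North steps of
-- β are therefore the transcript of a queue in which each node pops its children and is pushed
-- itself, so the forest is recovered by running the queue; the remaining steps of β record
-- which roots lie above (E) and below (N) the diagonal. Under this encoding rises and valleys
-- both compare a node with its last child (or two neighbouring roots). Finally dinv' and area'
-- both satisfy the recursion of the queue: popping e trees and pushing a node labelled l
-- increases the number of inversions by the number of remaining roots with label > l.
module Submission where

open import Defs
open import Data.Bool using (Bool; true; false; if_then_else_; _∧_)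
open import Data.Bool.Properties using (∧-assoc)
open import Data.Unit using (⊤; tt)
open import Data.Nat as ℕ using (ℕ; zero; suc; _+_; _≤_; z≤n; s≤s; _<ᵇ_)
import Data.Nat.Properties as ℕₚ
open import Algebra.Properties.CommutativeSemigroup ℕₚ.+-commutativeSemigroup using () renaming (interchange to +-interchange)
open import Data.Integer as ℤ using (ℤ; -[1+_]; -_; ∣_∣) renaming (+_ to pos)
import Data.Integer.Properties as ℤₚ
open import Data.List
open import Data.List.Properties
open import Data.List.Relation.Unary.All as All using (All; []; _∷_)
import Data.List.Relation.Unary.All.Properties as Allₚ
open import Data.List.Relation.Unary.Any using (here; there)
open import Data.List.Relation.Unary.AllPairs using (AllPairs; []; _∷_)
import Data.List.Relation.Unary.AllPairs.Properties as AllPairsₚ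
open import Data.List.Membership.Propositional using (_∈_)
open import Data.List.Relation.Binary.Permutation.Propositional using (_↭_; ↭-refl; ↭-sym; ↭-trans; ↭-reflexive; prep)
import Data.List.Relation.Binary.Permutation.Propositional.Properties as ↭ₚ
open import Data.Maybe using (Maybe; just; nothing)
open import Data.Product using (Σ; _×_; _,_; proj₁; proj₂; ∃-syntax)
open import Data.Sum using (_⊎_; inj₁; inj₂)
open import Function using (_∘_; id; flip; case_of_)
open import Function.Bundles using (_⇔_; mk⇔; Equivalence)
open import Relation.Nullary using (does)
open import Relation.Nullary.Decidable using (dec-true; dec-false; does-⇔)
open import Relation.Binary.PropositionalEquality hiding ([_])

-- The areas d + 1 and - d of depth d come from the symmetry a ↦ 1 - a, which exchanges the two
-- sides of the diagonal. Together with the negation of the labels below, it turns the four kinds of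
-- pairs in dinv' into two comparisons, between nodes of equal and of adjacent depths, regardless of
-- the side on which they lie. The exception is at the roots: areas 0 and 1 are also adjacent
-- integers and 0 is its own negative, so pairs of roots can be counted once more, and so can single
-- rows of area 0. This surplus, `extra`, is what the North steps of β after the n-th contribute to
-- area'. Deepest level first means that children are read before their parents, which is what lets
-- a queue rebuild the forest. The obstacle is that the queue usually holds the rest of one level
-- followed by the beginning of the next one read, so the readings must be compared across shifted
-- level boundaries (`nodes-half-level`). Path, rows, β and w are all functions of one list `m` of
-- excursions, and the bijection joins two encodings of `m`.

private variable
  A B : Set

-- Plane forests read level by level

data Tree : Set where
  node : ℤ → List Tree → Tree

label : Tree → ℤ
label (node l _) = l

children : Tree → List Tree
children (node _ c) = c

labels : List Tree → List ℤ
labels = map label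

kids : List Tree → List Tree
kids = concatMap children

-- The equation `descend h F ≡ []` is how the development says that `F` has height at most `h`.
descend : ℕ → List Tree → List Tree
descend zero    F = F
descend (suc d) F = descend d (kids F)

nodes : ℕ → List Tree → List Tree
nodes zero    F = []
nodes (suc h) F = nodes h (kids F) ++ F

size : List Tree → ℕ
size []             = 0
size (node _ c ∷ F) = suc (size c + size F)

kids-++ : ∀ F G → kids (F ++ G) ≡ kids F ++ kids G
kids-++ = concatMap-++ children

labels-++ : ∀ F G → labels (F ++ G) ≡ labels F ++ labels G
labels-++ = map-++ label

descend-[] : ∀ d → descend d [] ≡ []
descend-[] zero    = refl
descend-[] (suc d) = descend-[] d

descend-++ : ∀ d F G → descend d (F ++ G) ≡ descend d F ++ descend d G
descend-++ zero    F G = refl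
descend-++ (suc d) F G = trans (cong (descend d) (kids-++ F G)) (descend-++ d (kids F) (kids G))

nodes-[] : ∀ h → nodes h [] ≡ []
nodes-[] zero    = refl
nodes-[] (suc h) = cong (_++ []) (nodes-[] h)

size-++ : ∀ F G → size (F ++ G) ≡ size F + size G
size-++ []             G = refl
size-++ (node _ c ∷ F) G =
  cong suc (trans (cong (size c +_) (size-++ F G)) (sym (ℕₚ.+-assoc (size c) _ _)))

size-kids : ∀ F → length F + size (kids F) ≡ size F
size-kids []             = refl
size-kids (node _ c ∷ F) = cong suc (begin
  length F + size (c ++ kids F)         ≡⟨ cong (length F +_) (size-++ c (kids F)) ⟩
  length F + (size c + size (kids F))   ≡⟨ sym (ℕₚ.+-assoc (length F) _ _) ⟩
  length F + size c + size (kids F)     ≡⟨ cong (_+ size (kids F)) (ℕₚ.+-comm (length F) _) ⟩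
  size c + length F + size (kids F)     ≡⟨ ℕₚ.+-assoc (size c) _ _ ⟩
  size c + (length F + size (kids F))   ≡⟨ cong (size c +_) (size-kids F) ⟩
  size c + size F                       ∎)
  where open ≡-Reasoning

-- Passing to `kids` removes the roots, at least one tree node each time, so the size bounds the
-- height.
descend-exhausted : ∀ h F → size F ≤ h → descend h F ≡ []
descend-exhausted zero    []      _   = refl
descend-exhausted zero    (node _ _ ∷ _) ()
descend-exhausted (suc h) []      _   = descend-[] h
descend-exhausted (suc h) (t ∷ F) s≤h = descend-exhausted h (kids (t ∷ F))
  (ℕₚ.≤-pred (ℕₚ.≤-trans (s≤s (ℕₚ.m≤n+m _ (length F)))
    (ℕₚ.≤-trans (ℕₚ.≤-reflexive (size-kids (t ∷ F))) s≤h)))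

nodes-length : ∀ h F → descend h F ≡ [] → length (nodes h F) ≡ size F
nodes-length zero    F e rewrite e = refl
nodes-length (suc h) F e = begin
  length (nodes h (kids F) ++ F)      ≡⟨ length-++ (nodes h (kids F)) ⟩
  length (nodes h (kids F)) + length F ≡⟨ cong (_+ length F) (nodes-length h (kids F) e) ⟩
  size (kids F) + length F            ≡⟨ ℕₚ.+-comm _ (length F) ⟩
  length F + size (kids F)            ≡⟨ size-kids F ⟩
  size F                              ∎
  where open ≡-Reasoning

-- The children of one level are the level read just before it, so the children of all nodes,
-- followed by the roots, give back the reading. This aligns the labels of the East steps (children,
-- then roots) with those of the North steps.
kids-nodes : ∀ h F → descend h F ≡ [] → kids (nodes h F) ++ F ≡ nodes h F
kids-nodes zero    F e = e
kids-nodes (suc h) F e = cong (_++ F)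
  (trans (kids-++ (nodes h (kids F)) F) (kids-nodes h (kids F) e))

-- `nodes` recurses at the shallow end, whereas induction on the number of rounds of the zeta map
-- peels off the deepest level.
nodes-unfold-top : ∀ h F → nodes (suc h) F ≡ descend h F ++ nodes h F
nodes-unfold-top zero    F = sym (++-identityʳ F)
nodes-unfold-top (suc h) F = trans (cong (_++ F) (nodes-unfold-top h (kids F)))
  (++-assoc (descend h (kids F)) (nodes h (kids F)) F)

nodes-stable : ∀ h F → descend h F ≡ [] → nodes (suc h) F ≡ nodes h F
nodes-stable h F e = trans (nodes-unfold-top h F) (cong (_++ nodes h F) e)

-- With indices for depths, the reading is ... F₁ G₁ F₀ G₀. Bracketed as ... (G₂ F₁) (G₁ F₀) G₀ it
-- is the reading of `kids G ++ F`, followed by `G`. The bound on the height of `G` empties the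
-- G-part of the deepest bracket.
nodes-half-level : ∀ h F G → descend h G ≡ [] →
  nodes (suc h) (F ++ G) ≡ nodes (suc h) (kids G ++ F) ++ G
nodes-half-level zero    F G refl = refl
nodes-half-level (suc h) F G e = begin
  nodes (suc h) (kids (F ++ G)) ++ F ++ G
    ≡⟨ cong (λ K → nodes (suc h) K ++ F ++ G) (kids-++ F G) ⟩
  nodes (suc h) (kids F ++ kids G) ++ F ++ G
    ≡⟨ cong (_++ F ++ G) (nodes-half-level h (kids F) (kids G) e) ⟩
  (nodes (suc h) (kids (kids G) ++ kids F) ++ kids G) ++ F ++ G
    ≡⟨ cong (λ K → (nodes (suc h) K ++ kids G) ++ F ++ G) (sym (kids-++ (kids G) F)) ⟩
  (nodes (suc h) (kids (kids G ++ F)) ++ kids G) ++ F ++ G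
    ≡⟨ ++-assoc (nodes (suc h) (kids (kids G ++ F))) (kids G) (F ++ G) ⟩
  nodes (suc h) (kids (kids G ++ F)) ++ kids G ++ F ++ G
    ≡⟨ cong (nodes (suc h) (kids (kids G ++ F)) ++_) (sym (++-assoc (kids G) F G)) ⟩
  nodes (suc h) (kids (kids G ++ F)) ++ (kids G ++ F) ++ G
    ≡⟨ sym (++-assoc (nodes (suc h) (kids (kids G ++ F))) (kids G ++ F) G) ⟩
  (nodes (suc h) (kids (kids G ++ F)) ++ kids G ++ F) ++ G ∎
  where open ≡-Reasoning

-- This is one queue step, from `F ++ G` to `G ++ node l F ∷ []`. Below the new roots lies the level
-- `kids G ++ F`, so moving the level boundary shows that the reading only gains the new node at its
-- end.
nodes-push : ∀ h F G l → size (F ++ G) ℕ.< h →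
  nodes h (G ++ node l F ∷ []) ≡ nodes h (F ++ G) ++ node l F ∷ []
nodes-push (suc h) F G l (s≤s b) = begin
  nodes h (kids (G ++ node l F ∷ [])) ++ G ++ node l F ∷ []
    ≡⟨ cong (λ K → nodes h K ++ G ++ node l F ∷ []) (trans (kids-++ G _) (cong (kids G ++_) (++-identityʳ F))) ⟩
  nodes h (kids G ++ F) ++ G ++ node l F ∷ []
    ≡⟨ sym (++-assoc (nodes h (kids G ++ F)) G _) ⟩
  (nodes h (kids G ++ F) ++ G) ++ node l F ∷ []
    ≡⟨ cong (λ K → (K ++ G) ++ node l F ∷ []) (sym (nodes-stable h (kids G ++ F) e₁)) ⟩
  (nodes (suc h) (kids G ++ F) ++ G) ++ node l F ∷ []
    ≡⟨ cong (_++ node l F ∷ []) (sym (nodes-half-level h F G e₂)) ⟩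
  nodes (suc h) (F ++ G) ++ node l F ∷ [] ∎
  where
  open ≡-Reasoning
  b′ : size F + size G ≤ h
  b′ = ℕₚ.≤-trans (ℕₚ.≤-reflexive (sym (size-++ F G))) b
  e₂ : descend h G ≡ []
  e₂ = descend-exhausted h G (ℕₚ.≤-trans (ℕₚ.m≤n+m _ (size F)) b′)
  e₁ : descend h (kids G ++ F) ≡ []
  e₁ = descend-exhausted h (kids G ++ F) (ℕₚ.≤-trans (ℕₚ.≤-reflexive (size-++ (kids G) F))
    (ℕₚ.≤-trans (ℕₚ.+-monoˡ-≤ (size F) (ℕₚ.m≤n+m (size (kids G)) (length G)))
    (ℕₚ.≤-trans (ℕₚ.≤-reflexive (trans (cong (_+ size F) (size-kids G)) (ℕₚ.+-comm (size G) _))) b′)))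

-- The queue machine and its transcripts

enc : List Tree → List (ℕ × ℤ)
enc = map (λ t → length (children t) , label t)

-- The queue machine reading the North steps: popped trees become the children of the pushed one.
dec : List Tree → List (ℕ × ℤ) → List Tree
dec Q []             = Q
dec Q ((e , l) ∷ xs) = dec (drop e Q ++ node l (take e Q) ∷ []) xs

take-++-length : (xs ys : List A) → take (length xs) (xs ++ ys) ≡ xs
take-++-length []       ys = refl
take-++-length (x ∷ xs) ys = cong (x ∷_) (take-++-length xs ys)

drop-++-length : (xs ys : List A) → drop (length xs) (xs ++ ys) ≡ ys
drop-++-length []       ys = refl
drop-++-length (x ∷ xs) ys = drop-++-length xs ys

-- Rebuilding the level `G` uses up exactly its children at the front of the queue and lines `G` up
-- at the back. `Q` is arbitrary because in the induction it collects the part of the level already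
-- rebuilt.
dec-level : ∀ G Q xs → dec (kids G ++ Q) (enc G ++ xs) ≡ dec (Q ++ G) xs
dec-level []             Q xs = cong (λ K → dec K xs) (sym (++-identityʳ Q))
dec-level (node l c ∷ G) Q xs
  rewrite ++-assoc c (kids G) Q
        | take-++-length c (kids G ++ Q)
        | drop-++-length c (kids G ++ Q)
        | ++-assoc (kids G) Q (node l c ∷ [])
        | dec-level G (Q ++ node l c ∷ []) xs
        | ++-assoc Q (node l c ∷ []) G = refl

dec-enc : ∀ h F xs → descend h F ≡ [] → dec [] (enc (nodes h F) ++ xs) ≡ dec F xs
dec-enc zero    F xs e rewrite e = refl
dec-enc (suc h) F xs e = begin
  dec [] (enc (nodes h (kids F) ++ F) ++ xs)
    ≡⟨ cong (λ z → dec [] (z ++ xs)) (map-++ _ (nodes h (kids F)) F) ⟩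
  dec [] ((enc (nodes h (kids F)) ++ enc F) ++ xs)
    ≡⟨ cong (dec []) (++-assoc (enc (nodes h (kids F))) (enc F) xs) ⟩
  dec [] (enc (nodes h (kids F)) ++ enc F ++ xs)
    ≡⟨ dec-enc h (kids F) (enc F ++ xs) e ⟩
  dec (kids F) (enc F ++ xs)
    ≡⟨ cong (λ z → dec z (enc F ++ xs)) (sym (++-identityʳ (kids F))) ⟩
  dec (kids F ++ []) (enc F ++ xs)
    ≡⟨ dec-level F [] xs ⟩
  dec F xs ∎
  where open ≡-Reasoning

-- A queue of length `q` never underflows. Otherwise `take` would silently give a node fewer than
-- `e` children, and the transcript could not be recovered.
data Valid : ℕ → List (ℕ × ℤ) → Set where
  []  : ∀ {q} → Valid q []
  _∷_ : ∀ {e q l xs} → e ≤ q → Valid (suc (q ℕ.∸ e)) xs → Valid q ((e , l) ∷ xs)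

size-push : ∀ e l Q → size (drop e Q ++ node l (take e Q) ∷ []) ≡ suc (size Q)
size-push e l Q = begin
  size (drop e Q ++ node l (take e Q) ∷ [])      ≡⟨ size-++ (drop e Q) _ ⟩
  size (drop e Q) + suc (size (take e Q) + 0)    ≡⟨ ℕₚ.+-suc _ _ ⟩
  suc (size (drop e Q) + (size (take e Q) + 0))  ≡⟨ cong (λ z → suc (size (drop e Q) + z)) (ℕₚ.+-identityʳ _) ⟩
  suc (size (drop e Q) + size (take e Q))        ≡⟨ cong suc (ℕₚ.+-comm (size (drop e Q)) _) ⟩
  suc (size (take e Q) + size (drop e Q))        ≡⟨ cong suc (sym (size-++ (take e Q) _)) ⟩
  suc (size (take e Q ++ drop e Q))              ≡⟨ cong (suc ∘ size) (take++drop≡id e Q) ⟩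
  suc (size Q)                                   ∎
  where open ≡-Reasoning

size-dec : ∀ Q xs → size (dec Q xs) ≡ size Q + length xs
size-dec Q []             = sym (ℕₚ.+-identityʳ _)
size-dec Q ((e , l) ∷ xs) = trans (size-dec _ xs)
  (trans (cong (_+ length xs) (size-push e l Q)) (sym (ℕₚ.+-suc (size Q) (length xs))))

-- The encoded reading of the queue is the transcript so far: by `nodes-push`, each step appends its
-- own entry. One bound `h` serves for the whole run, since a step adds a single node and keeps
-- `size Q + length xs` constant.
enc-dec : ∀ h Q xs → Valid (length Q) xs → size Q + length xs ≤ h →
  enc (nodes h (dec Q xs)) ≡ enc (nodes h Q) ++ xs
enc-dec h Q [] _ _ = sym (++-identityʳ _)
enc-dec h Q ((e , l) ∷ xs) (e≤q ∷ v) b = begin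
  enc (nodes h (dec Q′ xs))
    ≡⟨ enc-dec h Q′ xs (subst (λ k → Valid k xs) (sym len) v) b′ ⟩
  enc (nodes h Q′) ++ xs
    ≡⟨ cong (λ z → enc z ++ xs) (nodes-push h (take e Q) (drop e Q) l
         (subst (λ z → size z ℕ.< h) (sym (take++drop≡id e Q)) b″)) ⟩
  enc (nodes h (take e Q ++ drop e Q) ++ node l (take e Q) ∷ []) ++ xs
    ≡⟨ cong (λ z → enc (nodes h z ++ node l (take e Q) ∷ []) ++ xs) (take++drop≡id e Q) ⟩
  enc (nodes h Q ++ node l (take e Q) ∷ []) ++ xs
    ≡⟨ cong (_++ xs) (map-++ _ (nodes h Q) _) ⟩
  (enc (nodes h Q) ++ (length (take e Q) , l) ∷ []) ++ xs
    ≡⟨ ++-assoc (enc (nodes h Q)) _ xs ⟩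
  enc (nodes h Q) ++ (length (take e Q) , l) ∷ xs
    ≡⟨ cong (λ z → enc (nodes h Q) ++ (z , l) ∷ xs)
         (trans (length-take e Q) (ℕₚ.m≤n⇒m⊓n≡m e≤q)) ⟩
  enc (nodes h Q) ++ (e , l) ∷ xs ∎
  where
  open ≡-Reasoning
  Q′ : List Tree
  Q′ = drop e Q ++ node l (take e Q) ∷ []
  len : length Q′ ≡ suc (length Q ℕ.∸ e)
  len = trans (length-++ (drop e Q)) (trans (ℕₚ.+-comm _ 1) (cong suc (length-drop e Q)))
  b″ : size Q ℕ.< h
  b″ = ℕₚ.≤-trans (ℕₚ.≤-trans (s≤s (ℕₚ.m≤m+n (size Q) (length xs)))
        (ℕₚ.≤-reflexive (sym (ℕₚ.+-suc (size Q) (length xs))))) b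
  b′ : size Q′ + length xs ≤ h
  b′ = ℕₚ.≤-trans (ℕₚ.≤-reflexive (trans (cong (_+ length xs) (size-push e l Q)) (sym (ℕₚ.+-suc (size Q) _)))) b

-- Labelled lattice paths and their excursions

-- A lattice path with its labels: just l is a North step labelled l, nothing is an East step.
LPath : Set
LPath = List (Maybe ℤ)

step : Maybe ℤ → Step
step (just _) = N
step nothing  = E

steps : LPath → Path
steps = map step

-- Excursions of a path above (true) and below (false) the diagonal, listed from the last
-- one to the first one.
Excursions : Set
Excursions = List (Bool × Tree)

-- A node at depth d of an excursion above (below) the diagonal is a row with area d + 1
-- (resp. - d). Labels are negated below the diagonal, and siblings are listed in the order
-- in which the zeta map reads them, i.e. backwards above the diagonal.
above : List Tree → LPath
above []             = []
above (node l c ∷ F) = above F ++ just l ∷ above c ++ nothing ∷ []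

below : List Tree → LPath
below []             = []
below (node l c ∷ F) = nothing ∷ below c ++ just (- l) ∷ below F

excursion : Bool × Tree → LPath
excursion (true  , t) = above (t ∷ [])
excursion (false , t) = below (t ∷ [])

path : Excursions → LPath
path []      = []
path (x ∷ m) = path m ++ excursion x

fromPath : (π : Path) (σ : List ℤ) → length σ ≡ numN π →
  Σ LPath λ p → (steps p ≡ π) × (catMaybes p ≡ σ)
fromPath []      []      _ = [] , refl , refl
fromPath []      (_ ∷ _) ()
fromPath (N ∷ π) []      ()
fromPath (N ∷ π) (l ∷ σ) e with fromPath π σ (ℕₚ.suc-injective e)
... | p , refl , refl = just l ∷ p , refl , refl
fromPath (E ∷ π) σ e with fromPath π σ e
... | p , refl , refl = nothing ∷ p , refl , refl

below-++ : ∀ F G → below (F ++ G) ≡ below F ++ below G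
below-++ []             G = refl
below-++ (node l c ∷ F) G = cong (nothing ∷_)
  (trans (cong (λ z → below c ++ just (- l) ∷ z) (below-++ F G)) (sym (++-assoc (below c) _ _)))

-- The excursion in progress, innermost open step first.
openAbove : Excursions → List (ℤ × List Tree) → LPath
openAbove m []             = path m
openAbove m ((l , F) ∷ st) = openAbove m st ++ just l ∷ above F

openBelow : Excursions → List (List Tree) → LPath
openBelow m []       = path m
openBelow m (F ∷ st) = openBelow m st ++ nothing ∷ below F

-- A parser, structurally recursive in the unread steps, with the open steps of the current
-- excursion on a stack. The balance of the unread steps against the stack excludes that the path
-- ends with a step still open.
decompose : ∀ p m → numN (steps p) ≡ numE (steps p) → ∃[ m′ ] path m′ ≡ path m ++ p
decomposeAbove : ∀ p m x st → suc (length st) + numN (steps p) ≡ numE (steps p) →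
  ∃[ m′ ] path m′ ≡ openAbove m (x ∷ st) ++ p
decomposeBelow : ∀ p m F st → numN (steps p) ≡ suc (length st) + numE (steps p) →
  ∃[ m′ ] path m′ ≡ openBelow m (F ∷ st) ++ p

decompose []            m e = m , sym (++-identityʳ _)
decompose (just l ∷ p)  m e with decomposeAbove p m (l , []) [] e
... | m′ , q = m′ , trans q (++-assoc (path m) _ p)
decompose (nothing ∷ p) m e with decomposeBelow p m [] [] e
... | m′ , q = m′ , trans q (++-assoc (path m) _ p)

decomposeAbove [] m x st ()
decomposeAbove (just l ∷ p) m x st e
  with decomposeAbove p m (l , []) (x ∷ st) (trans (cong suc (sym (ℕₚ.+-suc (length st) _))) e)
... | m′ , q = m′ , trans q (++-assoc (openAbove m (x ∷ st)) _ p)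
decomposeAbove (nothing ∷ p) m (l , F) [] e
  with decompose p ((true , node l F) ∷ m) (ℕₚ.suc-injective e)
... | m′ , q = m′ , trans q (trans (++-assoc (path m) _ p)
  (sym (trans (++-assoc (path m) _ _) (cong (λ z → path m ++ just l ∷ z) (sym (++-assoc (above F) _ p))))))
-- The finished node goes to the front of its siblings, which are listed backwards above the
-- diagonal; below, it goes to the back.
decomposeAbove (nothing ∷ p) m (l , F) ((l′ , G) ∷ st) e
  with decomposeAbove p m (l′ , node l F ∷ G) st (ℕₚ.suc-injective e)
... | m′ , q = m′ , trans q (begin
  (O ++ just l′ ∷ above G ++ just l ∷ above F ++ nothing ∷ []) ++ p
    ≡⟨ cong (_++ p) (sym (++-assoc O (just l′ ∷ above G) _)) ⟩
  ((O ++ just l′ ∷ above G) ++ just l ∷ above F ++ nothing ∷ []) ++ p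
    ≡⟨ ++-assoc (O ++ just l′ ∷ above G) _ p ⟩
  (O ++ just l′ ∷ above G) ++ just l ∷ (above F ++ nothing ∷ []) ++ p
    ≡⟨ cong (λ z → (O ++ just l′ ∷ above G) ++ just l ∷ z) (++-assoc (above F) _ p) ⟩
  (O ++ just l′ ∷ above G) ++ just l ∷ above F ++ nothing ∷ p
    ≡⟨ sym (++-assoc (O ++ just l′ ∷ above G) _ _) ⟩
  ((O ++ just l′ ∷ above G) ++ just l ∷ above F) ++ nothing ∷ p ∎)
  where
  open ≡-Reasoning
  O : LPath
  O = openAbove m st

decomposeBelow [] m F st ()
decomposeBelow (nothing ∷ p) m F st e
  with decomposeBelow p m [] (F ∷ st) (trans e (cong suc (ℕₚ.+-suc (length st) _)))
... | m′ , q = m′ , trans q (++-assoc (openBelow m (F ∷ st)) _ p)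
decomposeBelow (just l ∷ p) m F [] e
  with decompose p ((false , node (- l) F) ∷ m) (ℕₚ.suc-injective e)
... | m′ , q = m′ , trans q (trans (++-assoc (path m) _ p)
  (sym (trans (++-assoc (path m) _ _) (cong (λ z → path m ++ nothing ∷ z)
    (sym (trans (++-assoc (below F) _ p) (cong (λ z → below F ++ just z ∷ p) (ℤₚ.neg-involutive l))))))))
decomposeBelow (just l ∷ p) m F (G ∷ st) e
  with decomposeBelow p m (G ++ node (- l) F ∷ []) st (ℕₚ.suc-injective e)
... | m′ , q = m′ , trans q (begin
  (O ++ nothing ∷ below (G ++ node (- l) F ∷ [])) ++ p
    ≡⟨ cong (λ z → (O ++ nothing ∷ z) ++ p) (below-++ G _) ⟩
  (O ++ nothing ∷ below G ++ nothing ∷ below F ++ just (- (- l)) ∷ []) ++ p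
    ≡⟨ cong (λ z → (O ++ nothing ∷ below G ++ nothing ∷ below F ++ just z ∷ []) ++ p) (ℤₚ.neg-involutive l) ⟩
  (O ++ nothing ∷ below G ++ nothing ∷ below F ++ just l ∷ []) ++ p
    ≡⟨ cong (_++ p) (sym (++-assoc O (nothing ∷ below G) _)) ⟩
  ((O ++ nothing ∷ below G) ++ nothing ∷ below F ++ just l ∷ []) ++ p
    ≡⟨ cong (_++ p) (sym (++-assoc (O ++ nothing ∷ below G) (nothing ∷ below F) _)) ⟩
  (((O ++ nothing ∷ below G) ++ nothing ∷ below F) ++ just l ∷ []) ++ p
    ≡⟨ ++-assoc ((O ++ nothing ∷ below G) ++ nothing ∷ below F) _ p ⟩
  ((O ++ nothing ∷ below G) ++ nothing ∷ below F) ++ just l ∷ p ∎)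
  where
  open ≡-Reasoning
  O : LPath
  O = openBelow m st

-- The rows of an encoded path

-- The rows as pairs (area, label), for a path starting at height h above the diagonal.
rows : ℤ → LPath → List (ℤ × ℤ)
rows h []            = []
rows h (just l ∷ p)  = (ℤ.suc h , l) ∷ rows (ℤ.suc h) p
rows h (nothing ∷ p) = rows (ℤ.pred h) p

areaAux-rows : ∀ k x h p → pos k ℤ.- pos x ≡ h → areaAux k x (steps p) ≡ map proj₁ (rows h p)
areaAux-rows k x h []           e = refl
areaAux-rows k x h (just l ∷ p) e = cong₂ _∷_ e′ (areaAux-rows (suc k) x (ℤ.suc h) p e′)
  where
  e′ : pos (suc k) ℤ.- pos x ≡ ℤ.suc h
  e′ = trans (ℤₚ.+-assoc (pos 1) (pos k) (- pos x)) (cong ℤ.suc e)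
areaAux-rows k x h (nothing ∷ p) e = areaAux-rows k (suc x) (ℤ.pred h) p (begin
  pos k ℤ.+ - pos (suc x)        ≡⟨ cong (λ z → pos k ℤ.+ z) (ℤₚ.neg-distrib-+ (pos 1) (pos x)) ⟩
  pos k ℤ.+ (-[1+ 0 ] ℤ.+ - pos x) ≡⟨ sym (ℤₚ.+-assoc (pos k) -[1+ 0 ] _) ⟩
  (pos k ℤ.+ -[1+ 0 ]) ℤ.+ - pos x ≡⟨ cong (λ z → z ℤ.+ - pos x) (ℤₚ.+-comm (pos k) -[1+ 0 ]) ⟩
  (-[1+ 0 ] ℤ.+ pos k) ℤ.+ - pos x ≡⟨ ℤₚ.+-assoc -[1+ 0 ] (pos k) _ ⟩
  ℤ.pred (pos k ℤ.- pos x)       ≡⟨ cong ℤ.pred e ⟩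
  ℤ.pred h                       ∎)
  where open ≡-Reasoning

rows-labels : ∀ h p → map proj₂ (rows h p) ≡ catMaybes p
rows-labels h []            = refl
rows-labels h (just l ∷ p)  = cong (l ∷_) (rows-labels _ p)
rows-labels h (nothing ∷ p) = rows-labels _ p

-- Depths and labels in the order in which the zeta map meets them.
scan : ℕ → List Tree → List (ℕ × ℤ)
scan d []             = []
scan d (node l c ∷ F) = scan (suc d) c ++ (d , l) ∷ scan d F

rowAbove rowBelow : ℕ × ℤ → ℤ × ℤ
rowAbove (d , l) = pos (suc d) , l
rowBelow (d , l) = - pos d , - l

-- Along the path a North step precedes its children above the diagonal and follows them below. With
-- the two sibling orders, the rows of an excursion are a postorder scan below and the reverse of
-- such a scan above.
rowsOf : Excursions → List (ℤ × ℤ)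
rowsOf []                = []
rowsOf ((true  , t) ∷ m) = rowsOf m ++ map rowAbove (reverse (scan 0 (t ∷ [])))
rowsOf ((false , t) ∷ m) = rowsOf m ++ map rowBelow (scan 0 (t ∷ []))

rows-above : ∀ d F p → rows (pos d) (above F ++ p) ≡ map rowAbove (reverse (scan d F)) ++ rows (pos d) p
rows-above d []             p = refl
rows-above d (node l c ∷ F) p = begin
  rows (pos d) ((above F ++ just l ∷ above c ++ nothing ∷ []) ++ p)
    ≡⟨ cong (rows (pos d)) (trans (++-assoc (above F) _ p) (cong (λ z → above F ++ just l ∷ z) (++-assoc (above c) _ p))) ⟩
  rows (pos d) (above F ++ just l ∷ above c ++ nothing ∷ p)
    ≡⟨ rows-above d F _ ⟩
  S F d ++ (pos (suc d) , l) ∷ rows (pos (suc d)) (above c ++ nothing ∷ p)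
    ≡⟨ cong (λ z → S F d ++ (pos (suc d) , l) ∷ z) (rows-above (suc d) c (nothing ∷ p)) ⟩
  S F d ++ (pos (suc d) , l) ∷ S c (suc d) ++ rows (pos d) p
    ≡⟨ sym (++-assoc (S F d) ((pos (suc d) , l) ∷ S c (suc d)) _) ⟩
  (S F d ++ (pos (suc d) , l) ∷ S c (suc d)) ++ rows (pos d) p
    ≡⟨ cong (_++ rows (pos d) p) (sym split) ⟩
  S (node l c ∷ F) d ++ rows (pos d) p ∎
  where
  open ≡-Reasoning
  S : List Tree → ℕ → List (ℤ × ℤ)
  S G k = map rowAbove (reverse (scan k G))
  split : S (node l c ∷ F) d ≡ S F d ++ (pos (suc d) , l) ∷ S c (suc d)
  split = begin
    map rowAbove (reverse (scan (suc d) c ++ (d , l) ∷ scan d F))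
      ≡⟨ cong (map rowAbove) (reverse-++ (scan (suc d) c) _) ⟩
    map rowAbove (reverse ((d , l) ∷ scan d F) ++ reverse (scan (suc d) c))
      ≡⟨ cong (λ z → map rowAbove (z ++ reverse (scan (suc d) c))) (unfold-reverse (d , l) (scan d F)) ⟩
    map rowAbove ((reverse (scan d F) ++ (d , l) ∷ []) ++ reverse (scan (suc d) c))
      ≡⟨ cong (map rowAbove) (++-assoc (reverse (scan d F)) _ _) ⟩
    map rowAbove (reverse (scan d F) ++ (d , l) ∷ reverse (scan (suc d) c))
      ≡⟨ map-++ rowAbove (reverse (scan d F)) _ ⟩
    S F d ++ (pos (suc d) , l) ∷ S c (suc d) ∎

pred-neg : ∀ d → ℤ.pred (- pos d) ≡ - pos (suc d)
pred-neg zero    = refl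
pred-neg (suc d) = refl

suc-neg : ∀ d → ℤ.suc (- pos (suc d)) ≡ - pos d
suc-neg zero    = refl
suc-neg (suc d) = refl

rows-below : ∀ d F p → rows (- pos d) (below F ++ p) ≡ map rowBelow (scan d F) ++ rows (- pos d) p
rows-below d []             p = refl
rows-below d (node l c ∷ F) p = begin
  rows (ℤ.pred (- pos d)) ((below c ++ just (- l) ∷ below F) ++ p)
    ≡⟨ cong₂ rows (pred-neg d) (++-assoc (below c) _ p) ⟩
  rows (- pos (suc d)) (below c ++ just (- l) ∷ below F ++ p)
    ≡⟨ rows-below (suc d) c _ ⟩
  S (suc d) c ++ (ℤ.suc (- pos (suc d)) , - l) ∷ rows (ℤ.suc (- pos (suc d))) (below F ++ p)
    ≡⟨ cong (λ z → S (suc d) c ++ (z , - l) ∷ rows z (below F ++ p)) (suc-neg d) ⟩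
  S (suc d) c ++ (- pos d , - l) ∷ rows (- pos d) (below F ++ p)
    ≡⟨ cong (λ z → S (suc d) c ++ (- pos d , - l) ∷ z) (rows-below d F p) ⟩
  S (suc d) c ++ (- pos d , - l) ∷ S d F ++ rows (- pos d) p
    ≡⟨ sym (++-assoc (S (suc d) c) ((- pos d , - l) ∷ S d F) _) ⟩
  (S (suc d) c ++ (- pos d , - l) ∷ S d F) ++ rows (- pos d) p
    ≡⟨ cong (_++ rows (- pos d) p) (sym (map-++ rowBelow (scan (suc d) c) _)) ⟩
  S d (node l c ∷ F) ++ rows (- pos d) p ∎
  where
  open ≡-Reasoning
  S : ℕ → List Tree → List (ℤ × ℤ)
  S k G = map rowBelow (scan k G)

rows-path : ∀ m p → rows (pos 0) (path m ++ p) ≡ rowsOf m ++ rows (pos 0) p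
rows-path []                p = refl
rows-path ((true  , t) ∷ m) p
  rewrite ++-assoc (path m) (above (t ∷ [])) p
        | rows-path m (above (t ∷ []) ++ p)
        | rows-above 0 (t ∷ []) p
        | ++-assoc (rowsOf m) (map rowAbove (reverse (scan 0 (t ∷ [])))) (rows (pos 0) p) = refl
rows-path ((false , t) ∷ m) p
  rewrite ++-assoc (path m) (below (t ∷ [])) p
        | rows-path m (below (t ∷ []) ++ p)
        | rows-below 0 (t ∷ []) p
        | ++-assoc (rowsOf m) (map rowBelow (scan 0 (t ∷ []))) (rows (pos 0) p) = refl

rows-path′ : ∀ m → rows (pos 0) (path m) ≡ rowsOf m
rows-path′ m = trans (cong (rows (pos 0)) (sym (++-identityʳ (path m))))
  (trans (rows-path m []) (++-identityʳ (rowsOf m)))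

areaVec-path : ∀ m → areaVec (steps (path m)) ≡ map proj₁ (rowsOf m)
areaVec-path m = trans (areaAux-rows 0 0 (pos 0) (path m) refl) (cong (map proj₁) (rows-path′ m))

labels-path : ∀ m → catMaybes (path m) ≡ map proj₂ (rowsOf m)
labels-path m = trans (sym (rows-labels (pos 0) (path m))) (cong (map proj₂) (rows-path′ m))

-- The steps and labels drawn by the zeta map

unary : List Tree → Path
unary []             = []
unary (node _ c ∷ F) = replicate (length c) E ++ N ∷ unary F

unary-++ : ∀ F G → unary (F ++ G) ≡ unary F ++ unary G
unary-++ []             G = refl
unary-++ (node _ c ∷ F) G = trans (cong (λ z → replicate (length c) E ++ N ∷ z) (unary-++ F G))
  (sym (++-assoc (replicate (length c) E) _ _))

letter : Bool → Step
letter true  = E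
letter false = N

letters : Excursions → Path
letters = map (letter ∘ proj₁)

-- As `m` runs backwards, the roots above are listed from last to first and those below from first
-- to last, which is how the zeta map reads them. The latest excursion thus sits at one end of
-- `roots`, and `letters` peels this list from both ends.
aboveRoots belowRoots roots : Excursions → List Tree
aboveRoots []                = []
aboveRoots ((true  , t) ∷ m) = t ∷ aboveRoots m
aboveRoots ((false , t) ∷ m) = aboveRoots m
belowRoots []                = []
belowRoots ((true  , t) ∷ m) = belowRoots m
belowRoots ((false , t) ∷ m) = belowRoots m ++ t ∷ []
roots []                = []
roots ((true  , t) ∷ m) = t ∷ roots m
roots ((false , t) ∷ m) = roots m ++ t ∷ []

roots-split : ∀ m → roots m ≡ aboveRoots m ++ belowRoots m
roots-split []                = refl
roots-split ((true  , t) ∷ m) = cong (t ∷_) (roots-split m)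
roots-split ((false , t) ∷ m) = trans (cong (_++ t ∷ []) (roots-split m))
  (++-assoc (aboveRoots m) (belowRoots m) (t ∷ []))

scan-++ : ∀ d F G → scan d (F ++ G) ≡ scan d F ++ scan d G
scan-++ d []             G = refl
scan-++ d (node l c ∷ F) G = trans (cong (λ z → scan (suc d) c ++ (d , l) ∷ z) (scan-++ d F G))
  (sym (++-assoc (scan (suc d) c) _ _))

-- Except for the second pass of round 0, each pass of the zeta map reacts to rows on one side of
-- the diagonal only; here the other rows drop out.
concatMap-reverse-above : ∀ {B : Set} (f : ℤ × ℤ → List B) → (∀ x → f (rowBelow x) ≡ []) → ∀ m →
  concatMap f (reverse (rowsOf m)) ≡ concatMap (f ∘ rowAbove) (scan 0 (aboveRoots m))
concatMap-below : ∀ {B : Set} (f : ℤ × ℤ → List B) → (∀ x → f (rowAbove x) ≡ []) → ∀ m →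
  concatMap f (rowsOf m) ≡ concatMap (f ∘ rowBelow) (scan 0 (belowRoots m))

concatMap-[] : ∀ {A B : Set} (f : A → List B) {xs} → All (λ x → f x ≡ []) xs → concatMap f xs ≡ []
concatMap-[] f []       = refl
concatMap-[] f (e ∷ es) rewrite e = concatMap-[] f es

concatMap-reverse-above f e [] = refl
concatMap-reverse-above f e ((true , t) ∷ m)
  rewrite reverse-++ (rowsOf m) (map rowAbove (reverse (scan 0 (t ∷ []))))
        | sym (reverse-map rowAbove (reverse (scan 0 (t ∷ []))))
        | reverse-involutive (scan 0 (t ∷ []))
        | concatMap-++ f (map rowAbove (scan 0 (t ∷ []))) (reverse (rowsOf m))
        | concatMap-map f rowAbove (scan 0 (t ∷ []))
        | concatMap-reverse-above f e m
        | sym (concatMap-++ (f ∘ rowAbove) (scan 0 (t ∷ [])) (scan 0 (aboveRoots m)))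
        | sym (scan-++ 0 (t ∷ []) (aboveRoots m)) = refl
concatMap-reverse-above f e ((false , t) ∷ m)
  rewrite reverse-++ (rowsOf m) (map rowBelow (scan 0 (t ∷ [])))
        | sym (reverse-map rowBelow (scan 0 (t ∷ [])))
        | concatMap-++ f (map rowBelow (reverse (scan 0 (t ∷ [])))) (reverse (rowsOf m))
        | concatMap-map f rowBelow (reverse (scan 0 (t ∷ [])))
        | concatMap-[] (f ∘ rowBelow) {reverse (scan 0 (t ∷ []))} (All.universal e _) = concatMap-reverse-above f e m

concatMap-below f e [] = refl
concatMap-below f e ((true , t) ∷ m)
  rewrite concatMap-++ f (rowsOf m) (map rowAbove (reverse (scan 0 (t ∷ []))))
        | concatMap-map f rowAbove (reverse (scan 0 (t ∷ [])))
        | concatMap-[] (f ∘ rowAbove) {reverse (scan 0 (t ∷ []))} (All.universal e _)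
        | ++-identityʳ (concatMap f (rowsOf m)) = concatMap-below f e m
concatMap-below f e ((false , t) ∷ m)
  rewrite concatMap-++ f (rowsOf m) (map rowBelow (scan 0 (t ∷ [])))
        | concatMap-map f rowBelow (scan 0 (t ∷ []))
        | concatMap-below f e m
        | sym (concatMap-++ (f ∘ rowBelow) (scan 0 (belowRoots m)) (scan 0 (t ∷ [])))
        | sym (scan-++ 0 (belowRoots m) (t ∷ [])) = refl

infix 4 _=ⁿ_
_=ⁿ_ : ℕ → ℕ → Bool
m =ⁿ n = does (m ℕ.≟ n)

=ⁿ-refl : ∀ n → (n =ⁿ n) ≡ true
=ⁿ-refl n = dec-true (n ℕ.≟ n) refl

=ⁿ-≢ : ∀ {m n} → m ≢ n → (m =ⁿ n) ≡ false
=ⁿ-≢ {m} {n} = dec-false (m ℕ.≟ n)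

scan-depth : ∀ d F → All (λ x → d ≤ proj₁ x) (scan d F)
scan-depth d []             = []
scan-depth d (node l c ∷ F) = Allₚ.++⁺ (All.map (ℕₚ.≤-trans (ℕₚ.n≤1+n d)) (scan-depth (suc d) c))
  (ℕₚ.≤-refl ∷ scan-depth d F)

concatMap-top-level : ∀ (f : ℕ × ℤ → List B) d → (∀ d′ l → d ℕ.< d′ → f (d′ , l) ≡ []) → ∀ F →
  concatMap f (scan d F) ≡ concatMap (λ t → f (d , label t)) F
concatMap-top-level f d e []             = refl
concatMap-top-level f d e (node l c ∷ F)
  rewrite concatMap-++ f (scan (suc d) c) ((d , l) ∷ scan d F)
        | concatMap-[] f (All.map (λ {x} → e (proj₁ x) (proj₂ x)) (scan-depth (suc d) c))
        | concatMap-top-level f d e F = refl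

labelAt : ℕ → ℕ × ℤ → List ℤ
labelAt d (d′ , l) = if d′ =ⁿ d then l ∷ [] else []

stepAt : ℕ → ℕ × ℤ → Path
stepAt d (d′ , l) = if d′ =ⁿ suc d then E ∷ [] else if d′ =ⁿ d then N ∷ [] else []

labelAt-≢ : ∀ {d d′ l} → d′ ≢ d → labelAt d (d′ , l) ≡ []
labelAt-≢ ne rewrite =ⁿ-≢ ne = refl

stepAt-N : ∀ {d l} → stepAt d (d , l) ≡ N ∷ []
stepAt-N {d} rewrite =ⁿ-≢ (ℕₚ.<⇒≢ (ℕₚ.n<1+n d)) | =ⁿ-refl d = refl

stepAt-E : ∀ {d l} → stepAt d (suc d , l) ≡ E ∷ []
stepAt-E {d} rewrite =ⁿ-refl (suc d) = refl

stepAt-≢ : ∀ {d d′ l} → d′ ≢ suc d → d′ ≢ d → stepAt d (d′ , l) ≡ []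
stepAt-≢ ne ne′ rewrite =ⁿ-≢ ne | =ⁿ-≢ ne′ = refl

scan-labels : ∀ v d F → concatMap (labelAt (v + d)) (scan v F) ≡ labels (descend d F)
scan-labels v zero F rewrite ℕₚ.+-identityʳ v = begin
  concatMap (labelAt v) (scan v F)
    ≡⟨ concatMap-top-level (labelAt v) v (λ d′ l lt → labelAt-≢ (ℕₚ.>⇒≢ lt)) F ⟩
  concatMap (λ t → labelAt v (v , label t)) F
    ≡⟨ concatMap-cong (λ t → cong (λ b → if b then label t ∷ [] else []) (=ⁿ-refl v)) F ⟩
  concatMap (λ t → label t ∷ []) F
    ≡⟨ sym (concatMap-map (_∷ []) label F) ⟩
  concatMap (_∷ []) (labels F)
    ≡⟨ concatMap-pure (labels F) ⟩
  labels F ∎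
  where open ≡-Reasoning
scan-labels v (suc d) [] rewrite descend-[] d = refl
scan-labels v (suc d) (node l c ∷ F)
  rewrite concatMap-++ (labelAt (v + suc d)) (scan (suc v) c) ((v , l) ∷ scan v F)
        | labelAt-≢ {v + suc d} {v} {l} (ℕₚ.<⇒≢ (ℕₚ.m<m+n v (s≤s z≤n)))
        | scan-labels v (suc d) F
        | ℕₚ.+-suc v d
        | scan-labels (suc v) d c
        | descend-++ d c (kids F) = sym (labels-++ (descend d c) _)

concatMap-const : ∀ (x : B) (xs : List A) → concatMap (λ _ → x ∷ []) xs ≡ replicate (length xs) x
concatMap-const x []       = refl
concatMap-const x (_ ∷ xs) = cong (x ∷_) (concatMap-const x xs)

-- A postorder scan meets the subtree of a node just before the node itself, and of this subtree
-- only the children draw a step. This produces the block E^e N.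
scan-steps : ∀ v d F → concatMap (stepAt (v + d)) (scan v F) ≡ unary (descend d F)
scan-steps v zero [] = refl
scan-steps v zero (node l c ∷ F)
  rewrite concatMap-++ (stepAt (v + 0)) (scan (suc v) c) ((v , l) ∷ scan v F)
        | scan-steps v zero F
        | ℕₚ.+-identityʳ v
        | stepAt-N {v} {l}
        | concatMap-top-level (stepAt v) (suc v)
            (λ d′ l′ lt → stepAt-≢ {v} {d′} {l′} (ℕₚ.>⇒≢ lt) (ℕₚ.>⇒≢ (ℕₚ.<-trans (ℕₚ.n<1+n v) lt))) c
        | concatMap-cong (λ t → stepAt-E {v} {label t}) c
        | concatMap-const E c = refl
scan-steps v (suc d) [] rewrite descend-[] d = refl
scan-steps v (suc d) (node l c ∷ F)
  rewrite concatMap-++ (stepAt (v + suc d)) (scan (suc v) c) ((v , l) ∷ scan v F)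
        | stepAt-≢ {v + suc d} {v} {l} (ℕₚ.<⇒≢ (s≤s (ℕₚ.m≤m+n v (suc d)))) (ℕₚ.<⇒≢ (ℕₚ.m<m+n v (s≤s z≤n)))
        | scan-steps v (suc d) F
        | ℕₚ.+-suc v d
        | scan-steps (suc v) d c
        | descend-++ d c (kids F) = sym (unary-++ (descend d c) _)

neg-pos-injective : ∀ {d e} → - pos d ≡ - pos e → d ≡ e
neg-pos-injective = ℤₚ.+-injective ∘ ℤₚ.neg-injective

neg-pos≢pos : ∀ {d e} → - pos d ≢ pos (suc e)
neg-pos≢pos {zero}  ()
neg-pos≢pos {suc d} ()

neg-suc+1 : ∀ e → (- pos (suc e)) ℤ.+ pos 1 ≡ - pos e
neg-suc+1 zero    = refl
neg-suc+1 (suc e) = refl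

neg-1 : ∀ i → - pos i ℤ.- pos 1 ≡ - pos (suc i)
neg-1 zero    = refl
neg-1 (suc i) = cong (λ z → -[1+ suc z ]) (ℕₚ.+-identityʳ i)

=ᶻ-above : ∀ d e → (pos (suc d) =ᶻ pos (suc e)) ≡ (d =ⁿ e)
=ᶻ-above d e = does-⇔ (mk⇔ (ℕₚ.suc-injective ∘ ℤₚ.+-injective) (cong (pos ∘ suc)))
  (pos (suc d) ℤ.≟ pos (suc e)) (d ℕ.≟ e)

=ᶻ-below : ∀ d e → (- pos d =ᶻ - pos e) ≡ (d =ⁿ e)
=ᶻ-below d e = does-⇔ (mk⇔ neg-pos-injective (cong (-_ ∘ pos)))
  (- pos d ℤ.≟ - pos e) (d ℕ.≟ e)

=ᶻ-below-above : ∀ d e → (- pos d =ᶻ pos (suc e)) ≡ false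
=ᶻ-below-above d e = dec-false (- pos d ℤ.≟ pos (suc e)) neg-pos≢pos

=ᶻ-above-below : ∀ d e → (pos (suc d) =ᶻ - pos e) ≡ false
=ᶻ-above-below d e = dec-false (pos (suc d) ℤ.≟ - pos e) (neg-pos≢pos ∘ sym)

at-rows : ∀ R n → length R ≡ n →
  map (λ k → at (map proj₁ R) k , at (map proj₂ R) k) (oneTo n) ≡ R
at-rows R n e = trans (trans (cong (map _) (map-upTo suc n)) (map-applyUpTo suc _ n)) (go R n e)
  where
  go : ∀ R n → length R ≡ n →
    applyUpTo (λ i → at (map proj₁ R) (suc i) , at (map proj₂ R) (suc i)) n ≡ R
  go []      _ refl = refl
  go (x ∷ R) _ refl = cong (x ∷_) (go R _ refl)

module _ {m : Excursions} {n : ℕ} (len : length (rowsOf m) ≡ n) where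

  private
    π = steps (path m)
    σ = catMaybes (path m)

  concatMap-rows : ∀ {B : Set} (f : ℤ × ℤ → List B) →
    concatMap (λ k → f (at (areaVec π) k , at σ k)) (oneTo n) ≡ concatMap f (rowsOf m)
  concatMap-rows f rewrite areaVec-path m | labels-path m =
    trans (sym (concatMap-map f _ (oneTo n))) (cong (concatMap f) (at-rows (rowsOf m) n len))

  concatMap-reverse-rows : ∀ {B : Set} (f : ℤ × ℤ → List B) →
    concatMap (λ k → f (at (areaVec π) k , at σ k)) (reverse (oneTo n)) ≡ concatMap f (reverse (rowsOf m))
  concatMap-reverse-rows f rewrite areaVec-path m | labels-path m =
    trans (sym (concatMap-map f _ (reverse (oneTo n)))) (cong (concatMap f)
      (trans (reverse-map _ (oneTo n)) (cong reverse (at-rows (rowsOf m) n len))))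

  -- Label round i = e + 1 reads area i = e + 1 above and area - i + 1 = - e below: both are depth
  -- `e`. The sign given to the second group undoes the negation of the labels below.
  zetaLabels-path : ∀ e → zetaLabels n π σ (suc e) ≡ labels (descend e (roots m))
  zetaLabels-path e = begin
    zetaLabels n π σ (suc e)
      ≡⟨ cong₂ _++_ (concatMap-reverse-rows f) (concatMap-rows g) ⟩
    concatMap f (reverse (rowsOf m)) ++ concatMap g (rowsOf m)
      ≡⟨ cong₂ _++_
           (trans (concatMap-reverse-above f f-below m) (concatMap-cong f-above (scan 0 (aboveRoots m))))
           (trans (concatMap-below g g-above m) (concatMap-cong g-below (scan 0 (belowRoots m)))) ⟩
    concatMap (labelAt e) (scan 0 (aboveRoots m)) ++ concatMap (labelAt e) (scan 0 (belowRoots m))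
      ≡⟨ cong₂ _++_ (scan-labels 0 e (aboveRoots m)) (scan-labels 0 e (belowRoots m)) ⟩
    labels (descend e (aboveRoots m)) ++ labels (descend e (belowRoots m))
      ≡⟨ sym (labels-++ (descend e (aboveRoots m)) _) ⟩
    labels (descend e (aboveRoots m) ++ descend e (belowRoots m))
      ≡⟨ cong labels (sym (descend-++ e (aboveRoots m) _)) ⟩
    labels (descend e (aboveRoots m ++ belowRoots m))
      ≡⟨ cong (labels ∘ descend e) (sym (roots-split m)) ⟩
    labels (descend e (roots m)) ∎
    where
    open ≡-Reasoning
    f g : ℤ × ℤ → List ℤ
    f (a , s) = if a =ᶻ pos (suc e) then s ∷ [] else []
    g (a , s) = if a =ᶻ ((- pos (suc e)) ℤ.+ pos 1) then - s ∷ [] else []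
    f-below : ∀ x → f (rowBelow x) ≡ []
    f-below (d , l) rewrite =ᶻ-below-above d e = refl
    f-above : ∀ x → f (rowAbove x) ≡ labelAt e x
    f-above (d , l) rewrite =ᶻ-above d e = refl
    g-above : ∀ x → g (rowAbove x) ≡ []
    g-above (d , l) rewrite neg-suc+1 e | =ᶻ-above-below d e = refl
    g-below : ∀ x → g (rowBelow x) ≡ labelAt e x
    g-below (d , l) rewrite neg-suc+1 e | =ᶻ-below d e | ℤₚ.neg-involutive l = refl

  zetaU-path : zetaU n π σ ≡ labels (nodes n (roots m))
  zetaU-path = trans (cong (concatMap (zetaLabels n π σ))
      (trans (sym (reverse-map suc (upTo n))) (cong (map suc) (reverse-upTo n)))) (go n)
    where
    go : ∀ k → concatMap (zetaLabels n π σ) (map suc (downFrom k)) ≡ labels (nodes k (roots m))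
    go zero    = refl
    go (suc k) = trans (cong₂ _++_ (zetaLabels-path k) (go k))
      (trans (sym (labels-++ (descend k (roots m)) _)) (cong labels (sym (nodes-unfold-top k (roots m)))))

scan-tree-[] : ∀ (f : ℕ × ℤ → List B) → (∀ d l → f (suc d , l) ≡ []) → ∀ d c → concatMap f (scan (suc d) c) ≡ []
scan-tree-[] f e d c = concatMap-[] f (All.map (λ { {suc d′ , l} (s≤s _) → e d′ l }) (scan-depth (suc d) c))

-- For the second pass of round 0: areas 1 and 0 are the roots above and below, hence one letter per
-- excursion, and reading from right to left starts with the last one.
concatMap-letters : ∀ (f : ℤ × ℤ → Path) → (∀ d l → f (rowAbove (suc d , l)) ≡ []) →
  (∀ d l → f (rowBelow (suc d , l)) ≡ []) → (∀ l → f (rowAbove (0 , l)) ≡ E ∷ []) →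
  (∀ l → f (rowBelow (0 , l)) ≡ N ∷ []) → ∀ m → concatMap f (reverse (rowsOf m)) ≡ letters m
concatMap-letters f a b a₀ b₀ [] = refl
concatMap-letters f a b a₀ b₀ ((true , node l c) ∷ m)
  rewrite reverse-++ (rowsOf m) (map rowAbove (reverse (scan 0 (node l c ∷ []))))
        | sym (reverse-map rowAbove (reverse (scan 0 (node l c ∷ []))))
        | reverse-involutive (scan 0 (node l c ∷ []))
        | concatMap-++ f (map rowAbove (scan 0 (node l c ∷ []))) (reverse (rowsOf m))
        | concatMap-map f rowAbove (scan 0 (node l c ∷ []))
        | concatMap-++ (f ∘ rowAbove) (scan 1 c) ((0 , l) ∷ [])
        | scan-tree-[] (f ∘ rowAbove) a 0 c
        | a₀ l = cong (E ∷_) (concatMap-letters f a b a₀ b₀ m)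
concatMap-letters f a b a₀ b₀ ((false , node l c) ∷ m)
  rewrite reverse-++ (rowsOf m) (map rowBelow (scan 0 (node l c ∷ [])))
        | sym (reverse-map rowBelow (scan 0 (node l c ∷ [])))
        | concatMap-++ f (map rowBelow (reverse (scan 0 (node l c ∷ [])))) (reverse (rowsOf m))
        | concatMap-map f rowBelow (reverse (scan 0 (node l c ∷ [])))
        | reverse-++ (scan 1 c) ((0 , l) ∷ [])
        | concatMap-[] (f ∘ rowBelow) {reverse (scan 1 c)}
            (↭ₚ.All-resp-↭ (↭-sym (↭ₚ.↭-reverse (scan 1 c)))
              (All.map (λ { {suc d′ , l} (s≤s _) → b d′ l }) (scan-depth 1 c)))
        | b₀ l = cong (N ∷_) (concatMap-letters f a b a₀ b₀ m)

module _ (m : Excursions) where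

  private
    a = areaVec (steps (path m))

    outer inner : ℕ → ℤ → Path
    outer i x = if x =ᶻ (- pos i ℤ.- pos 1) then E ∷ [] else if x =ᶻ (- pos i) then N ∷ [] else []
    inner i x = if x =ᶻ pos (suc i) then E ∷ [] else if x =ᶻ pos i then N ∷ [] else []

  outer-path : ∀ i → concatMap (outer i) a ≡ unary (descend i (belowRoots m))
  outer-path i rewrite areaVec-path m = begin
    concatMap (outer i) (map proj₁ (rowsOf m))
      ≡⟨ concatMap-map (outer i) proj₁ (rowsOf m) ⟩
    concatMap (outer i ∘ proj₁) (rowsOf m)
      ≡⟨ concatMap-below (outer i ∘ proj₁) off m ⟩
    concatMap (outer i ∘ proj₁ ∘ rowBelow) (scan 0 (belowRoots m))
      ≡⟨ concatMap-cong on (scan 0 (belowRoots m)) ⟩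
    concatMap (stepAt i) (scan 0 (belowRoots m))
      ≡⟨ scan-steps 0 i (belowRoots m) ⟩
    unary (descend i (belowRoots m)) ∎
    where
    open ≡-Reasoning
    off : ∀ x → outer i (proj₁ (rowAbove x)) ≡ []
    off (d , l) rewrite neg-1 i | =ᶻ-above-below d (suc i) | =ᶻ-above-below d i = refl
    on : ∀ x → outer i (proj₁ (rowBelow x)) ≡ stepAt i x
    on (d , l) rewrite neg-1 i | =ᶻ-below d (suc i) | =ᶻ-below d i = refl

  inner-path : ∀ i → concatMap (inner (suc i)) (reverse a) ≡ unary (descend i (aboveRoots m))
  inner-path i rewrite areaVec-path m = begin
    concatMap (inner (suc i)) (reverse (map proj₁ (rowsOf m)))
      ≡⟨ cong (concatMap (inner (suc i))) (sym (reverse-map proj₁ (rowsOf m))) ⟩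
    concatMap (inner (suc i)) (map proj₁ (reverse (rowsOf m)))
      ≡⟨ concatMap-map (inner (suc i)) proj₁ (reverse (rowsOf m)) ⟩
    concatMap (inner (suc i) ∘ proj₁) (reverse (rowsOf m))
      ≡⟨ concatMap-reverse-above (inner (suc i) ∘ proj₁) off m ⟩
    concatMap (inner (suc i) ∘ proj₁ ∘ rowAbove) (scan 0 (aboveRoots m))
      ≡⟨ concatMap-cong on (scan 0 (aboveRoots m)) ⟩
    concatMap (stepAt i) (scan 0 (aboveRoots m))
      ≡⟨ scan-steps 0 i (aboveRoots m) ⟩
    unary (descend i (aboveRoots m)) ∎
    where
    open ≡-Reasoning
    off : ∀ x → inner (suc i) (proj₁ (rowBelow x)) ≡ []
    off (d , l) rewrite =ᶻ-below-above d (suc i) | =ᶻ-below-above d i = refl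
    on : ∀ x → inner (suc i) (proj₁ (rowAbove x)) ≡ stepAt i x
    on (d , l) rewrite =ᶻ-above d (suc i) | =ᶻ-above d i = refl

  inner-path₀ : concatMap (inner 0) (reverse a) ≡ letters m
  inner-path₀ rewrite areaVec-path m = begin
    concatMap (inner 0) (reverse (map proj₁ (rowsOf m)))
      ≡⟨ cong (concatMap (inner 0)) (sym (reverse-map proj₁ (rowsOf m))) ⟩
    concatMap (inner 0) (map proj₁ (reverse (rowsOf m)))
      ≡⟨ concatMap-map (inner 0) proj₁ (reverse (rowsOf m)) ⟩
    concatMap (inner 0 ∘ proj₁) (reverse (rowsOf m))
      ≡⟨ concatMap-letters (inner 0 ∘ proj₁) (λ _ _ → refl) (λ _ _ → refl) (λ _ → refl) (λ _ → refl) m ⟩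
    letters m ∎
    where open ≡-Reasoning

  -- The rounds are out of step with the levels: round i draws depth i below and then depth i - 1
  -- above. The front term is the lower half of level `k`, whose upper half belongs to round k + 1;
  -- it is empty once `k` reaches the height.
  rounds-path : ∀ k → concatMap (zetaRound a) (downFrom (suc k)) ≡
    unary (descend k (belowRoots m)) ++ unary (nodes k (roots m)) ++ letters m
  rounds-path zero rewrite outer-path 0 | inner-path₀ = ++-identityʳ _
  rounds-path (suc k)
    rewrite outer-path (suc k)
          | inner-path k
          | rounds-path k
          | nodes-unfold-top k (roots m)
          | roots-split m
          | descend-++ k (aboveRoots m) (belowRoots m)
          | unary-++ (descend k (aboveRoots m) ++ descend k (belowRoots m)) (nodes k (aboveRoots m ++ belowRoots m))
          | unary-++ (descend k (aboveRoots m)) (descend k (belowRoots m)) =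
    trans (++-assoc (unary (descend (suc k) (belowRoots m))) _ _)
      (cong (unary (descend (suc k) (belowRoots m)) ++_)
        (trans (sym (++-assoc U _ _)) (sym (++-assoc (U ++ V) _ _))))
    where
    U = unary (descend k (aboveRoots m))
    V = unary (descend k (belowRoots m))

-- Lengths, and the image of an encoded path

length-scan : ∀ d F → length (scan d F) ≡ size F
length-scan d []             = refl
length-scan d (node l c ∷ F) = begin
  length (scan (suc d) c ++ (d , l) ∷ scan d F)      ≡⟨ length-++ (scan (suc d) c) ⟩
  length (scan (suc d) c) + suc (length (scan d F)) ≡⟨ cong₂ (λ x y → x + suc y) (length-scan (suc d) c) (length-scan d F) ⟩
  size c + suc (size F)                             ≡⟨ ℕₚ.+-suc (size c) (size F) ⟩
  suc (size c + size F)                             ∎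
  where open ≡-Reasoning

length-rowsOf : ∀ m → length (rowsOf m) ≡ size (roots m)
length-rowsOf []                = refl
length-rowsOf ((true  , t) ∷ m)
  rewrite length-++ (rowsOf m) {map rowAbove (reverse (scan 0 (t ∷ [])))}
        | length-map rowAbove (reverse (scan 0 (t ∷ [])))
        | length-reverse (scan 0 (t ∷ []))
        | length-scan 0 (t ∷ [])
        | length-rowsOf m = trans (ℕₚ.+-comm _ (size (t ∷ []))) (sym (size-++ (t ∷ []) (roots m)))
length-rowsOf ((false , t) ∷ m)
  rewrite length-++ (rowsOf m) {map rowBelow (scan 0 (t ∷ []))}
        | length-map rowBelow (scan 0 (t ∷ []))
        | length-scan 0 (t ∷ [])
        | length-rowsOf m = sym (size-++ (roots m) (t ∷ []))

length-roots : ∀ m → length (roots m) ≡ length m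
length-roots []                = refl
length-roots ((true  , t) ∷ m) = cong suc (length-roots m)
length-roots ((false , t) ∷ m) = trans (length-++-comm (roots m) (t ∷ [])) (cong suc (length-roots m))

length-unary : ∀ F → length (unary F) ≡ length (kids F) + length F
length-unary []             = refl
length-unary (node l c ∷ F) = begin
  length (replicate (length c) E ++ N ∷ unary F)     ≡⟨ length-++ (replicate (length c) E) ⟩
  length (replicate (length c) E) + suc (length (unary F)) ≡⟨ cong₂ (λ x y → x + suc y) (length-replicate (length c)) (length-unary F) ⟩
  length c + suc (length (kids F) + length F)        ≡⟨ cong (length c +_) (sym (ℕₚ.+-suc (length (kids F)) (length F))) ⟩
  length c + (length (kids F) + suc (length F))      ≡⟨ sym (ℕₚ.+-assoc (length c) _ _) ⟩
  length c + length (kids F) + suc (length F)        ≡⟨ cong (_+ suc (length F)) (sym (length-++ c)) ⟩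
  length (c ++ kids F) + suc (length F)              ∎
  where open ≡-Reasoning

reading : Excursions → List Tree
reading m = nodes (size (roots m)) (roots m)

ballot : Excursions → Path
ballot m = unary (reading m) ++ letters m

roots-exhausted : ∀ m → descend (size (roots m)) (roots m) ≡ []
roots-exhausted m = descend-exhausted _ (roots m) ℕₚ.≤-refl

kids-reading : ∀ m → kids (reading m) ++ roots m ≡ reading m
kids-reading m = kids-nodes (size (roots m)) (roots m) (roots-exhausted m)

length-reading : ∀ m → length (reading m) ≡ size (roots m)
length-reading m = nodes-length (size (roots m)) (roots m) (roots-exhausted m)

length-kids-reading : ∀ m → length (kids (reading m)) + length m ≡ size (roots m)
length-kids-reading m = trans (cong (length (kids (reading m)) +_) (sym (length-roots m)))
  (trans (sym (length-++ (kids (reading m)))) (trans (cong length (kids-reading m)) (length-reading m)))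

-- Every node draws one N, every child one E and every root one letter, which is two steps per node.
-- Hence the `take (n + n)` in `zetaC` cuts nothing off.
length-ballot : ∀ m → length (ballot m) ≡ size (roots m) + size (roots m)
length-ballot m = begin
  length (unary (reading m) ++ letters m)          ≡⟨ length-++ (unary (reading m)) ⟩
  length (unary (reading m)) + length (letters m)  ≡⟨ cong₂ _+_ (length-unary (reading m)) (length-map _ m) ⟩
  (k + length (reading m)) + length m              ≡⟨ cong (λ z → k + z + length m) (length-reading m) ⟩
  (k + s) + length m                               ≡⟨ cong (_+ length m) (ℕₚ.+-comm k s) ⟩
  (s + k) + length m                               ≡⟨ ℕₚ.+-assoc s k (length m) ⟩
  s + (k + length m)                               ≡⟨ cong (s +_) (length-kids-reading m) ⟩
  s + s                                            ∎
  where
  open ≡-Reasoning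
  s = size (roots m)
  k = length (kids (reading m))

zeta-path : ∀ m → zeta (size (roots m)) (steps (path m)) (catMaybes (path m)) ≡
  (ballot m , labels (reading m) ++ map -_ (reverse (labels (reading m))))
zeta-path m = cong₂ _,_ β-eq (cong (λ u → u ++ map -_ (reverse u)) (zetaU-path {m} (length-rowsOf m)))
  where
  n = size (roots m)
  below-exhausted : descend n (belowRoots m) ≡ []
  below-exhausted = descend-exhausted n (belowRoots m)
    (ℕₚ.≤-trans (ℕₚ.m≤n+m _ (size (aboveRoots m)))
      (ℕₚ.≤-reflexive (trans (sym (size-++ (aboveRoots m) _)) (cong size (sym (roots-split m))))))
  β-eq : zetaC n (steps (path m)) ≡ ballot m
  β-eq = trans (cong (take (n + n)) (trans (rounds-path m n) (cong (λ G → unary G ++ ballot m) below-exhausted)))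
    (trans (cong (λ k → take k (ballot m)) (sym (length-ballot m)))
      (take-all (length (ballot m)) (ballot m) ℕₚ.≤-refl))

-- The labels up to permutation

content : List Tree → List ℤ
content []             = []
content (node l c ∷ F) = content c ++ l ∷ content F

content-++ : ∀ F G → content (F ++ G) ≡ content F ++ content G
content-++ []             G = refl
content-++ (node l c ∷ F) G = trans (cong (λ z → content c ++ l ∷ z) (content-++ F G))
  (sym (++-assoc (content c) _ _))

scan-content : ∀ d F → map proj₂ (scan d F) ≡ content F
scan-content d []             = refl
scan-content d (node l c ∷ F) = trans (map-++ proj₂ (scan (suc d) c) _)
  (cong₂ (λ x y → x ++ l ∷ y) (scan-content (suc d) c) (scan-content d F))

content-kids : ∀ F → content F ↭ content (kids F) ++ labels F
content-kids []             = ↭-refl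
content-kids (node l c ∷ F) =
  ↭-trans (↭ₚ.++⁺ˡ (content c) (↭-trans (prep l (content-kids F)) (↭-sym (↭ₚ.shift l (content (kids F)) (labels F)))))
    (↭-reflexive (trans (sym (++-assoc (content c) (content (kids F)) _))
      (cong (_++ l ∷ labels F) (sym (content-++ c (kids F))))))

labels-nodes : ∀ h F → descend h F ≡ [] → labels (nodes h F) ↭ content F
labels-nodes zero    F e rewrite e = ↭-refl
labels-nodes (suc h) F e = ↭-trans (↭-reflexive (labels-++ (nodes h (kids F)) F))
  (↭-trans (↭ₚ.++⁺ʳ (labels F) (labels-nodes h (kids F) e)) (↭-sym (content-kids F)))

∣content∣ : List Tree → List ℕ
∣content∣ F = map ∣_∣ (content F)

-- Rows below carry negated labels, so the two lists agree in absolute value, which is what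
-- `IsSignedPerm` looks at.
∣rowsOf∣ : ∀ m → map ∣_∣ (map proj₂ (rowsOf m)) ↭ ∣content∣ (roots m)
∣rowsOf∣ [] = ↭-refl
∣rowsOf∣ ((true , t) ∷ m)
  rewrite map-++ proj₂ (rowsOf m) (map rowAbove (reverse (scan 0 (t ∷ []))))
        | map-++ ∣_∣ (map proj₂ (rowsOf m)) (map proj₂ (map rowAbove (reverse (scan 0 (t ∷ [])))))
        | sym (map-∘ {g = proj₂} {f = rowAbove} (reverse (scan 0 (t ∷ []))))
        | reverse-map proj₂ (scan 0 (t ∷ []))
        | scan-content 0 (t ∷ [])
        | reverse-map ∣_∣ (content (t ∷ []))
        | content-++ (t ∷ []) (roots m)
        | map-++ ∣_∣ (content (t ∷ [])) (content (roots m)) =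
  ↭-trans (↭ₚ.++⁺ (∣rowsOf∣ m) (↭ₚ.↭-reverse (∣content∣ (t ∷ []))))
    (↭ₚ.++-comm (∣content∣ (roots m)) (∣content∣ (t ∷ [])))
∣rowsOf∣ ((false , t) ∷ m)
  rewrite map-++ proj₂ (rowsOf m) (map rowBelow (scan 0 (t ∷ [])))
        | map-++ ∣_∣ (map proj₂ (rowsOf m)) (map proj₂ (map rowBelow (scan 0 (t ∷ []))))
        | content-++ (roots m) (t ∷ [])
        | map-++ ∣_∣ (content (roots m)) (content (t ∷ [])) =
  ↭ₚ.++⁺ (∣rowsOf∣ m) (↭-reflexive (trans (sym (map-∘ {g = ∣_∣} {f = proj₂} (map rowBelow (scan 0 (t ∷ [])))))
    (trans (sym (map-∘ {g = ∣_∣ ∘ proj₂} {f = rowBelow} (scan 0 (t ∷ []))))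
    (trans (map-cong (λ x → ℤₚ.∣-i∣≡∣i∣ (proj₂ x)) (scan 0 (t ∷ [])))
    (trans (map-∘ {g = ∣_∣} {f = proj₂} (scan 0 (t ∷ []))) (cong (map ∣_∣) (scan-content 0 (t ∷ []))))))))

∣labels-path∣ : ∀ m → map ∣_∣ (catMaybes (path m)) ↭ map ∣_∣ (labels (reading m))
∣labels-path∣ m = ↭-trans (↭-reflexive (cong (map ∣_∣) (labels-path m)))
  (↭-trans (∣rowsOf∣ m) (↭-sym (↭ₚ.map⁺ ∣_∣ (labels-nodes (size (roots m)) (roots m) (roots-exhausted m)))))

-- The rise condition

infix 4 _≺_
_≺_ : Maybe ℤ → ℤ → Set
just x  ≺ y = x ℤ.< y
nothing ≺ y = ⊤

-- The rise condition for a path preceded by a North step with label x (just x) or by an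
-- East step (nothing).
Rising : Maybe ℤ → LPath → Set
Rising x []            = ⊤
Rising x (just l ∷ p)  = (x ≺ l) × Rising (just l) p
Rising x (nothing ∷ p) = Rising nothing p

-- Above the diagonal the last listed child is the first one along the path, and its North step
-- directly follows that of its parent. Below, it is the last one along the path, directly before
-- its parent, with both labels negated. Either rise says that the child has the larger label.
LastAbove : Maybe ℤ → List Tree → Set
LastAbove x []          = ⊤
LastAbove x (t ∷ [])    = x ≺ label t
LastAbove x (_ ∷ t ∷ F) = LastAbove x (t ∷ F)

-- Both the rise condition and the valley condition compare a node with its last child.
Sorted : List Tree → Set
Sorted []             = ⊤
Sorted (node l c ∷ F) = LastAbove (just l) c × Sorted c × Sorted F

-- The label before the first excursion is 0, which encodes the condition σ₁ > 0.
lastLabel : Excursions → Maybe ℤ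
lastLabel []                = just (pos 0)
lastLabel ((true  , t) ∷ m) = nothing
lastLabel ((false , t) ∷ m) = just (- label t)

-- Between two excursions a rise needs an earlier one below, which ends with N, and a later one
-- above, which starts with N.
SortedRoots : Excursions → Set
SortedRoots []                = ⊤
SortedRoots ((true  , t) ∷ m) = (lastLabel m ≺ label t) × SortedRoots m
SortedRoots ((false , t) ∷ m) = SortedRoots m

Sorted-++ : ∀ F G → Sorted (F ++ G) ⇔ (Sorted F × Sorted G)
Sorted-++ []             G = mk⇔ (tt ,_) proj₂
Sorted-++ (node l c ∷ F) G = mk⇔
  (λ { (a , b , s) → let (f , g) = to s in (a , b , f) , g })
  (λ { ((a , b , f) , g) → a , b , from (f , g) })
  where open Equivalence (Sorted-++ F G)

afterAbove : Maybe ℤ → List Tree → Maybe ℤ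
afterAbove x []      = x
afterAbove x (_ ∷ _) = nothing

afterBelow : Maybe ℤ → List Tree → Maybe ℤ
afterBelow x []          = x
afterBelow x (t ∷ [])    = just (- label t)
afterBelow x (_ ∷ t ∷ F) = afterBelow x (t ∷ F)

LastAbove-∷ : ∀ x t F → LastAbove x (t ∷ F) ⇔ (LastAbove x F × (afterAbove x F ≺ label t))
LastAbove-∷ x t []      = mk⇔ (tt ,_) proj₂
LastAbove-∷ x t (_ ∷ _) = mk⇔ (_, tt) proj₁

Rising-above : ∀ x F p → Rising x (above F ++ p) ⇔ (LastAbove x F × Sorted F × Rising (afterAbove x F) p)
Rising-above x []             p = mk⇔ (λ r → tt , tt , r) (proj₂ ∘ proj₂)
Rising-above x (node l c ∷ F) p
  rewrite ++-assoc (above F) (just l ∷ above c ++ nothing ∷ []) p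
        | ++-assoc (above c) (nothing ∷ []) p = mk⇔
  (λ r → let (a , s , b , r′) = Equivalence.to (Rising-above x F (just l ∷ above c ++ nothing ∷ p)) r
             (a′ , s′ , r″) = Equivalence.to (Rising-above (just l) c (nothing ∷ p)) r′
         in Equivalence.from (LastAbove-∷ x (node l c) F) (a , b) , (a′ , s′ , s) , r″)
  (λ { (a , (a′ , s′ , s) , r) →
       let (a″ , b) = Equivalence.to (LastAbove-∷ x (node l c) F) a
       in Equivalence.from (Rising-above x F (just l ∷ above c ++ nothing ∷ p)) (a″ , s , b ,
            Equivalence.from (Rising-above (just l) c (nothing ∷ p)) (a′ , s′ , r)) })

afterBelow-≺ : ∀ l F → (afterBelow nothing F ≺ - l) ⇔ LastAbove (just l) F
afterBelow-≺ l []          = mk⇔ id id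
afterBelow-≺ l (t ∷ [])    = mk⇔ ℤₚ.neg-cancel-< ℤₚ.neg-mono-<
afterBelow-≺ l (_ ∷ t ∷ F) = afterBelow-≺ l (t ∷ F)

afterBelow-∷ : ∀ x t F → afterBelow x (t ∷ F) ≡ afterBelow (just (- label t)) F
afterBelow-∷ x t []          = refl
afterBelow-∷ x t (_ ∷ [])    = refl
afterBelow-∷ x t (_ ∷ s ∷ F) = afterBelow-∷ x t (s ∷ F)

Rising-below : ∀ x F p → Rising x (below F ++ p) ⇔ (Sorted F × Rising (afterBelow x F) p)
Rising-below x []             p = mk⇔ (tt ,_) proj₂
Rising-below x (node l c ∷ F) p
  rewrite ++-assoc (below c) (just (- l) ∷ below F) p | afterBelow-∷ x (node l c) F = mk⇔
  (λ r → let (s , b , r′) = Equivalence.to (Rising-below nothing c (just (- l) ∷ below F ++ p)) r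
             (s′ , r″) = Equivalence.to (Rising-below (just (- l)) F p) r′
         in (Equivalence.to (afterBelow-≺ l c) b , s , s′) , r″)
  (λ { ((a , s , s′) , r) → Equivalence.from (Rising-below nothing c (just (- l) ∷ below F ++ p))
       (s , Equivalence.from (afterBelow-≺ l c) a , Equivalence.from (Rising-below (just (- l)) F p) (s′ , r)) })

Rising-path : ∀ m p → Rising (just (pos 0)) (path m ++ p) ⇔
  (SortedRoots m × Sorted (roots m) × Rising (lastLabel m) p)
Rising-path []                p = mk⇔ (λ r → tt , tt , r) (proj₂ ∘ proj₂)
Rising-path ((true , node l c) ∷ m) p rewrite ++-assoc (path m) (above (node l c ∷ [])) p = mk⇔
  (λ r → let (q , s , r′) = Equivalence.to (Rising-path m (above (node l c ∷ []) ++ p)) r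
             (b , (a , s′ , _) , r″) = Equivalence.to (Rising-above (lastLabel m) (node l c ∷ []) p) r′
         in (b , q) , (a , s′ , s) , r″)
  (λ { ((b , q) , (a , s′ , s) , r) → Equivalence.from (Rising-path m (above (node l c ∷ []) ++ p))
       (q , s , Equivalence.from (Rising-above (lastLabel m) (node l c ∷ []) p) (b , (a , s′ , tt) , r)) })
Rising-path ((false , t) ∷ m) p rewrite ++-assoc (path m) (below (t ∷ [])) p = mk⇔
  (λ r → let (q , s , r′) = Equivalence.to (Rising-path m (below (t ∷ []) ++ p)) r
             (s′ , r″) = Equivalence.to (Rising-below (lastLabel m) (t ∷ []) p) r′
         in q , Equivalence.from (Sorted-++ (roots m) (t ∷ [])) (s , s′) , r″)
  (λ { (q , s , r) → let (s₁ , s₂) = Equivalence.to (Sorted-++ (roots m) (t ∷ [])) s in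
       Equivalence.from (Rising-path m (below (t ∷ []) ++ p)) (q , s₁ , Equivalence.from (Rising-below (lastLabel m) (t ∷ []) p) (s₂ , r)) })

RisesOK : Path → List ℤ → Set
RisesOK π σ = (∀ i → i ∈ rises π → at σ i ℤ.< at σ (suc i)) × (headStep π ≡ just N → pos 0 ℤ.< at σ 1)

FirstRise : Maybe ℤ → LPath → Set
FirstRise x (just l ∷ p) = x ≺ l
FirstRise x _            = ⊤

Rising-first : ∀ x p → Rising x p ⇔ (FirstRise x p × Rising nothing p)
Rising-first x []            = mk⇔ (tt ,_) proj₂
Rising-first x (just l ∷ p)  = mk⇔ (λ { (a , r) → a , tt , r }) (λ { (a , _ , r) → a , r })
Rising-first x (nothing ∷ p) = mk⇔ (tt ,_) proj₂

-- `rises` speaks of absolute positions while `Rising` consumes labels along the path, so labels are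
-- read through a function `s`, of which `p` determines only the values beyond `k`.
risesAux-Rising : ∀ (s : ℕ → ℤ) k p → (∀ i → s (k + suc i) ≡ at (catMaybes p) (suc i)) →
  (∀ i → i ∈ risesAux k (steps p) → s i ℤ.< s (suc i)) ⇔ Rising nothing p
risesAux-Rising s k [] e = mk⇔ (λ _ → tt) (λ { _ i () })
risesAux-Rising s k (nothing ∷ p) e = risesAux-Rising s k p e
risesAux-Rising s k (just x ∷ p) e = mk⇔
  (λ h → tt , Equivalence.from (Rising-first (just x) p)
    (first p e (λ j → h (suc k) j) , Equivalence.to IH (λ i i∈ → h i (later p i∈))))
  (λ { (_ , r) → let (a , r′) = Equivalence.to (Rising-first (just x) p) r in
       λ i i∈ → split p e a (Equivalence.from IH r′) i i∈ })
  where
  IH = risesAux-Rising s (suc k) p (λ i → trans (cong s (sym (ℕₚ.+-suc k (suc i)))) (e (suc i)))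
  -- The helpers take the tail `p` as an argument because `risesAux` decides on a rise only after
  -- seeing the first step of the tail.
  value : ∀ p → (∀ i → s (k + suc i) ≡ at (catMaybes (just x ∷ p)) (suc i)) → s (suc k) ≡ x
  value p e = trans (cong s (ℕₚ.+-comm 1 k)) (e 0)
  value₂ : ∀ y p → (∀ i → s (k + suc i) ≡ at (catMaybes (just x ∷ just y ∷ p)) (suc i)) → s (suc (suc k)) ≡ y
  value₂ y p e = trans (cong s (ℕₚ.+-comm 2 k)) (e 1)
  first : ∀ p → (∀ i → s (k + suc i) ≡ at (catMaybes (just x ∷ p)) (suc i)) →
    (suc k ∈ risesAux k (N ∷ steps p) → s (suc k) ℤ.< s (suc (suc k))) → FirstRise (just x) p
  first []            e h = tt
  first (nothing ∷ p) e h = tt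
  first (just y ∷ p)  e h = subst₂ ℤ._<_ (value (just y ∷ p) e) (value₂ y p e) (h (here refl))
  later : ∀ p {i} → i ∈ risesAux (suc k) (steps p) → i ∈ risesAux k (N ∷ steps p)
  later []            i∈ = i∈
  later (nothing ∷ p) i∈ = i∈
  later (just y ∷ p)  i∈ = there i∈
  split : ∀ p → (∀ i → s (k + suc i) ≡ at (catMaybes (just x ∷ p)) (suc i)) → FirstRise (just x) p →
    (∀ i → i ∈ risesAux (suc k) (steps p) → s i ℤ.< s (suc i)) →
    ∀ i → i ∈ risesAux k (N ∷ steps p) → s i ℤ.< s (suc i)
  split []            e a h i i∈         = h i i∈
  split (nothing ∷ p) e a h i i∈         = h i i∈
  split (just y ∷ p)  e a h i (here refl) = subst₂ ℤ._<_ (sym (value (just y ∷ p) e)) (sym (value₂ y p e)) a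
  split (just y ∷ p)  e a h i (there i∈) = h i i∈

RisesOK-Rising : ∀ p → RisesOK (steps p) (catMaybes p) ⇔ Rising (just (pos 0)) p
RisesOK-Rising p = mk⇔
  (λ { (r , h) → Equivalence.from (Rising-first _ p) (start p h , Equivalence.to R r) })
  (λ r → let (f , r′) = Equivalence.to (Rising-first _ p) r in Equivalence.from R r′ , start⁻ p f)
  where
  R = risesAux-Rising (at (catMaybes p)) 0 p (λ _ → refl)
  start : ∀ p → (headStep (steps p) ≡ just N → pos 0 ℤ.< at (catMaybes p) 1) → FirstRise (just (pos 0)) p
  start []            h = tt
  start (just l ∷ p)  h = h refl
  start (nothing ∷ p) h = tt
  start⁻ : ∀ p → FirstRise (just (pos 0)) p → headStep (steps p) ≡ just N → pos 0 ℤ.< at (catMaybes p) 1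
  start⁻ (just l ∷ p) f _ = f

RisesOK-path : ∀ m → RisesOK (steps (path m)) (catMaybes (path m)) ⇔ (SortedRoots m × Sorted (roots m))
RisesOK-path m = mk⇔
  (λ h → let (q , s , _) = to (subst (Rising _) (sym (++-identityʳ (path m))) (Equivalence.to (RisesOK-Rising (path m)) h)) in q , s)
  (λ { (q , s) → Equivalence.from (RisesOK-Rising (path m))
         (subst (Rising _) (++-identityʳ (path m)) (from (q , s , tt))) })
  where open Equivalence (Rising-path m [])

-- The valley condition

-- The pending East labels u and the pending North labels v, read along a path; the end of
-- the path compares with 0.
East≻ : List ℤ → List ℤ → Path → Set
East≻ u v []      = pos 0 ℤ.< at u 1
East≻ u v (N ∷ p) = at v 1 ℤ.< at u 1
East≻ u v (E ∷ p) = ⊤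

Falling : List ℤ → List ℤ → Path → Set
Falling u v []      = ⊤
Falling u v (N ∷ p) = Falling u (drop 1 v) p
Falling u v (E ∷ p) = East≻ u v p × Falling (drop 1 u) v p

SortedNode : Tree → Set
SortedNode t = LastAbove (just (label t)) (children t)

Sorted-kids : ∀ F → Sorted F ⇔ (All SortedNode F × Sorted (kids F))
Sorted-kids []             = mk⇔ (λ _ → [] , tt) (λ _ → tt)
Sorted-kids (node l c ∷ F) = mk⇔
  (λ { (a , s , s′) → let (as , s″) = to s′ in a ∷ as , Equivalence.from (Sorted-++ c (kids F)) (s , s″) })
  (λ { (a ∷ as , s) → let (s₁ , s₂) = Equivalence.to (Sorted-++ c (kids F)) s in a , s₁ , from (as , s₂) })
  where open Equivalence (Sorted-kids F)

-- Sortedness is a condition on single nodes, so it may be checked tree by tree, as along the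
-- lattice path, or level by level, as along the ballot path.
Sorted-nodes : ∀ h F → descend h F ≡ [] → Sorted F ⇔ All SortedNode (nodes h F)
Sorted-nodes zero    F e rewrite e = mk⇔ (λ _ → []) (λ _ → tt)
Sorted-nodes (suc h) F e = mk⇔
  (λ s → let (as , s′) = Equivalence.to (Sorted-kids F) s in Allₚ.++⁺ (to s′) as)
  (λ as → let (as₁ , as₂) = Allₚ.++⁻ (nodes h (kids F)) as in Equivalence.from (Sorted-kids F) (as₂ , from as₁))
  where open Equivalence (Sorted-nodes h (kids F) e)

-- Only the last E of a block E^e N is followed by N. East labels enumerate children, so this E
-- carries the last child's label, and the N carries the node's own.
Falling-children : ∀ l c u v p →
  Falling (labels c ++ u) (l ∷ v) (replicate (length c) E ++ N ∷ p) ⇔ (LastAbove (just l) c × Falling u v p)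
Falling-children l []          u v p = mk⇔ (tt ,_) proj₂
Falling-children l (t ∷ [])    u v p = mk⇔ id id
Falling-children l (_ ∷ t ∷ c) u v p = mk⇔ (to ∘ proj₂) (λ x → tt , from x)
  where open Equivalence (Falling-children l (t ∷ c) u v p)

Falling-unary : ∀ F u v p →
  Falling (labels (kids F) ++ u) (labels F ++ v) (unary F ++ p) ⇔ (All SortedNode F × Falling u v p)
Falling-unary []             u v p = mk⇔ ([] ,_) proj₂
Falling-unary (node l c ∷ F) u v p
  rewrite labels-++ c (kids F)
        | ++-assoc (labels c) (labels (kids F)) u
        | ++-assoc (replicate (length c) E) (N ∷ unary F) p = mk⇔
  (λ f → let (a , f′) = Equivalence.to C f ; (as , f″) = to f′ in a ∷ as , f″)
  (λ { (a ∷ as , f) → Equivalence.from C (a , from (as , f)) })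
  where
  C = Falling-children l c (labels (kids F) ++ u) (labels F ++ v) (unary F ++ p)
  open Equivalence (Falling-unary F u v p)

negLabels : List Tree → List ℤ
negLabels F = map -_ (reverse (labels F))

negLabels-++ : ∀ F G → negLabels (F ++ G) ≡ negLabels G ++ negLabels F
negLabels-++ F G = trans (cong (map -_) (trans (cong reverse (labels-++ F G)) (reverse-++ (labels F) (labels G))))
  (map-++ -_ (reverse (labels G)) (reverse (labels F)))

negLabels-∷ʳ : ∀ F t → negLabels (F ++ t ∷ []) ≡ - label t ∷ negLabels F
negLabels-∷ʳ F t = negLabels-++ F (t ∷ [])

negLabels-below : ∀ m → ∃[ v ] negLabels (roots m) ≡ negLabels (belowRoots m) ++ v
negLabels-below m = negLabels (aboveRoots m) ,
  trans (cong negLabels (roots-split m)) (negLabels-++ (aboveRoots m) (belowRoots m))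

-- Beyond position n the word is the negated reading backwards, so the North letters carry the
-- negated labels of the roots below, latest first, and the East letters the labels of the roots
-- above. Valleys among the letters are therefore the rises between excursions, and the end of β, at
-- the earliest excursion, gives σ₁ > 0.
Falling-letters : ∀ m u v →
  Falling (labels (aboveRoots m) ++ u) (negLabels (belowRoots m) ++ v) (letters m) ⇔ SortedRoots m
Falling-letters []                u v = mk⇔ id id
Falling-letters ((false , t) ∷ m) u v rewrite negLabels-∷ʳ (belowRoots m) t = Falling-letters m u v
Falling-letters ((true , t) ∷ m)  u v = mk⇔
  (λ { (a , f) → Equivalence.to (east m) a , to f })
  (λ { (a , f) → Equivalence.from (east m) a , from f })
  where
  open Equivalence (Falling-letters m u v)
  east : ∀ m → East≻ (label t ∷ labels (aboveRoots m) ++ u) (negLabels (belowRoots m) ++ v) (letters m)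
    ⇔ (lastLabel m ≺ label t)
  east []                 = mk⇔ id id
  east ((true  , t′) ∷ m) = mk⇔ id id
  east ((false , t′) ∷ m) rewrite negLabels-∷ʳ (belowRoots m) t′ = mk⇔ id id

word : Excursions → List ℤ
word m = labels (reading m) ++ negLabels (reading m)

-- No valley straddles blocks and letters, as every block ends with N. East steps read the children
-- and then the roots, North steps the nodes and then the negated half of the word.
Falling-ballot : ∀ m → Falling (word m) (word m) (ballot m) ⇔ (SortedRoots m × Sorted (roots m))
Falling-ballot m = mk⇔
  (λ f → let (as , f′) = Equivalence.to U (subst (λ w → Falling w (word m) (ballot m)) east f)
         in Equivalence.to L (subst₂ (λ x y → Falling x y (letters m)) split split′ f′)
            , Equivalence.from S as)
  (λ { (q , s) → subst (λ w → Falling w (word m) (ballot m)) (sym east) (Equivalence.from U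
        (Equivalence.to S s , subst₂ (λ x y → Falling x y (letters m)) (sym split) (sym split′) (Equivalence.from L q))) })
  where
  open ≡-Reasoning
  G = reading m
  S = Sorted-nodes (size (roots m)) (roots m) (roots-exhausted m)
  U = Falling-unary G (labels (roots m) ++ negLabels G) (negLabels G) (letters m)
  rest = negLabels (aboveRoots m) ++ negLabels (kids G)
  L = Falling-letters m (labels (belowRoots m) ++ negLabels G) rest
  east : word m ≡ labels (kids G) ++ labels (roots m) ++ negLabels G
  east = trans (cong (λ z → labels z ++ negLabels G) (sym (kids-reading m)))
    (trans (cong (_++ negLabels G) (labels-++ (kids G) (roots m))) (++-assoc (labels (kids G)) _ _))
  split : labels (roots m) ++ negLabels G ≡ labels (aboveRoots m) ++ labels (belowRoots m) ++ negLabels G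
  split = trans (cong (λ z → labels z ++ negLabels G) (roots-split m))
    (trans (cong (_++ negLabels G) (labels-++ (aboveRoots m) _)) (++-assoc (labels (aboveRoots m)) _ _))
  split′ : negLabels G ≡ negLabels (belowRoots m) ++ rest
  split′ = begin
    negLabels G                                  ≡⟨ cong negLabels (sym (kids-reading m)) ⟩
    negLabels (kids G ++ roots m)                ≡⟨ negLabels-++ (kids G) (roots m) ⟩
    negLabels (roots m) ++ negLabels (kids G)    ≡⟨ cong (_++ negLabels (kids G)) (proj₂ (negLabels-below m)) ⟩
    (negLabels (belowRoots m) ++ negLabels (aboveRoots m)) ++ negLabels (kids G) ≡⟨ ++-assoc (negLabels (belowRoots m)) _ _ ⟩
    negLabels (belowRoots m) ++ rest             ∎

ValleysOK : Path → List ℤ → Set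
ValleysOK β w = (∀ i j → (i , j) ∈ valleys β → at w j ℤ.< at w i) × (lastStep β ≡ just E → pos 0 ℤ.< at w (numE β))

at-drop : ∀ e w → at (drop e w) 1 ≡ at w (suc e)
at-drop zero    w       = refl
at-drop (suc e) []      = refl
at-drop (suc e) (x ∷ w) = at-drop e w

drop-suc : ∀ e (w : List A) → drop 1 (drop e w) ≡ drop (suc e) w
drop-suc e w = trans (drop-drop e 1 w) (cong (λ k → drop k w) (ℕₚ.+-comm e 1))

-- After `e` East and `k` North steps, both lists of pending labels are suffixes of the one word
-- `w`.
ValleysOK-Falling : ∀ w e k β →
  ((∀ i j → (i , j) ∈ valleysAux e k β → at w j ℤ.< at w i) × (lastStep β ≡ just E → pos 0 ℤ.< at w (e + numE β)))
  ⇔ Falling (drop e w) (drop k w) β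
ValleysOK-Falling w e k [] = mk⇔ (λ _ → tt) (λ _ → (λ _ _ ()) , λ ())
ValleysOK-Falling w e k (N ∷ []) = mk⇔ (λ _ → tt) (λ _ → (λ _ _ ()) , λ ())
ValleysOK-Falling w e k (N ∷ β@(_ ∷ _)) with ValleysOK-Falling w e (suc k) β
... | IH rewrite drop-suc k w = IH
ValleysOK-Falling w e k (E ∷ []) rewrite at-drop e w | ℕₚ.+-comm e 1 = mk⇔
  (λ { (_ , l) → l refl , tt }) (λ { (l , _) → (λ _ _ ()) , λ _ → l })
ValleysOK-Falling w e k (E ∷ β@(E ∷ _)) with ValleysOK-Falling w (suc e) k β
... | IH rewrite drop-suc e w | ℕₚ.+-suc e (numE β) = mk⇔
  (λ h → tt , Equivalence.to IH h) (Equivalence.from IH ∘ proj₂)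
ValleysOK-Falling w e k (E ∷ β@(N ∷ _)) with ValleysOK-Falling w (suc e) k β
... | IH rewrite drop-suc e w | ℕₚ.+-suc e (numE β) | at-drop e w | at-drop k w = mk⇔
  (λ { (v , l) → v (suc e) (suc k) (here refl) , Equivalence.to IH ((λ i j ij∈ → v i j (there ij∈)) , l) })
  (λ { (a , f) → let (v , l) = Equivalence.from IH f in
       (λ { i j (here refl) → a ; i j (there ij∈) → v i j ij∈ }) , l })

ValleysOK-ballot : ∀ m → ValleysOK (ballot m) (word m) ⇔ (SortedRoots m × Sorted (roots m))
ValleysOK-ballot m = mk⇔ (Equivalence.to F ∘ Equivalence.to V) (Equivalence.from V ∘ Equivalence.from F)
  where
  F = Falling-ballot m
  V = ValleysOK-Falling (word m) 0 0 (ballot m)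

-- Blocks E^e N and the ballot condition

unaryOf : List (ℕ × ℤ) → Path
unaryOf []             = []
unaryOf ((e , _) ∷ xs) = replicate e E ++ N ∷ unaryOf xs

unaryOf-enc : ∀ F → unaryOf (enc F) ≡ unary F
unaryOf-enc []             = refl
unaryOf-enc (node l c ∷ F) = cong (λ z → replicate (length c) E ++ N ∷ z) (unaryOf-enc F)

labels-enc : ∀ F → map proj₂ (enc F) ≡ labels F
labels-enc F = sym (map-∘ F)

batch-injective : ∀ e e′ p p′ → replicate e E ++ N ∷ p ≡ replicate e′ E ++ N ∷ p′ → (e ≡ e′) × (p ≡ p′)
batch-injective zero    zero     p p′ q = refl , ∷-injectiveʳ q
batch-injective zero    (suc e′) p p′ ()
batch-injective (suc e) zero     p p′ ()
batch-injective (suc e) (suc e′) p p′ q with batch-injective e e′ p p′ (∷-injectiveʳ q)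
... | refl , q′ = refl , q′

-- The blocks form a prefix code, so blocks and remainder are determined once the number of blocks
-- is known; the equal label lists fix this number.
unaryOf-injective : ∀ xs ys p p′ → map proj₂ xs ≡ map proj₂ ys → unaryOf xs ++ p ≡ unaryOf ys ++ p′ →
  (xs ≡ ys) × (p ≡ p′)
unaryOf-injective []             []              p p′ _  q = refl , q
unaryOf-injective []             (_ ∷ _)         p p′ ()
unaryOf-injective (_ ∷ _)        []              p p′ ()
unaryOf-injective ((e , l) ∷ xs) ((e′ , l′) ∷ ys) p p′ lq q
  with batch-injective e e′ _ _ (trans (sym (++-assoc (replicate e E) (N ∷ unaryOf xs) p))
         (trans q (++-assoc (replicate e′ E) (N ∷ unaryOf ys) p′)))
... | refl , q′ with unaryOf-injective xs ys p p′ (∷-injectiveʳ lq) q′ | ∷-injectiveˡ lq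
... | refl , q″ | refl = refl , q″

split-unary : ∀ β ls → length ls ≤ numN β →
  ∃[ xs ] ∃[ p ] (map proj₂ xs ≡ ls) × (unaryOf xs ++ p ≡ β)
split-unary β       []       _       = [] , β , refl , refl
split-unary []      (_ ∷ _)  ()
split-unary (N ∷ β) (l ∷ ls) (s≤s b) with split-unary β ls b
... | xs , p , refl , refl = (0 , l) ∷ xs , p , refl , refl
split-unary (E ∷ β) (l ∷ ls) b with split-unary β (l ∷ ls) b
... | (e , _) ∷ xs , p , refl , refl = (suc e , l) ∷ xs , p , refl , refl

-- `h` is the surplus of North over East steps drawn before `β`. It equals the length of the queue,
-- which is why the ballot condition prevents underflow.
BallotFrom : ℕ → Path → Set
BallotFrom h β = ∀ k → numE (take k β) ≤ h + numN (take k β)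

BallotFrom-N : ∀ {h β} → BallotFrom h (N ∷ β) ⇔ BallotFrom (suc h) β
BallotFrom-N {h} {β} = mk⇔
  (λ b k → ℕₚ.≤-trans (b (suc k)) (ℕₚ.≤-reflexive (ℕₚ.+-suc h _)))
  (λ { b zero → z≤n ; b (suc k) → ℕₚ.≤-trans (b k) (ℕₚ.≤-reflexive (sym (ℕₚ.+-suc h _))) })

BallotFrom-E : ∀ {h β} → BallotFrom (suc h) (E ∷ β) ⇔ BallotFrom h β
BallotFrom-E = mk⇔ (λ b k → ℕₚ.≤-pred (b (suc k))) (λ { b zero → z≤n ; b (suc k) → s≤s (b k) })

BallotFrom-Es : ∀ e {h β} → BallotFrom h β → BallotFrom (e + h) (replicate e E ++ β)
BallotFrom-Es zero    b = b
BallotFrom-Es (suc e) b = Equivalence.from BallotFrom-E (BallotFrom-Es e b)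

BallotFrom-Es⁻ : ∀ e h {β} → BallotFrom h (replicate e E ++ β) → (e ≤ h) × BallotFrom (h ℕ.∸ e) β
BallotFrom-Es⁻ zero    h       b = z≤n , b
BallotFrom-Es⁻ (suc e) zero    b = case b 1 of λ ()
BallotFrom-Es⁻ (suc e) (suc h) b with BallotFrom-Es⁻ e h (Equivalence.to BallotFrom-E b)
... | le , b′ = s≤s le , b′

BallotFrom-valid : ∀ xs h p → BallotFrom h (unaryOf xs ++ p) → Valid h xs
BallotFrom-valid []             h p b = []
BallotFrom-valid ((e , l) ∷ xs) h p b
  rewrite ++-assoc (replicate e E) (N ∷ unaryOf xs) p with BallotFrom-Es⁻ e h b
... | le , b′ = le ∷ BallotFrom-valid xs _ p (Equivalence.to BallotFrom-N b′)

BallotFrom-unary : ∀ F q p → BallotFrom (q + length F) p → BallotFrom (length (kids F) + q) (unary F ++ p)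
BallotFrom-unary []             q p b rewrite ℕₚ.+-identityʳ q = b
BallotFrom-unary (node l c ∷ F) q p b
  rewrite ++-assoc (replicate (length c) E) (N ∷ unary F) p
        | length-++ c {kids F}
        | ℕₚ.+-assoc (length c) (length (kids F)) q =
  BallotFrom-Es (length c) (Equivalence.from BallotFrom-N
    (subst (λ h → BallotFrom h (unary F ++ p)) (ℕₚ.+-suc (length (kids F)) q)
      (BallotFrom-unary F (suc q) p (subst (λ h → BallotFrom h p) (ℕₚ.+-suc q (length F)) b))))

BallotFrom-nodes : ∀ h F p → descend h F ≡ [] → BallotFrom (length F) p → BallotFrom 0 (unary (nodes h F) ++ p)
BallotFrom-nodes zero    F p e b rewrite e = b
BallotFrom-nodes (suc h) F p e b
  rewrite unary-++ (nodes h (kids F)) F | ++-assoc (unary (nodes h (kids F))) (unary F) p =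
  BallotFrom-nodes h (kids F) (unary F ++ p) e
    (subst (λ k → BallotFrom k (unary F ++ p)) (ℕₚ.+-identityʳ _) (BallotFrom-unary F 0 p b))

-- When the letters start, the surplus is the number of roots, and there is one letter per root. In
-- whatever order they come, they cannot cross the diagonal.
BallotFrom-short : ∀ p h → length p ≤ h → BallotFrom h p
BallotFrom-short []      h       b       zero    = z≤n
BallotFrom-short []      h       b       (suc k) = z≤n
BallotFrom-short (N ∷ p) h       b = Equivalence.from BallotFrom-N
  (BallotFrom-short p (suc h) (ℕₚ.≤-trans (ℕₚ.n≤1+n _) (ℕₚ.≤-trans b (ℕₚ.n≤1+n h))))
BallotFrom-short (E ∷ p) (suc h) (s≤s b) = Equivalence.from BallotFrom-E (BallotFrom-short p h b)

ballot-isBallot : ∀ m → IsBallotPath (size (roots m)) (ballot m)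
ballot-isBallot m = length-ballot m , BallotFrom-nodes (size (roots m)) (roots m) (letters m) (roots-exhausted m)
  (BallotFrom-short (letters m) (length (roots m))
    (ℕₚ.≤-reflexive (trans (length-map _ m) (sym (length-roots m)))))

numN+numE : ∀ p → numN p + numE p ≡ length p
numN+numE []      = refl
numN+numE (N ∷ p) = cong suc (numN+numE p)
numN+numE (E ∷ p) = trans (ℕₚ.+-suc (numN p) (numE p)) (cong suc (numN+numE p))

-- A ballot path may end off the diagonal, but at least half of its 2n steps are North, so `n`
-- blocks can be split off.
ballot-numN : ∀ {n β} → IsBallotPath n β → n ≤ numN β
ballot-numN {n} {β} (len , b) = ℕₚ.≮⇒≥ λ lt → ℕₚ.<⇒≢ (ℕₚ.+-mono-< lt (ℕₚ.≤-<-trans e≤n lt)) (trans (numN+numE β) len)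
  where
  e≤n : numE β ≤ numN β
  e≤n = subst (λ p → numE p ≤ numN p) (take-all (length β) β ℕₚ.≤-refl) (b (length β))

-- Well-definedness, injectivity and surjectivity

length-oneTo : ∀ n → length (oneTo n) ≡ n
length-oneTo n = trans (length-map suc (upTo n)) (length-upTo n)

signedPerm-length : ∀ {n σ} → IsSignedPerm n σ → length σ ≡ n
signedPerm-length {n} {σ} s = trans (sym (length-map ∣_∣ σ)) (trans (↭ₚ.↭-length s) (length-oneTo n))

numN-steps : ∀ p → numN (steps p) ≡ length (catMaybes p)
numN-steps []            = refl
numN-steps (just _ ∷ p)  = cong suc (numN-steps p)
numN-steps (nothing ∷ p) = numN-steps p

length-labels-path : ∀ m → length (catMaybes (path m)) ≡ size (roots m)
length-labels-path m = trans (cong length (labels-path m)) (trans (length-map proj₂ (rowsOf m)) (length-rowsOf m))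

numE-above : ∀ F p → numE (steps (above F ++ p)) ≡ size F + numE (steps p)
numE-above []             p = refl
numE-above (node l c ∷ F) p = begin
  numE (steps ((above F ++ just l ∷ above c ++ nothing ∷ []) ++ p))
    ≡⟨ cong (numE ∘ steps) (trans (++-assoc (above F) _ p) (cong (λ z → above F ++ just l ∷ z) (++-assoc (above c) _ p))) ⟩
  numE (steps (above F ++ just l ∷ above c ++ nothing ∷ p))
    ≡⟨ trans (numE-above F _) (cong (size F +_) (numE-above c (nothing ∷ p))) ⟩
  size F + (size c + suc (numE (steps p)))
    ≡⟨ sym (ℕₚ.+-assoc (size F) (size c) _) ⟩
  size F + size c + suc (numE (steps p))
    ≡⟨ ℕₚ.+-suc (size F + size c) _ ⟩
  suc (size F + size c + numE (steps p))
    ≡⟨ cong (λ z → suc (z + numE (steps p))) (ℕₚ.+-comm (size F) (size c)) ⟩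
  suc (size c + size F + numE (steps p)) ∎
  where open ≡-Reasoning

numE-below : ∀ F p → numE (steps (below F ++ p)) ≡ size F + numE (steps p)
numE-below []             p = refl
numE-below (node l c ∷ F) p = cong suc (begin
  numE (steps ((below c ++ just (- l) ∷ below F) ++ p))
    ≡⟨ cong (numE ∘ steps) (++-assoc (below c) _ p) ⟩
  numE (steps (below c ++ just (- l) ∷ below F ++ p))
    ≡⟨ trans (numE-below c _) (cong (size c +_) (numE-below F p)) ⟩
  size c + (size F + numE (steps p))
    ≡⟨ sym (ℕₚ.+-assoc (size c) (size F) _) ⟩
  size c + size F + numE (steps p) ∎)
  where open ≡-Reasoning

numE-path : ∀ m p → numE (steps (path m ++ p)) ≡ size (roots m) + numE (steps p)
numE-path []                p = refl
numE-path ((true  , t) ∷ m) p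
  rewrite ++-assoc (path m) (above (t ∷ [])) p
        | numE-path m (above (t ∷ []) ++ p)
        | numE-above (t ∷ []) p =
  trans (sym (ℕₚ.+-assoc (size (roots m)) (size (t ∷ [])) _))
    (cong (_+ numE (steps p)) (trans (ℕₚ.+-comm (size (roots m)) (size (t ∷ []))) (sym (size-++ (t ∷ []) (roots m)))))
numE-path ((false , t) ∷ m) p
  rewrite ++-assoc (path m) (below (t ∷ [])) p
        | numE-path m (below (t ∷ []) ++ p)
        | numE-below (t ∷ []) p
        | size-++ (roots m) (t ∷ []) = sym (ℕₚ.+-assoc (size (roots m)) (size (t ∷ [])) _)

path-isLattice : ∀ m → IsLatticePath (size (roots m)) (steps (path m))
path-isLattice m = trans (numN-steps (path m)) (length-labels-path m) ,
  trans (cong (numE ∘ steps) (sym (++-identityʳ (path m)))) (trans (numE-path m []) (ℕₚ.+-identityʳ _))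

record Decomposition (n : ℕ) (π : Path) (σ : List ℤ) : Set where
  constructor decomposition
  field
    m        : Excursions
    size≡n   : size (roots m) ≡ n
    steps≡π  : steps (path m) ≡ π
    labels≡σ : catMaybes (path m) ≡ σ

vertLabelled-decomposition : ∀ {n π σ} → IsVertLabelled n π σ → Decomposition n π σ
vertLabelled-decomposition {n} {π} {σ} ((nN , nE) , perm , _)
  with fromPath π σ (trans (signedPerm-length perm) (sym nN))
... | p , refl , refl with decompose p [] (trans nN (sym nE))
... | m , refl = decomposition m (trans (sym (length-labels-path m)) (signedPerm-length perm)) refl refl

zeta-wellDefined : ∀ {n} π σ → IsVertLabelled n π σ →
  Σ (List ℤ) λ τ → IsDiagLabelled n (proj₁ (zeta n π σ)) τ × proj₂ (zeta n π σ) ≡ wOf τ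
zeta-wellDefined {n} π σ v@(_ , perm , rises-ok) with vertLabelled-decomposition v
... | decomposition m refl refl refl =
  subst (λ z → Σ (List ℤ) λ τ → IsDiagLabelled n (proj₁ z) τ × proj₂ z ≡ wOf τ) (sym (zeta-path m))
    (τ , (ballot-isBallot m
      , ↭-trans (↭ₚ.map⁺ ∣_∣ (↭ₚ.↭-reverse (labels (reading m)))) (↭-trans (↭-sym (∣labels-path∣ m)) perm)
      , subst (ValleysOK (ballot m)) word≡
          (Equivalence.from (ValleysOK-ballot m) (Equivalence.to (RisesOK-path m) rises-ok)))
    , word≡)
  where
  τ : List ℤ
  τ = reverse (labels (reading m))
  word≡ : word m ≡ wOf τ
  word≡ = cong (_++ map -_ τ) (sym (reverse-involutive (labels (reading m))))

-- Each letter tells from which end of the list of roots the next excursion is taken.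
excursions-injective : ∀ m m′ → letters m ≡ letters m′ → roots m ≡ roots m′ → m ≡ m′
excursions-injective []                []                  _ _ = refl
excursions-injective []                ((_ , _) ∷ _)       ()
excursions-injective ((_ , _) ∷ _)     []                  ()
excursions-injective ((true , _) ∷ _)  ((false , _) ∷ _)   ()
excursions-injective ((false , _) ∷ _) ((true , _) ∷ _)    ()
excursions-injective ((true , t) ∷ m)  ((true , t′) ∷ m′)  l r =
  cong₂ (λ x y → (true , x) ∷ y) (∷-injectiveˡ r) (excursions-injective m m′ (∷-injectiveʳ l) (∷-injectiveʳ r))
excursions-injective ((false , t) ∷ m) ((false , t′) ∷ m′) l r =
  cong₂ (λ x y → (false , x) ∷ y) (∷ʳ-injectiveʳ (roots m) (roots m′) r)
    (excursions-injective m m′ (∷-injectiveʳ l) (∷ʳ-injectiveˡ (roots m) (roots m′) r))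

dec-reading : ∀ m → dec [] (enc (reading m)) ≡ roots m
dec-reading m = trans (cong (dec []) (sym (++-identityʳ (enc (reading m)))))
  (dec-enc (size (roots m)) (roots m) [] (roots-exhausted m))

reading-injective : ∀ m m′ → size (roots m) ≡ size (roots m′) → ballot m ≡ ballot m′ → word m ≡ word m′ → m ≡ m′
reading-injective m m′ s b w with unaryOf-injective (enc (reading m)) (enc (reading m′)) (letters m) (letters m′) ls us
  where
  take-word : ∀ m → take (size (roots m)) (word m) ≡ labels (reading m)
  take-word m = trans (cong (λ k → take k (word m)) (sym (trans (length-map label (reading m)) (length-reading m))))
    (take-++-length (labels (reading m)) (negLabels (reading m)))
  ls : map proj₂ (enc (reading m)) ≡ map proj₂ (enc (reading m′))
  ls = trans (labels-enc (reading m)) (trans (sym (take-word m)) (trans (cong₂ take s w)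
    (trans (take-word m′) (sym (labels-enc (reading m′))))))
  us : unaryOf (enc (reading m)) ++ letters m ≡ unaryOf (enc (reading m′)) ++ letters m′
  us = trans (cong (_++ letters m) (unaryOf-enc (reading m)))
    (trans b (cong (_++ letters m′) (sym (unaryOf-enc (reading m′)))))
... | xs , ls = excursions-injective m m′ ls
  (trans (sym (dec-reading m)) (trans (cong (dec []) xs) (dec-reading m′)))

zeta-injective : ∀ {n} π π′ σ σ′ → IsVertLabelled n π σ → IsVertLabelled n π′ σ′ →
  zeta n π σ ≡ zeta n π′ σ′ → (π ≡ π′) × (σ ≡ σ′)
zeta-injective π π′ σ σ′ v v′ q with vertLabelled-decomposition v | vertLabelled-decomposition v′
... | decomposition m refl refl refl | decomposition m′ s refl refl =
  cong (steps ∘ path) m≡m′ , cong (catMaybes ∘ path) m≡m′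
  where
  q′ : (ballot m , word m) ≡ (ballot m′ , word m′)
  q′ = trans (sym (zeta-path m)) (trans q
    (trans (cong (λ k → zeta k (steps (path m′)) (catMaybes (path m′))) (sym s)) (zeta-path m′)))
  m≡m′ : m ≡ m′
  m≡m′ = reading-injective m m′ (sym s) (cong proj₁ q′) (cong proj₂ q′)

excursionsFrom : ∀ p F → length p ≡ length F → ∃[ m ] (letters m ≡ p) × (roots m ≡ F)
excursionsFrom []      []      _ = [] , refl , refl
excursionsFrom []      (_ ∷ _) ()
excursionsFrom (E ∷ _) []      ()
excursionsFrom (E ∷ p) (t ∷ F) e with excursionsFrom p F (ℕₚ.suc-injective e)
... | m , refl , refl = (true , t) ∷ m , refl , refl
excursionsFrom (N ∷ p) F       e with initLast F
excursionsFrom (N ∷ p) _       () | []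
... | F′ ∷ʳ′ t with excursionsFrom p F′ (ℕₚ.suc-injective (trans e (length-++-comm F′ (t ∷ []))))
... | m , refl , refl = (false , t) ∷ m , refl , refl

ballot-decomposition : ∀ {n β} ls → IsBallotPath n β → length ls ≡ n →
  ∃[ m ] (size (roots m) ≡ n) × (ballot m ≡ β) × (labels (reading m) ≡ ls)
ballot-decomposition {n} {β} ls isBallot@(len , above) refl
  with split-unary β ls (ballot-numN isBallot)
... | xs , p , refl , refl = conclude (excursionsFrom p F len-p)
  where
  F G : List Tree
  F = dec [] xs
  G = nodes n F
  size-F : size F ≡ n
  size-F = trans (size-dec [] xs) (sym (length-map proj₂ xs))
  exhausted : descend n F ≡ []
  exhausted = descend-exhausted n F (ℕₚ.≤-reflexive size-F)
  enc≡ : enc G ≡ xs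
  enc≡ = trans (enc-dec n [] xs (BallotFrom-valid xs 0 p above) (ℕₚ.≤-reflexive (sym (length-map proj₂ xs))))
    (cong (λ z → enc z ++ xs) (nodes-[] n))
  len-G : length G ≡ n
  len-G = trans (nodes-length n F exhausted) size-F
  k : ℕ
  k = length (kids G)
  -- Both sides are n - k. The blocks use n North and `k` East steps out of 2n, and the n nodes are
  -- `k` children and the roots `F`.
  len-p : length p ≡ length F
  len-p = ℕₚ.+-cancelˡ-≡ k _ _ (trans (ℕₚ.+-cancelˡ-≡ n _ _ (begin
    n + (k + length p)                 ≡⟨ sym (ℕₚ.+-assoc n k (length p)) ⟩
    n + k + length p                   ≡⟨ cong (_+ length p) (ℕₚ.+-comm n k) ⟩
    k + n + length p                   ≡⟨ cong (λ z → k + z + length p) (sym len-G) ⟩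
    k + length G + length p            ≡⟨ cong (_+ length p) (sym (length-unary G)) ⟩
    length (unary G) + length p        ≡⟨ sym (length-++ (unary G)) ⟩
    length (unary G ++ p)              ≡⟨ cong (λ z → length (z ++ p)) (trans (sym (unaryOf-enc G)) (cong unaryOf enc≡)) ⟩
    length (unaryOf xs ++ p)           ≡⟨ len ⟩
    n + n                              ∎))
    (sym (trans (sym (length-++ (kids G))) (trans (cong length (kids-nodes n F exhausted)) len-G))))
    where open ≡-Reasoning
  conclude : ∃[ m ] (letters m ≡ p) × (roots m ≡ F) →
    ∃[ m ] (size (roots m) ≡ n) × (ballot m ≡ unaryOf xs ++ p) × (labels (reading m) ≡ map proj₂ xs)
  conclude (m , refl , r) = m , trans (cong size r) size-F ,
    cong (_++ letters m) (trans (sym (unaryOf-enc (reading m))) (cong unaryOf enc′)) ,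
    trans (sym (labels-enc (reading m))) (cong (map proj₂) enc′)
    where
    enc′ : enc (reading m) ≡ xs
    enc′ = trans (cong₂ (λ h K → enc (nodes h K)) (trans (cong size r) size-F) r) enc≡

zeta-surjective : ∀ {n} β τ → IsDiagLabelled n β τ →
  Σ Path λ π → Σ (List ℤ) λ σ → IsVertLabelled n π σ × (zeta n π σ ≡ (β , wOf τ))
zeta-surjective β τ (isBallot , perm , valleys-ok)
  with ballot-decomposition (reverse τ) isBallot (trans (length-reverse τ) (signedPerm-length perm))
... | m , refl , refl , ls≡ =
  steps (path m) , catMaybes (path m) ,
  ( path-isLattice m
  , ↭-trans (∣labels-path∣ m) (↭-trans (↭-reflexive (cong (map ∣_∣) ls≡))
      (↭-trans (↭ₚ.map⁺ ∣_∣ (↭ₚ.↭-reverse τ)) perm))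
  , Equivalence.from (RisesOK-path m) (Equivalence.to (ValleysOK-ballot m)
      (subst (ValleysOK (ballot m)) (sym word≡) valleys-ok)))
  , trans (zeta-path m) (cong (ballot m ,_) word≡)
  where
  word≡ : word m ≡ wOf τ
  word≡ = cong₂ (λ u v → u ++ map -_ v) ls≡ (trans (cong reverse ls≡) (reverse-involutive τ))

-- Sums over lists and over pairs

𝟙 : Bool → ℕ
𝟙 b = if b then 1 else 0

∑ : (A → ℕ) → List A → ℕ
∑ f []       = 0
∑ f (x ∷ xs) = f x + ∑ f xs

count-∑ : ∀ (f : A → Bool) xs → count f xs ≡ ∑ (𝟙 ∘ f) xs
count-∑ f []       = refl
count-∑ f (x ∷ xs) with f x
... | true  = cong suc (count-∑ f xs)
... | false = count-∑ f xs

∑-cong : ∀ {f g : A → ℕ} → (∀ x → f x ≡ g x) → ∀ xs → ∑ f xs ≡ ∑ g xs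
∑-cong e []       = refl
∑-cong e (x ∷ xs) = cong₂ _+_ (e x) (∑-cong e xs)

∑-zero : ∀ (xs : List A) → ∑ (λ _ → 0) xs ≡ 0
∑-zero []       = refl
∑-zero (_ ∷ xs) = ∑-zero xs

∑-++ : ∀ (f : A → ℕ) xs ys → ∑ f (xs ++ ys) ≡ ∑ f xs + ∑ f ys
∑-++ f []       ys = refl
∑-++ f (x ∷ xs) ys = trans (cong (f x +_) (∑-++ f xs ys)) (sym (ℕₚ.+-assoc (f x) _ _))

∑-map : ∀ (f : B → ℕ) (g : A → B) xs → ∑ f (map g xs) ≡ ∑ (f ∘ g) xs
∑-map f g []       = refl
∑-map f g (x ∷ xs) = cong (f (g x) +_) (∑-map f g xs)

∑-+ : ∀ (f g : A → ℕ) xs → ∑ (λ x → f x + g x) xs ≡ ∑ f xs + ∑ g xs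
∑-+ f g []       = refl
∑-+ f g (x ∷ xs) = trans (cong (f x + g x +_) (∑-+ f g xs)) (+-interchange (f x) (g x) _ _)

∑-swap : ∀ (f : A → B → ℕ) xs ys → ∑ (λ x → ∑ (f x) ys) xs ≡ ∑ (λ y → ∑ (λ x → f x y) xs) ys
∑-swap f []       ys = sym (∑-zero ys)
∑-swap f (x ∷ xs) ys = trans (cong (∑ (f x) ys +_) (∑-swap f xs ys))
  (sym (∑-+ (f x) (λ y → ∑ (λ x → f x y) xs) ys))

∑-reverse : ∀ (f : A → ℕ) xs → ∑ f (reverse xs) ≡ ∑ f xs
∑-reverse f []       = refl
∑-reverse f (x ∷ xs) rewrite unfold-reverse x xs | ∑-++ f (reverse xs) (x ∷ []) | ∑-reverse f xs =
  trans (cong (∑ f xs +_) (ℕₚ.+-identityʳ (f x))) (ℕₚ.+-comm (∑ f xs) (f x))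

cross : (A → A → ℕ) → List A → List A → ℕ
cross g xs ys = ∑ (λ x → ∑ (g x) ys) xs

pairSum : (A → A → ℕ) → List A → ℕ
pairSum g []       = 0
pairSum g (x ∷ xs) = ∑ (g x) xs + pairSum g xs

pairSum-cong : ∀ {f g : A → A → ℕ} → (∀ x y → f x y ≡ g x y) → ∀ xs → pairSum f xs ≡ pairSum g xs
pairSum-cong e []       = refl
pairSum-cong e (x ∷ xs) = cong₂ _+_ (∑-cong (e x) xs) (pairSum-cong e xs)

pairSum-map : ∀ (g : B → B → ℕ) (f : A → B) xs → pairSum g (map f xs) ≡ pairSum (λ x y → g (f x) (f y)) xs
pairSum-map g f []       = refl
pairSum-map g f (x ∷ xs) = cong₂ _+_ (∑-map (g (f x)) f xs) (pairSum-map g f xs)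

pairSum-+ : ∀ (f g : A → A → ℕ) xs → pairSum (λ x y → f x y + g x y) xs ≡ pairSum f xs + pairSum g xs
pairSum-+ f g []       = refl
pairSum-+ f g (x ∷ xs) = trans (cong₂ _+_ (∑-+ (f x) (g x) xs) (pairSum-+ f g xs))
  (+-interchange (∑ (f x) xs) _ _ _)

pairSum-++ : ∀ (g : A → A → ℕ) xs ys → pairSum g (xs ++ ys) ≡ pairSum g xs + pairSum g ys + cross g xs ys
pairSum-++ g []       ys = sym (ℕₚ.+-identityʳ _)
pairSum-++ g (x ∷ xs) ys = begin
  ∑ (g x) (xs ++ ys) + pairSum g (xs ++ ys)
    ≡⟨ cong₂ _+_ (∑-++ (g x) xs ys) (pairSum-++ g xs ys) ⟩
  (a + b) + ((p + q) + c)  ≡⟨ cong ((a + b) +_) (ℕₚ.+-comm (p + q) c) ⟩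
  (a + b) + (c + (p + q))  ≡⟨ ℕₚ.+-assoc a b _ ⟩
  a + (b + (c + (p + q)))  ≡⟨ cong (a +_) (sym (ℕₚ.+-assoc b c _)) ⟩
  a + ((b + c) + (p + q))  ≡⟨ cong (a +_) (ℕₚ.+-comm (b + c) _) ⟩
  a + ((p + q) + (b + c))  ≡⟨ sym (ℕₚ.+-assoc a (p + q) _) ⟩
  (a + (p + q)) + (b + c)  ≡⟨ cong (_+ (b + c)) (sym (ℕₚ.+-assoc a p q)) ⟩
  ((a + p) + q) + (b + c)  ∎
  where
  open ≡-Reasoning
  a = ∑ (g x) xs
  b = ∑ (g x) ys
  c = cross g xs ys
  p = pairSum g xs
  q = pairSum g ys

pairSum-reverse : ∀ (g : A → A → ℕ) xs → pairSum g (reverse xs) ≡ pairSum (flip g) xs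
pairSum-reverse g []       = refl
pairSum-reverse g (x ∷ xs)
  rewrite unfold-reverse x xs
        | pairSum-++ g (reverse xs) (x ∷ [])
        | pairSum-reverse g xs
        | ∑-reverse (λ y → g y x + 0) xs
        | ∑-cong {f = λ y → g y x + 0} (λ y → ℕₚ.+-identityʳ (g y x)) xs
        | ℕₚ.+-identityʳ (pairSum (flip g) xs) = ℕₚ.+-comm (pairSum (flip g) xs) _

count-pairs : ∀ (f : A × B → Bool) xs ys →
  count f (concatMap (λ x → map (x ,_) ys) xs) ≡ ∑ (λ x → ∑ (λ y → 𝟙 (f (x , y))) ys) xs
count-pairs f xs ys = trans (count-∑ f (concatMap (λ x → map (x ,_) ys) xs)) (go xs)
  where
  go : ∀ xs → ∑ (𝟙 ∘ f) (concatMap (λ x → map (x ,_) ys) xs) ≡ ∑ (λ x → ∑ (λ y → 𝟙 (f (x , y))) ys) xs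
  go []       = refl
  go (x ∷ xs) = trans (∑-++ (𝟙 ∘ f) (map (x ,_) ys) _) (cong₂ _+_ (∑-map (𝟙 ∘ f) (x ,_) ys) (go xs))

<ᵇ-true : ∀ {m n} → m ℕ.< n → (m <ᵇ n) ≡ true
<ᵇ-true {m} {n} = dec-true (m ℕ.<? n)

<ᵇ-false : ∀ {m n} → n ≤ m → (m <ᵇ n) ≡ false
<ᵇ-false {m} {n} n≤m = dec-false (m ℕ.<? n) (ℕₚ.≤⇒≯ n≤m)

-- On a sorted list of indices the test i < j is list order, so from here on the indices can be
-- replaced by the rows themselves.
∑-pairSum : ∀ (h : ℕ → ℕ → Bool) {xs} → AllPairs ℕ._<_ xs →
  ∑ (λ i → ∑ (λ j → 𝟙 ((i <ᵇ j) ∧ h i j)) xs) xs ≡ pairSum (λ i j → 𝟙 (h i j)) xs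
∑-pairSum h []                  = refl
∑-pairSum h {x ∷ xs} (lt ∷ ap) = begin
  (𝟙 ((x <ᵇ x) ∧ h x x) + ∑ (λ j → 𝟙 ((x <ᵇ j) ∧ h x j)) xs)
    + ∑ (λ i → 𝟙 ((i <ᵇ x) ∧ h i x) + ∑ (λ j → 𝟙 ((i <ᵇ j) ∧ h i j)) xs) xs
    ≡⟨ cong₂ _+_ (cong₂ _+_ (cong (λ b → 𝟙 (b ∧ h x x)) (<ᵇ-false {x} ℕₚ.≤-refl)) (first xs lt))
         (∑-+ (λ i → 𝟙 ((i <ᵇ x) ∧ h i x)) (λ i → ∑ (λ j → 𝟙 ((i <ᵇ j) ∧ h i j)) xs) xs) ⟩
  ∑ (λ j → 𝟙 (h x j)) xs
    + (∑ (λ i → 𝟙 ((i <ᵇ x) ∧ h i x)) xs + ∑ (λ i → ∑ (λ j → 𝟙 ((i <ᵇ j) ∧ h i j)) xs) xs)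
    ≡⟨ cong₂ (λ a b → ∑ (λ j → 𝟙 (h x j)) xs + (a + b)) (rest xs lt) (∑-pairSum h ap) ⟩
  ∑ (λ j → 𝟙 (h x j)) xs + pairSum (λ i j → 𝟙 (h i j)) xs ∎
  where
  open ≡-Reasoning
  first : ∀ xs → All (x ℕ.<_) xs → ∑ (λ j → 𝟙 ((x <ᵇ j) ∧ h x j)) xs ≡ ∑ (λ j → 𝟙 (h x j)) xs
  first []       []        = refl
  first (y ∷ ys) (lt ∷ as) rewrite <ᵇ-true lt = cong (𝟙 (h x y) +_) (first ys as)
  rest : ∀ xs → All (x ℕ.<_) xs → ∑ (λ i → 𝟙 ((i <ᵇ x) ∧ h i x)) xs ≡ 0
  rest []       []        = refl
  rest (y ∷ ys) (lt ∷ as) rewrite <ᵇ-false (ℕₚ.<⇒≤ lt) = rest ys as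

oneTo-sorted : ∀ n → AllPairs ℕ._<_ (oneTo n)
oneTo-sorted n = AllPairsₚ.map⁺ (AllPairsₚ.applyUpTo⁺₁ id n (λ i<j _ → s≤s i<j))

-- The statistic dinv′ in terms of forests

φ₁ φ₂ φ₃ φ₄ : ℤ × ℤ → ℤ × ℤ → Bool
φ₁ (a , s) (b , t) = (a =ᶻ b) ∧ (s <ᶻ t)
φ₂ (a , s) (b , t) = (a =ᶻ (b ℤ.+ pos 1)) ∧ (t <ᶻ s)
φ₃ (a , s) (b , t) = (a =ᶻ (- b)) ∧ (s <ᶻ (- t))
φ₄ (a , s) (b , t) = (a =ᶻ ((- b) ℤ.+ pos 1)) ∧ ((- t) <ᶻ s)

φ : ℤ × ℤ → ℤ × ℤ → ℕ
φ x y = 𝟙 (φ₁ x y) + 𝟙 (φ₂ x y) + 𝟙 (φ₃ x y) + 𝟙 (φ₄ x y)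

ψ : ℤ × ℤ → ℕ
ψ (a , s) = 𝟙 ((a =ᶻ pos 0) ∧ (s <ᶻ pos 0))

dinvRows : List (ℤ × ℤ) → ℕ
dinvRows R = pairSum φ R + ∑ ψ R

dinv-rows : ∀ {n} R → length R ≡ n → ∀ π → areaVec π ≡ map proj₁ R → dinv′ n π (map proj₂ R) ≡ dinvRows R
dinv-rows {n} R len π e = begin
  dinv′ n π (map proj₂ R)
    ≡⟨ cong₂ _+_ (cong₂ _+_ (cong₂ _+_ (cong₂ _+_ (term φ₁) (term φ₂)) (term φ₃)) (term φ₄)) single ⟩
  pairSum (λ x y → 𝟙 (φ₁ x y)) R + pairSum (λ x y → 𝟙 (φ₂ x y)) R + pairSum (λ x y → 𝟙 (φ₃ x y)) R
    + pairSum (λ x y → 𝟙 (φ₄ x y)) R + ∑ ψ R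
    ≡⟨ cong (_+ ∑ ψ R) (sym expand) ⟩
  pairSum φ R + ∑ ψ R ∎
  where
  open ≡-Reasoning
  r : ℕ → ℤ × ℤ
  r k = at (areaVec π) k , at (map proj₂ R) k
  r-rows : map r (oneTo n) ≡ R
  r-rows = trans (cong (λ a → map (λ k → at a k , at (map proj₂ R) k) (oneTo n)) e) (at-rows R n len)
  term : ∀ f → count (λ { (i , j) → (i <ᵇ j) ∧ f (r i) (r j) }) (pairsIn (oneTo n)) ≡ pairSum (λ x y → 𝟙 (f x y)) R
  term f = trans (count-pairs _ (oneTo n) (oneTo n))
    (trans (∑-pairSum (λ i j → f (r i) (r j)) (oneTo-sorted n))
    (trans (sym (pairSum-map (λ x y → 𝟙 (f x y)) r (oneTo n)))
      (cong (pairSum (λ x y → 𝟙 (f x y))) r-rows)))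
  single : count (λ k → (proj₁ (r k) =ᶻ pos 0) ∧ (proj₂ (r k) <ᶻ pos 0)) (oneTo n) ≡ ∑ ψ R
  single = trans (count-∑ _ (oneTo n)) (trans (sym (∑-map ψ r (oneTo n))) (cong (∑ ψ) r-rows))
  expand : pairSum φ R ≡ pairSum (λ x y → 𝟙 (φ₁ x y)) R + pairSum (λ x y → 𝟙 (φ₂ x y)) R
    + pairSum (λ x y → 𝟙 (φ₃ x y)) R + pairSum (λ x y → 𝟙 (φ₄ x y)) R
  expand = trans (pairSum-+ _ (λ x y → 𝟙 (φ₄ x y)) R)
    (cong (_+ pairSum (λ x y → 𝟙 (φ₄ x y)) R) (trans (pairSum-+ _ (λ x y → 𝟙 (φ₃ x y)) R)
      (cong (_+ pairSum (λ x y → 𝟙 (φ₃ x y)) R) (pairSum-+ (λ x y → 𝟙 (φ₁ x y)) (λ x y → 𝟙 (φ₂ x y)) R))))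

-- Inversions between nodes on the same depth or on adjacent depths, for pairs listed in
-- scanning order.
δ : ℕ × ℤ → ℕ × ℤ → ℕ
δ (d , l) (d′ , l′) = 𝟙 ((d =ⁿ d′) ∧ (l′ <ᶻ l)) + 𝟙 ((d′ =ⁿ suc d) ∧ (l <ᶻ l′))

-- Pairs of excursions contribute to dinv' when the sum of their root labels is positive and
-- the later one is below the diagonal; a single row with σᵢ < 0 is the diagonal case.
ε : ℕ × ℤ → ℕ × ℤ → ℕ
ε (d , l) (d′ , l′) = 𝟙 ((d =ⁿ 0) ∧ (d′ =ⁿ 0) ∧ ((- l′) <ᶻ l))

<ᶻ-neg : ∀ l l′ → ((- l) <ᶻ (- l′)) ≡ (l′ <ᶻ l)
<ᶻ-neg l l′ = does-⇔ (mk⇔ ℤₚ.neg-cancel-< ℤₚ.neg-mono-<) ((- l) ℤ.<? (- l′)) (l′ ℤ.<? l)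

<ᶻ-negˡ : ∀ l l′ → ((- l) <ᶻ l′) ≡ ((- l′) <ᶻ l)
<ᶻ-negˡ l l′ = trans (cong ((- l) <ᶻ_) (sym (ℤₚ.neg-involutive l′))) (<ᶻ-neg l (- l′))

<ᶻ-0 : ∀ l → ((- l) <ᶻ pos 0) ≡ ((- l) <ᶻ l)
<ᶻ-0 -[1+ _ ]      = refl
<ᶻ-0 (pos zero)    = refl
<ᶻ-0 (pos (suc _)) = refl

=ⁿ-sym : ∀ m n → (m =ⁿ n) ≡ (n =ⁿ m)
=ⁿ-sym m n = does-⇔ (mk⇔ sym sym) (m ℕ.≟ n) (n ℕ.≟ m)

=ᶻ-above-above+1 : ∀ d d′ → (pos (suc d) =ᶻ (pos (suc d′) ℤ.+ pos 1)) ≡ (d =ⁿ suc d′)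
=ᶻ-above-above+1 d d′ rewrite ℕₚ.+-comm d′ 1 = =ᶻ-above d (suc d′)

=ᶻ-below-above+1 : ∀ d d′ → (- pos d =ᶻ (pos (suc d′) ℤ.+ pos 1)) ≡ false
=ᶻ-below-above+1 d d′ rewrite ℕₚ.+-comm d′ 1 = =ᶻ-below-above d (suc d′)

=ᶻ-above-below+1 : ∀ d d′ → (pos (suc d) =ᶻ ((- pos d′) ℤ.+ pos 1)) ≡ (d =ⁿ 0) ∧ (d′ =ⁿ 0)
=ᶻ-above-below+1 zero    zero     = refl
=ᶻ-above-below+1 (suc d) zero     = refl
=ᶻ-above-below+1 zero    (suc d′) = trans (cong (pos 1 =ᶻ_) (neg-suc+1 d′)) (=ᶻ-above-below 0 d′)
=ᶻ-above-below+1 (suc d) (suc d′) = trans (cong (pos (suc (suc d)) =ᶻ_) (neg-suc+1 d′)) (=ᶻ-above-below (suc d) d′)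

=ᶻ-below-below+1 : ∀ d d′ → (- pos d =ᶻ ((- pos d′) ℤ.+ pos 1)) ≡ (d′ =ⁿ suc d)
=ᶻ-below-below+1 d zero     = =ᶻ-below-above d 0
=ᶻ-below-below+1 d (suc d′) = trans (cong (- pos d =ᶻ_) (neg-suc+1 d′))
  (trans (=ᶻ-below d d′) (=ⁿ-sym d d′))

=ᶻ-below-neg-below : ∀ d d′ → (- pos d =ᶻ (- - pos d′)) ≡ (d =ⁿ 0) ∧ (d′ =ⁿ 0)
=ᶻ-below-neg-below zero    zero     = refl
=ᶻ-below-neg-below zero    (suc d′) = refl
=ᶻ-below-neg-below (suc d) zero     = refl
=ᶻ-below-neg-below (suc d) (suc d′) = refl

-- `φ₁` and `φ₂` are the two clauses of `δ`, swapped since rows above come in reversed scanning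
-- order; `φ₃` and `φ₄` need areas with sum 0 or 1, but both areas are positive.
φ-above-above : ∀ x y → φ (rowAbove x) (rowAbove y) ≡ δ y x
φ-above-above (d , l) (d′ , l′)
  rewrite =ᶻ-above d d′ | =ⁿ-sym d d′
        | =ᶻ-above-above+1 d d′
        | =ᶻ-above-below d (suc d′)
        | =ᶻ-above-below+1 d (suc d′)
        | ∧-assoc (d =ⁿ 0) false ((- l′) <ᶻ l) with d =ⁿ 0
... | true  = trans (ℕₚ.+-identityʳ _) (ℕₚ.+-identityʳ _)
... | false = trans (ℕₚ.+-identityʳ _) (ℕₚ.+-identityʳ _)

-- Across the diagonal, area sums 0 and 1 mean adjacent and equal depths, so `φ₃` and `φ₄` give `δ`.
-- The arguments are swapped because roots above are scanned before roots below.
φ-below-above : ∀ x y → φ (rowBelow x) (rowAbove y) ≡ δ y x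
φ-below-above (d , l) (d′ , l′)
  rewrite =ᶻ-below-above d d′
        | =ᶻ-below-above+1 d d′
        | =ᶻ-below d (suc d′)
        | =ᶻ-below-below+1 d (suc d′)
        | <ᶻ-neg l l′ | <ᶻ-neg l′ l = ℕₚ.+-comm (𝟙 ((d =ⁿ suc d′) ∧ (l′ <ᶻ l))) _

-- `φ₃` and `φ₄` again give `δ`, now in scanning order. In addition `φ₂` holds for suitable roots,
-- whose areas 1 and 0 are adjacent; this is `ε`.
φ-above-below : ∀ x y → φ (rowAbove x) (rowBelow y) ≡ δ x y + ε x y
φ-above-below (d , l) (d′ , l′)
  rewrite =ᶻ-above-below d d′
        | =ᶻ-above-below+1 d d′
        | ∧-assoc (d =ⁿ 0) (d′ =ⁿ 0) ((- l′) <ᶻ l)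
        | ℤₚ.neg-involutive l′
        | ℤₚ.neg-involutive (pos d′)
        | ℕₚ.+-comm d′ 1
        | =ᶻ-above d d′ = go d′
  where
  e = ε (d , l) (d′ , l′)
  go : ∀ d″ → e + 𝟙 ((pos (suc d) =ᶻ pos d″) ∧ (l <ᶻ l′)) + 𝟙 ((d =ⁿ d′) ∧ (l′ <ᶻ l))
    ≡ 𝟙 ((d =ⁿ d′) ∧ (l′ <ᶻ l)) + 𝟙 ((d″ =ⁿ suc d) ∧ (l <ᶻ l′)) + e
  go d″ rewrite =ⁿ-sym d″ (suc d) =
    trans (ℕₚ.+-assoc e _ _) (trans (cong (e +_) (ℕₚ.+-comm (𝟙 ((suc d =ⁿ d″) ∧ (l <ᶻ l′))) _)) (ℕₚ.+-comm e _))

-- Here `φ₁` and `φ₂` give `δ`, as negation reverses both comparisons, and `ε` comes from `φ₃` at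
-- two areas 0.
φ-below-below : ∀ x y → φ (rowBelow x) (rowBelow y) ≡ δ x y + ε x y
φ-below-below (d , l) (d′ , l′)
  rewrite =ᶻ-below d d′
        | =ᶻ-below-below+1 d d′
        | =ᶻ-below-neg-below d d′
        | <ᶻ-neg l l′ | <ᶻ-neg l′ l
        | ℤₚ.neg-involutive l′
        | <ᶻ-negˡ l l′
        | ∧-assoc (d =ⁿ 0) (d′ =ⁿ 0) ((- l′) <ᶻ l)
        | ℤₚ.neg-involutive (pos d′)
        | ℕₚ.+-comm d′ 1
        | =ᶻ-below-above d d′ = ℕₚ.+-identityʳ _

ψ-below : ∀ x → ψ (rowBelow x) ≡ ε x x
ψ-below (zero  , l) = cong 𝟙 (<ᶻ-0 l)
ψ-below (suc d , l) = refl

inv : List Tree → ℕ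
inv F = pairSum δ (scan 0 F)

-- The count includes `t` itself, which accounts for the single rows with negative label. The list
-- `roots m ++ t ∷ []` is also what is left of the roots when the North letter of `t` is drawn.
extra : Excursions → ℕ
extra []                = 0
extra ((true  , t) ∷ m) = extra m
extra ((false , t) ∷ m) = extra m + count ((- label t) <ᶻ_) (labels (roots m ++ t ∷ []))

∑-rowsOf : ∀ {G : ℤ × ℤ → ℕ} {H : ℕ × ℤ → ℕ} → (∀ x → G (rowAbove x) ≡ H x) → (∀ x → G (rowBelow x) ≡ H x) →
  ∀ m → ∑ G (rowsOf m) ≡ ∑ H (scan 0 (roots m))
∑-rowsOf a b [] = refl
∑-rowsOf {G} {H} a b ((true , t) ∷ m)
  rewrite ∑-++ G (rowsOf m) (map rowAbove (reverse (scan 0 (t ∷ []))))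
        | ∑-map G rowAbove (reverse (scan 0 (t ∷ [])))
        | ∑-cong {f = G ∘ rowAbove} a (reverse (scan 0 (t ∷ [])))
        | ∑-reverse H (scan 0 (t ∷ []))
        | scan-++ 0 (t ∷ []) (roots m)
        | ∑-rowsOf {G} {H} a b m =
  trans (ℕₚ.+-comm (∑ H (scan 0 (roots m))) _)
    (sym (∑-++ H (scan 0 (t ∷ [])) (scan 0 (roots m))))
∑-rowsOf {G} {H} a b ((false , t) ∷ m)
  rewrite ∑-++ G (rowsOf m) (map rowBelow (scan 0 (t ∷ [])))
        | ∑-map G rowBelow (scan 0 (t ∷ []))
        | ∑-cong {f = G ∘ rowBelow} b (scan 0 (t ∷ []))
        | scan-++ 0 (roots m) (t ∷ [])
        | ∑-rowsOf {G} {H} a b m = sym (∑-++ H (scan 0 (roots m)) (scan 0 (t ∷ [])))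

∑-vanish : ∀ {f : A → ℕ} {xs} → All (λ x → f x ≡ 0) xs → ∑ f xs ≡ 0
∑-vanish []       = refl
∑-vanish (e ∷ es) = cong₂ _+_ e (∑-vanish es)

∑-roots : ∀ (f : ℕ × ℤ → ℕ) → (∀ d l → f (suc d , l) ≡ 0) → ∀ F → ∑ f (scan 0 F) ≡ ∑ (λ l → f (0 , l)) (labels F)
∑-roots f e []             = refl
∑-roots f e (node l c ∷ F) = trans (∑-++ f (scan 1 c) _) (cong₂ _+_
  (∑-vanish (All.map (λ { {suc d , l} (s≤s _) → e d l }) (scan-depth 1 c)))
  (cong (f (0 , l) +_) (∑-roots f e F)))

∑-ε : ∀ F t → ∑ (λ x → ∑ (ε x) (scan 0 (t ∷ []))) (scan 0 F) ≡ count ((- label t) <ᶻ_) (labels F)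
∑-ε F (node l c) = begin
  ∑ (λ x → ∑ (ε x) (scan 0 (node l c ∷ []))) (scan 0 F)
    ≡⟨ ∑-cong (λ x → trans (∑-roots (ε x) (λ d l′ → ε-deepʳ x d l′) (node l c ∷ [])) (ℕₚ.+-identityʳ _)) (scan 0 F) ⟩
  ∑ (λ x → ε x (0 , l)) (scan 0 F)
    ≡⟨ ∑-roots (λ x → ε x (0 , l)) (λ _ _ → refl) F ⟩
  ∑ (λ l′ → 𝟙 ((- l) <ᶻ l′)) (labels F)
    ≡⟨ sym (count-∑ ((- l) <ᶻ_) (labels F)) ⟩
  count ((- l) <ᶻ_) (labels F) ∎
  where
  open ≡-Reasoning
  ε-deepʳ : ∀ x d l′ → ε x (suc d , l′) ≡ 0
  ε-deepʳ (zero  , _) d l′ = refl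
  ε-deepʳ (suc _ , _) d l′ = refl

pairSum-ε : ∀ t → pairSum ε (scan 0 (t ∷ [])) ≡ 0
pairSum-ε (node l c) = trans (pairSum-++ ε (scan 1 c) ((0 , l) ∷ [])) (cong₂ (λ x y → x + 0 + y) (deep (scan-depth 1 c))
  (∑-vanish (All.map (λ { {suc d , l′} (s≤s _) → refl }) (scan-depth 1 c))))
  where
  deep : ∀ {xs} → All (λ x → 1 ≤ proj₁ x) xs → pairSum ε xs ≡ 0
  deep []                                = refl
  deep {(suc d , l′) ∷ xs} (s≤s _ ∷ as) = cong₂ _+_ (∑-zero xs) (deep as)

-- The latest excursion joins `roots` at the front if above and at the back if below, matching the
-- argument order of `δ` in the four cases. A tree below adds its `ε`-pairs with the earlier roots
-- and its `ψ`-term, which together are its share of `extra`.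
dinvRows-path : ∀ m → dinvRows (rowsOf m) ≡ inv (roots m) + extra m
dinvRows-path [] = refl
dinvRows-path ((true , t) ∷ m) = begin
  pairSum φ (R ++ r) + ∑ ψ (R ++ r)
    ≡⟨ cong₂ _+_ (pairSum-++ φ R r) (∑-++ ψ R r) ⟩
  (pairSum φ R + pairSum φ r + cross φ R r) + (∑ ψ R + ∑ ψ r)
    ≡⟨ cong₂ (λ x y → pairSum φ R + x + y + (∑ ψ R + ∑ ψ r)) within between ⟩
  (pairSum φ R + inv (t ∷ []) + X) + (∑ ψ R + ∑ ψ r)
    ≡⟨ cong (λ z → (pairSum φ R + inv (t ∷ []) + X) + (∑ ψ R + z)) no-ψ ⟩
  (pairSum φ R + inv (t ∷ []) + X) + (∑ ψ R + 0)
    ≡⟨ cong (_+ (∑ ψ R + 0)) (ℕₚ.+-assoc (pairSum φ R) (inv (t ∷ [])) X) ⟩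
  (pairSum φ R + (inv (t ∷ []) + X)) + (∑ ψ R + 0)
    ≡⟨ +-interchange (pairSum φ R) _ (∑ ψ R) 0 ⟩
  dinvRows R + (inv (t ∷ []) + X + 0)
    ≡⟨ cong₂ _+_ (dinvRows-path m) (ℕₚ.+-identityʳ _) ⟩
  (inv (roots m) + extra m) + (inv (t ∷ []) + X)
    ≡⟨ +-interchange (inv (roots m)) (extra m) (inv (t ∷ [])) X ⟩
  (inv (roots m) + inv (t ∷ [])) + (extra m + X)
    ≡⟨ cong₂ _+_ (ℕₚ.+-comm (inv (roots m)) _) (ℕₚ.+-comm (extra m) X) ⟩
  (inv (t ∷ []) + inv (roots m)) + (X + extra m)
    ≡⟨ sym (ℕₚ.+-assoc (inv (t ∷ []) + inv (roots m)) X (extra m)) ⟩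
  (inv (t ∷ []) + inv (roots m) + X) + extra m
    ≡⟨ cong (_+ extra m) (sym (trans (cong (pairSum δ) (scan-++ 0 (t ∷ []) (roots m)))
         (pairSum-++ δ S (scan 0 (roots m))))) ⟩
  inv (t ∷ roots m) + extra m ∎
  where
  open ≡-Reasoning
  S = scan 0 (t ∷ [])
  R = rowsOf m
  r = map rowAbove (reverse S)
  X = cross δ S (scan 0 (roots m))
  within : pairSum φ r ≡ inv (t ∷ [])
  within = trans (pairSum-map φ rowAbove (reverse S))
    (trans (pairSum-cong φ-above-above (reverse S)) (pairSum-reverse (flip δ) S))
  row : ∀ x y → (∀ z → φ x (rowAbove z) ≡ δ z y) → ∑ (φ x) r ≡ ∑ (λ z → δ z y) S
  row x y e = trans (∑-map (φ x) rowAbove (reverse S)) (trans (∑-cong e (reverse S)) (∑-reverse (λ z → δ z y) S))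
  between : cross φ R r ≡ X
  between = trans (∑-rowsOf {G = λ x → ∑ (φ x) r} {H = λ y → ∑ (λ z → δ z y) S}
      (λ x → row (rowAbove x) x (φ-above-above x)) (λ x → row (rowBelow x) x (φ-below-above x)) m)
    (∑-swap (λ y z → δ z y) (scan 0 (roots m)) S)
  no-ψ : ∑ ψ r ≡ 0
  no-ψ = trans (∑-map ψ rowAbove (reverse S)) (∑-zero (reverse S))
dinvRows-path ((false , t) ∷ m) = begin
  pairSum φ (R ++ r) + ∑ ψ (R ++ r)
    ≡⟨ cong₂ _+_ (pairSum-++ φ R r) (∑-++ ψ R r) ⟩
  (pairSum φ R + pairSum φ r + cross φ R r) + (∑ ψ R + ∑ ψ r)
    ≡⟨ cong₂ (λ x y → pairSum φ R + x + y + (∑ ψ R + ∑ ψ r)) within between ⟩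
  (pairSum φ R + inv (t ∷ []) + (X + Y)) + (∑ ψ R + ∑ ψ r)
    ≡⟨ cong (_+ (∑ ψ R + ∑ ψ r)) (ℕₚ.+-assoc (pairSum φ R) (inv (t ∷ [])) (X + Y)) ⟩
  (pairSum φ R + (inv (t ∷ []) + (X + Y))) + (∑ ψ R + ∑ ψ r)
    ≡⟨ +-interchange (pairSum φ R) _ (∑ ψ R) (∑ ψ r) ⟩
  dinvRows R + (inv (t ∷ []) + (X + Y) + ∑ ψ r)
    ≡⟨ cong₂ _+_ (dinvRows-path m) (trans (cong (_+ ∑ ψ r) (sym (ℕₚ.+-assoc (inv (t ∷ [])) X Y))) (ℕₚ.+-assoc (inv (t ∷ []) + X) Y (∑ ψ r))) ⟩
  (inv (roots m) + extra m) + ((inv (t ∷ []) + X) + (Y + ∑ ψ r))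
    ≡⟨ +-interchange (inv (roots m)) (extra m) (inv (t ∷ []) + X) (Y + ∑ ψ r) ⟩
  (inv (roots m) + (inv (t ∷ []) + X)) + (extra m + (Y + ∑ ψ r))
    ≡⟨ cong₂ _+_ (sym (ℕₚ.+-assoc (inv (roots m)) (inv (t ∷ [])) X)) (cong (extra m +_) corner) ⟩
  (inv (roots m) + inv (t ∷ []) + X) + extra ((false , t) ∷ m)
    ≡⟨ cong (_+ extra ((false , t) ∷ m)) (sym (trans (cong (pairSum δ) (scan-++ 0 (roots m) (t ∷ [])))
         (pairSum-++ δ (scan 0 (roots m)) S))) ⟩
  inv (roots m ++ t ∷ []) + extra ((false , t) ∷ m) ∎
  where
  open ≡-Reasoning
  S = scan 0 (t ∷ [])
  R = rowsOf m
  r = map rowBelow S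
  X = cross δ (scan 0 (roots m)) S
  Y = cross ε (scan 0 (roots m)) S
  within : pairSum φ r ≡ inv (t ∷ [])
  within = trans (pairSum-map φ rowBelow S) (trans (pairSum-cong φ-below-below S)
    (trans (pairSum-+ δ ε S) (trans (cong (inv (t ∷ []) +_) (pairSum-ε t)) (ℕₚ.+-identityʳ _))))
  row : ∀ x y → (∀ z → φ x (rowBelow z) ≡ δ y z + ε y z) → ∑ (φ x) r ≡ ∑ (λ z → δ y z + ε y z) S
  row x y e = trans (∑-map (φ x) rowBelow S) (∑-cong e S)
  between : cross φ R r ≡ X + Y
  between = begin
    cross φ R r
      ≡⟨ ∑-rowsOf {G = λ x → ∑ (φ x) r} {H = λ y → ∑ (λ z → δ y z + ε y z) S}
           (λ x → row (rowAbove x) x (φ-above-below x)) (λ x → row (rowBelow x) x (φ-below-below x)) m ⟩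
    ∑ (λ y → ∑ (λ z → δ y z + ε y z) S) (scan 0 (roots m))
      ≡⟨ ∑-cong (λ y → ∑-+ (δ y) (ε y) S) (scan 0 (roots m)) ⟩
    ∑ (λ y → ∑ (δ y) S + ∑ (ε y) S) (scan 0 (roots m))
      ≡⟨ ∑-+ (λ y → ∑ (δ y) S) (λ y → ∑ (ε y) S) (scan 0 (roots m)) ⟩
    X + Y ∎
  diagonal : ∑ ψ r ≡ ∑ (λ l → 𝟙 ((- label t) <ᶻ l)) (label t ∷ [])
  diagonal = trans (∑-map ψ rowBelow S) (trans (∑-cong ψ-below S)
    (∑-roots (λ x → ε x x) (λ _ _ → refl) (t ∷ [])))
  corner : Y + ∑ ψ r ≡ count ((- label t) <ᶻ_) (labels (roots m ++ t ∷ []))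
  corner = begin
    Y + ∑ ψ r
      ≡⟨ cong₂ _+_ (trans (∑-ε (roots m) t) (count-∑ _ (labels (roots m)))) diagonal ⟩
    ∑ (λ l → 𝟙 ((- label t) <ᶻ l)) (labels (roots m)) + ∑ (λ l → 𝟙 ((- label t) <ᶻ l)) (label t ∷ [])
      ≡⟨ sym (∑-++ _ (labels (roots m)) (label t ∷ [])) ⟩
    ∑ (λ l → 𝟙 ((- label t) <ᶻ l)) (labels (roots m) ++ label t ∷ [])
      ≡⟨ sym (count-∑ _ (labels (roots m) ++ label t ∷ [])) ⟩
    count ((- label t) <ᶻ_) (labels (roots m) ++ label t ∷ [])
      ≡⟨ cong (count ((- label t) <ᶻ_)) (sym (labels-++ (roots m) (t ∷ []))) ⟩
    count ((- label t) <ᶻ_) (labels (roots m ++ t ∷ [])) ∎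

-- The columns of area′

sumTo : (ℕ → ℕ) → ℕ → ℕ
sumTo f zero    = 0
sumTo f (suc k) = f 0 + sumTo (f ∘ suc) k

∑-oneTo : ∀ (f : ℕ → ℕ) k → ∑ f (oneTo k) ≡ sumTo (f ∘ suc) k
∑-oneTo f k = trans (∑-map f suc (upTo k)) (go (f ∘ suc) id k)
  where
  go : ∀ (g h : ℕ → ℕ) k → ∑ g (applyUpTo h k) ≡ sumTo (g ∘ h) k
  go g h zero    = refl
  go g h (suc k) = cong (g (h 0) +_) (go g (h ∘ suc) k)

sumTo-zero : ∀ f k → (∀ i → f i ≡ 0) → sumTo f k ≡ 0
sumTo-zero f zero    e = refl
sumTo-zero f (suc k) e = cong₂ _+_ (e 0) (sumTo-zero (f ∘ suc) k (e ∘ suc))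

sumTo-window : ∀ (h : ℤ → ℕ) a ls f k → (∀ i → i ℕ.< a → f i ≡ 0) →
  (∀ i → i ℕ.< length ls → f (a + i) ≡ h (at ls (suc i))) → (∀ i → f (a + length ls + i) ≡ 0) →
  a + length ls ≤ k → sumTo f k ≡ ∑ h ls
sumTo-window h zero    []       f k       z w z′ _ = sumTo-zero f k z′
sumTo-window h zero    (l ∷ ls) f (suc k) z w z′ (s≤s b) =
  cong₂ _+_ (w 0 (s≤s z≤n)) (sumTo-window h 0 ls (f ∘ suc) k (λ _ ()) (λ i lt → w (suc i) (s≤s lt)) z′ b)
sumTo-window h (suc a) ls       f (suc k) z w z′ (s≤s b) =
  cong₂ _+_ (z 0 (s≤s z≤n)) (sumTo-window h a ls (f ∘ suc) k (λ i lt → z (suc i) (s≤s lt)) w z′ b)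

at-++ʳ : ∀ (xs ys : List ℤ) i → at (xs ++ ys) (suc (length xs + i)) ≡ at ys (suc i)
at-++ʳ []       ys i = refl
at-++ʳ (x ∷ xs) ys i = at-++ʳ xs ys i

at-++ˡ : ∀ (xs ys : List ℤ) i → i ℕ.< length xs → at (xs ++ ys) (suc i) ≡ at xs (suc i)
at-++ˡ (x ∷ xs) ys zero    _        = refl
at-++ˡ (x ∷ xs) ys (suc i) (s≤s lt) = at-++ˡ xs ys i lt

∧-false : ∀ a c → 𝟙 (a ∧ false ∧ c) ≡ 0
∧-false false _ = refl
∧-false true  _ = refl

∧∧-false : ∀ a b c → 𝟙 (a ∧ b ∧ false ∧ c) ≡ 0
∧∧-false false _     _ = refl
∧∧-false true  false _ = refl
∧∧-false true  true  _ = refl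

module Area (n : ℕ) (w : List ℤ) where

  M : ℕ
  M = suc (n + n)

  -- The pairs (i , j) counted by area′ whose j-th North step has x-coordinate x.
  column : ℕ → ℕ → ℕ
  column j x = ∑ (λ i → 𝟙 ((i <ᵇ j) ∧ ((i + j) <ᵇ suc M) ∧ (x <ᵇ i) ∧ (at w j <ᶻ at w i))) (oneTo M)

  areaFrom : ℕ → ℕ → Path → ℕ
  areaFrom k x []      = 0
  areaFrom k x (N ∷ p) = column (suc k) x + areaFrom (suc k) x p
  areaFrom k x (E ∷ p) = areaFrom k (suc x) p

  maybeColumn : ℕ → Maybe ℕ → ℕ
  maybeColumn j (just x) = column j x
  maybeColumn j nothing  = 0

  area-columns : ∀ β → length (nXs 0 β) ≤ M → area′ n (β , w) ≡ areaFrom 0 0 β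
  area-columns β len = begin
    area′ n (β , w)
      ≡⟨ count-pairs _ (oneTo M) (oneTo M) ⟩
    ∑ (λ i → ∑ (λ j → 𝟙 (cell i j)) (oneTo M)) (oneTo M)
      ≡⟨ ∑-swap (λ i j → 𝟙 (cell i j)) (oneTo M) (oneTo M) ⟩
    ∑ (λ j → ∑ (λ i → 𝟙 (cell i j)) (oneTo M)) (oneTo M)
      ≡⟨ ∑-cong inner (oneTo M) ⟩
    ∑ (λ j → maybeColumn j (nth (nXs 0 β) j)) (oneTo M)
      ≡⟨ ∑-oneTo (λ j → maybeColumn j (nth (nXs 0 β) j)) M ⟩
    sumTo (λ j → maybeColumn (suc j) (nth (nXs 0 β) (suc j))) M
      ≡⟨ walk β 0 0 _ M (λ _ → refl) len ⟩
    areaFrom 0 0 β ∎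
    where
    open ≡-Reasoning
    cell : ℕ → ℕ → Bool
    cell i j = (i <ᵇ j) ∧ ((i + j) <ᵇ suc M) ∧ nStepLeftOf β j i ∧ (at w j <ᶻ at w i)
    inner : ∀ j → ∑ (λ i → 𝟙 (cell i j)) (oneTo M) ≡ maybeColumn j (nth (nXs 0 β) j)
    inner j with nth (nXs 0 β) j
    ... | just x  = refl
    ... | nothing = trans (∑-cong (λ i → ∧∧-false (i <ᵇ j) (i + j <ᵇ suc M) (at w j <ᶻ at w i)) (oneTo M)) (∑-zero (oneTo M))
    walk : ∀ p k x f K → (∀ j → f j ≡ maybeColumn (k + suc j) (nth (nXs x p) (suc j))) →
      length (nXs x p) ≤ K → sumTo f K ≡ areaFrom k x p
    walk []      k x f K       e b       = sumTo-zero f K e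
    walk (E ∷ p) k x f K       e b       = walk p k (suc x) f K e b
    walk (N ∷ p) k x f (suc K) e (s≤s b) = cong₂ _+_
      (trans (e 0) (cong (λ j → column j x) (ℕₚ.+-comm k 1)))
      (walk p (suc k) x (f ∘ suc) K
        (λ j → trans (e (suc j)) (cong (λ i → maybeColumn i (nth (nXs x p) (suc j))) (ℕₚ.+-suc k (suc j)))) b)

  -- The conditions on i leave one interval: it begins after `x` and ends with i < j or i + j ≤ 2n +
  -- 1. `cut` says which bound is sharp, the former for the first n North steps, the latter for the
  -- North letters.
  column-window : ∀ j x u v → at w j ≡ u → (∀ i → i ℕ.< length v → at w (suc (x + i)) ≡ at v (suc i)) →
    x + length v ℕ.< j → x + length v + j ≤ M →
    (j ≤ suc (x + length v)) ⊎ (M ≤ x + length v + j) →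
    column j x ≡ count (u <ᶻ_) v
  column-window j x u v refl e b₁ b₂ cut = trans (∑-oneTo test M) (trans
    (sumTo-window (λ z → 𝟙 (u <ᶻ z)) x v (test ∘ suc) M low inside (high cut)
      (ℕₚ.≤-trans (ℕₚ.m≤m+n (x + length v) j) b₂))
    (sym (count-∑ (u <ᶻ_) v)))
    where
    test : ℕ → ℕ
    test i = 𝟙 ((i <ᵇ j) ∧ ((i + j) <ᵇ suc M) ∧ (x <ᵇ i) ∧ (at w j <ᶻ at w i))
    low : ∀ i → i ℕ.< x → test (suc i) ≡ 0
    low i lt rewrite <ᵇ-false lt = ∧∧-false (suc i <ᵇ j) (suc i + j <ᵇ suc M) (at w j <ᶻ at w (suc i))
    le : ∀ i → i ℕ.< length v → suc (x + i) ≤ x + length v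
    le i lt = ℕₚ.≤-trans (ℕₚ.≤-reflexive (sym (ℕₚ.+-suc x i))) (ℕₚ.+-monoʳ-≤ x lt)
    inside : ∀ i → i ℕ.< length v → test (suc (x + i)) ≡ 𝟙 (u <ᶻ at v (suc i))
    inside i lt
      rewrite <ᵇ-true {suc (x + i)} {j} (ℕₚ.≤-<-trans (le i lt) b₁)
            | <ᵇ-true {suc (x + i) + j} {suc M} (s≤s (ℕₚ.≤-trans (ℕₚ.+-monoˡ-≤ j (le i lt)) b₂))
            | <ᵇ-true {x} {suc (x + i)} (s≤s (ℕₚ.m≤m+n x i))
            | e i lt = refl
    high : (j ≤ suc (x + length v)) ⊎ (M ≤ x + length v + j) → ∀ i → test (suc (x + length v + i)) ≡ 0
    high (inj₁ c) i rewrite <ᵇ-false {suc (x + length v + i)} {j} (ℕₚ.≤-trans c (s≤s (ℕₚ.m≤m+n _ i))) = refl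
    high (inj₂ c) i rewrite <ᵇ-false {suc (x + length v + i) + j} {suc M}
        (s≤s (ℕₚ.≤-trans c (ℕₚ.+-monoˡ-≤ j (ℕₚ.m≤m+n (x + length v) i)))) = ∧-false (suc (x + length v + i) <ᵇ j)
          ((x <ᵇ suc (x + length v + i)) ∧ (at w j <ᶻ at w (suc (x + length v + i))))

-- The recursion along the queue

scan-suc : ∀ d F → scan (suc d) F ≡ map (λ x → suc (proj₁ x) , proj₂ x) (scan d F)
scan-suc d []             = refl
scan-suc d (node l c ∷ F) = trans (cong₂ (λ x y → x ++ (suc d , l) ∷ y) (scan-suc (suc d) c) (scan-suc d F))
  (sym (map-++ _ (scan (suc d) c) _))

-- Pushing moves `c` from before `Q` to behind it and one level down. For a node of `c` and one of
-- `Q` this exchanges the clauses of `δ` for equal and adjacent depths, so their total is kept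
-- (`flip-δ`). The new root is scanned last and at depth 0, so it is compared only with the roots of
-- `Q`.
inv-push : ∀ l c Q → inv (Q ++ node l c ∷ []) ≡ inv (c ++ Q) + count (l <ᶻ_) (labels Q)
inv-push l c Q = begin
  inv (Q ++ node l c ∷ [])
    ≡⟨ cong (pairSum δ) (scan-++ 0 Q (node l c ∷ [])) ⟩
  pairSum δ (q ++ (c⁺ ++ x ∷ []))
    ≡⟨ pairSum-++ δ q (c⁺ ++ x ∷ []) ⟩
  pairSum δ q + pairSum δ (c⁺ ++ x ∷ []) + cross δ q (c⁺ ++ x ∷ [])
    ≡⟨ cong₂ (λ a b → pairSum δ q + a + b) shifted across ⟩
  pairSum δ q + pairSum δ c⁰ + (cross δ c⁰ q + count (l <ᶻ_) (labels Q))
    ≡⟨ sym (ℕₚ.+-assoc (pairSum δ q + pairSum δ c⁰) (cross δ c⁰ q) _) ⟩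
  pairSum δ q + pairSum δ c⁰ + cross δ c⁰ q + count (l <ᶻ_) (labels Q)
    ≡⟨ cong (λ z → z + cross δ c⁰ q + count (l <ᶻ_) (labels Q)) (ℕₚ.+-comm (pairSum δ q) _) ⟩
  pairSum δ c⁰ + pairSum δ q + cross δ c⁰ q + count (l <ᶻ_) (labels Q)
    ≡⟨ cong (_+ count (l <ᶻ_) (labels Q)) (sym (trans (cong (pairSum δ) (scan-++ 0 c Q)) (pairSum-++ δ c⁰ q))) ⟩
  inv (c ++ Q) + count (l <ᶻ_) (labels Q) ∎
  where
  open ≡-Reasoning
  q c⁰ c⁺ : List (ℕ × ℤ)
  q  = scan 0 Q
  c⁰ = scan 0 c
  c⁺ = scan 1 c
  x : ℕ × ℤ
  x = 0 , l
  deeper : ℕ × ℤ → ℕ × ℤ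
  deeper y = suc (proj₁ y) , proj₂ y
  shifted : pairSum δ (c⁺ ++ x ∷ []) ≡ pairSum δ c⁰
  shifted = trans (pairSum-++ δ c⁺ (x ∷ [])) (trans
    (cong₂ _+_ (trans (ℕₚ.+-identityʳ _) (trans (cong (pairSum δ) (scan-suc 0 c)) (pairSum-map δ deeper c⁰)))
      (∑-vanish {f = λ y → δ y x + 0} (All.map (λ { {suc d , l′} (s≤s _) → refl }) (scan-depth 1 c))))
    (ℕₚ.+-identityʳ _))
  across : cross δ q (c⁺ ++ x ∷ []) ≡ cross δ c⁰ q + count (l <ᶻ_) (labels Q)
  across = begin
    ∑ (λ y → ∑ (δ y) (c⁺ ++ x ∷ [])) q
      ≡⟨ ∑-cong (λ y → ∑-++ (δ y) c⁺ (x ∷ [])) q ⟩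
    ∑ (λ y → ∑ (δ y) c⁺ + (δ y x + 0)) q
      ≡⟨ ∑-+ (λ y → ∑ (δ y) c⁺) (λ y → δ y x + 0) q ⟩
    ∑ (λ y → ∑ (δ y) c⁺) q + ∑ (λ y → δ y x + 0) q
      ≡⟨ cong₂ _+_ descend-one top ⟩
    cross δ c⁰ q + count (l <ᶻ_) (labels Q) ∎
    where
    descend-one : ∑ (λ y → ∑ (δ y) c⁺) q ≡ cross δ c⁰ q
    descend-one = begin
      ∑ (λ y → ∑ (δ y) c⁺) q
        ≡⟨ ∑-cong (λ y → trans (cong (∑ (δ y)) (scan-suc 0 c)) (∑-map (δ y) deeper c⁰)) q ⟩
      ∑ (λ y → ∑ (λ z → δ y (deeper z)) c⁰) q
        ≡⟨ ∑-cong (λ y → ∑-cong (λ z → flip-δ y z) c⁰) q ⟩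
      ∑ (λ y → ∑ (λ z → δ z y) c⁰) q
        ≡⟨ ∑-swap (λ y z → δ z y) q c⁰ ⟩
      cross δ c⁰ q ∎
      where
      flip-δ : ∀ y z → δ y (deeper z) ≡ δ z y
      flip-δ (d , s) (d′ , s′) rewrite =ⁿ-sym d′ d = ℕₚ.+-comm (𝟙 ((d =ⁿ suc d′) ∧ (s′ <ᶻ s))) _
    top : ∑ (λ y → δ y x + 0) q ≡ count (l <ᶻ_) (labels Q)
    top = begin
      ∑ (λ y → δ y x + 0) q
        ≡⟨ ∑-roots (λ y → δ y x + 0) (λ _ _ → refl) Q ⟩
      ∑ (λ s → 𝟙 (l <ᶻ s) + 0 + 0) (labels Q)
        ≡⟨ ∑-cong (λ s → trans (ℕₚ.+-identityʳ _) (ℕₚ.+-identityʳ _)) (labels Q) ⟩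
      ∑ (λ s → 𝟙 (l <ᶻ s)) (labels Q)
        ≡⟨ sym (count-∑ (l <ᶻ_) (labels Q)) ⟩
      count (l <ᶻ_) (labels Q) ∎

nXs-length : ∀ x p → length (nXs x p) ≡ numN p
nXs-length x []      = refl
nXs-length x (N ∷ p) = cong suc (nXs-length x p)
nXs-length x (E ∷ p) = nXs-length (suc x) p

length-labels : ∀ F → length (labels F) ≡ length F
length-labels = length-map label

length-negLabels : ∀ F → length (negLabels F) ≡ length F
length-negLabels F = trans (length-map -_ (reverse (labels F))) (trans (length-reverse (labels F)) (length-labels F))

module _ (n : ℕ) (w : List ℤ) where

  open Area n w

  areaFrom-Es : ∀ e k x p → areaFrom k x (replicate e E ++ p) ≡ areaFrom k (x + e) p
  areaFrom-Es zero    k x p = cong (λ y → areaFrom k y p) (sym (ℕₚ.+-identityʳ x))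
  areaFrom-Es (suc e) k x p = trans (areaFrom-Es e k (suc x) p) (cong (λ y → areaFrom k y p) (sym (ℕₚ.+-suc x e)))

  window : ∀ (A Q : List Tree) v → w ≡ labels (A ++ Q) ++ v →
    ∀ i → i ℕ.< length (labels Q) → at w (suc (length A + i)) ≡ at (labels Q) (suc i)
  window A Q v refl i lt
    rewrite labels-++ A Q | ++-assoc (labels A) (labels Q) v | sym (length-labels A) =
    trans (at-++ʳ (labels A) (labels Q ++ v) i) (at-++ˡ (labels Q) v i lt)

  -- Positions |A| + 1 to |A| + |Q| of the word carry the queue `Q` left after popping, and `t`
  -- comes right behind, so the window is closed by i < j.
  column-push : ∀ A Q t v → w ≡ labels (A ++ Q ++ t ∷ []) ++ v → length (A ++ Q ++ t ∷ []) ≤ n →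
    column (suc (length A + length Q)) (length A) ≡ count (label t <ᶻ_) (labels Q)
  column-push A Q t v e b = column-window (suc k) (length A) (label t) (labels Q)
    (trans (cong (at w ∘ suc) (trans (cong (length A +_) (sym (ℕₚ.+-identityʳ (length Q)))) (sym (ℕₚ.+-assoc (length A) (length Q) 0))))
      label-at)
    (window A Q (label t ∷ v) e₁)
    (ℕₚ.≤-reflexive (cong suc k≡))
    (ℕₚ.≤-trans (ℕₚ.≤-reflexive (trans (cong (_+ suc k) k≡) (ℕₚ.+-suc k k)))
      (s≤s (ℕₚ.≤-trans (ℕₚ.+-mono-≤ k≤n k≤n) ℕₚ.≤-refl)))
    (inj₁ (ℕₚ.≤-reflexive (cong suc (sym k≡))))
    where
    k : ℕ
    k = length A + length Q
    k≡ : length A + length (labels Q) ≡ k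
    k≡ = cong (length A +_) (length-labels Q)
    e₁ : w ≡ labels (A ++ Q) ++ label t ∷ v
    e₁ = trans e (trans (cong (_++ v) (trans (cong labels (sym (++-assoc A Q (t ∷ [])))) (labels-++ (A ++ Q) (t ∷ []))))
      (++-assoc (labels (A ++ Q)) _ v))
    label-at : at w (suc (length A + length Q + 0)) ≡ label t
    label-at = trans (cong₂ at e₁ (cong (λ z → suc (z + 0))
      (sym (trans (length-labels (A ++ Q)) (length-++ A))))) (at-++ʳ (labels (A ++ Q)) (label t ∷ v) 0)
    k≤n : k ≤ n
    k≤n = ℕₚ.≤-trans (ℕₚ.≤-trans (ℕₚ.≤-reflexive (sym (length-++ A)))
        (ℕₚ.≤-trans (length-++-≤ˡ (A ++ Q)) (ℕₚ.≤-reflexive (cong length (++-assoc A Q (t ∷ [])))))) b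

  -- A holds the trees popped from the queue so far, kids F ++ Q the current queue.
  areaFrom-unary : ∀ F A Q v p → w ≡ labels (A ++ (kids F ++ Q) ++ F) ++ v →
    length (A ++ (kids F ++ Q) ++ F) ≤ n →
    inv (kids F ++ Q) + areaFrom (length (A ++ kids F ++ Q)) (length A) (unary F ++ p)
      ≡ inv (Q ++ F) + areaFrom (length (A ++ (kids F ++ Q) ++ F)) (length (A ++ kids F)) p
  areaFrom-unary [] A Q v p e b
    rewrite ++-identityʳ Q | ++-identityʳ A = refl
  areaFrom-unary (t@(node l c) ∷ F) A Q v p e b = begin
    inv ((c ++ kids F) ++ Q) + areaFrom (length (A ++ (c ++ kids F) ++ Q)) (length A) ((replicate (length c) E ++ N ∷ unary F) ++ p)
      ≡⟨ cong₂ (λ R z → inv R + areaFrom (length (A ++ R)) (length A) z)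
           (++-assoc c (kids F) Q) (++-assoc (replicate (length c) E) (N ∷ unary F) p) ⟩
    inv (c ++ R) + areaFrom (length (A ++ c ++ R)) (length A) (replicate (length c) E ++ N ∷ unary F ++ p)
      ≡⟨ cong (inv (c ++ R) +_) (areaFrom-Es (length c) (length (A ++ c ++ R)) (length A) (N ∷ unary F ++ p)) ⟩
    inv (c ++ R) + areaFrom (length (A ++ c ++ R)) (length A + length c) (N ∷ unary F ++ p)
      ≡⟨ cong₂ (λ y z → inv (c ++ R) + areaFrom y z (N ∷ unary F ++ p))
           (trans (cong length (sym (++-assoc A c R))) (length-++ (A ++ c))) (sym (length-++ A)) ⟩
    inv (c ++ R) + (column (suc (length A′ + length R)) (length A′) + areaFrom (suc (length A′ + length R)) (length A′) (unary F ++ p))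
      ≡⟨ sym (ℕₚ.+-assoc (inv (c ++ R)) _ _) ⟩
    inv (c ++ R) + column (suc (length A′ + length R)) (length A′) + areaFrom (suc (length A′ + length R)) (length A′) (unary F ++ p)
      ≡⟨ cong₂ (λ y z → inv (c ++ R) + y + areaFrom z (length A′) (unary F ++ p))
           (column-push A′ R t (labels F ++ v) e₁ b₁) counter ⟩
    -- The column of the new North step is exactly the increment in `inv-push`.
    inv (c ++ R) + count (l <ᶻ_) (labels R) + areaFrom (length (A′ ++ kids F ++ Q′)) (length A′) (unary F ++ p)
      ≡⟨ cong (_+ areaFrom (length (A′ ++ kids F ++ Q′)) (length A′) (unary F ++ p))
           (trans (sym (inv-push l c R)) (cong inv (++-assoc (kids F) Q (t ∷ [])))) ⟩
    inv (kids F ++ Q′) + areaFrom (length (A′ ++ kids F ++ Q′)) (length A′) (unary F ++ p)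
      ≡⟨ areaFrom-unary F A′ Q′ v p (trans e (cong (λ z → labels z ++ v) (sym whole))) (subst (λ z → length z ≤ n) (sym whole) b) ⟩
    inv (Q′ ++ F) + areaFrom (length (A′ ++ (kids F ++ Q′) ++ F)) (length (A′ ++ kids F)) p
      ≡⟨ cong₂ (λ y z → inv y + z) (++-assoc Q (t ∷ []) F)
           (cong₂ (λ y z → areaFrom (length y) (length z) p) whole (++-assoc A c (kids F))) ⟩
    inv (Q ++ t ∷ F) + areaFrom (length (A ++ ((c ++ kids F) ++ Q) ++ t ∷ F)) (length (A ++ c ++ kids F)) p ∎
    where
    open ≡-Reasoning
    R A′ Q′ : List Tree
    R  = kids F ++ Q
    A′ = A ++ c
    Q′ = Q ++ t ∷ []
    whole : A′ ++ (kids F ++ Q′) ++ F ≡ A ++ ((c ++ kids F) ++ Q) ++ t ∷ F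
    whole = begin
      (A ++ c) ++ (kids F ++ Q ++ t ∷ []) ++ F    ≡⟨ ++-assoc A c _ ⟩
      A ++ c ++ (kids F ++ Q ++ t ∷ []) ++ F      ≡⟨ cong (λ z → A ++ c ++ z ++ F) (sym (++-assoc (kids F) Q (t ∷ []))) ⟩
      A ++ c ++ (R ++ t ∷ []) ++ F                ≡⟨ cong (λ z → A ++ c ++ z) (++-assoc R (t ∷ []) F) ⟩
      A ++ c ++ R ++ t ∷ F                        ≡⟨ cong (A ++_) (sym (++-assoc c R (t ∷ F))) ⟩
      A ++ (c ++ R) ++ t ∷ F                      ≡⟨ cong (λ z → A ++ z ++ t ∷ F) (sym (++-assoc c (kids F) Q)) ⟩
      A ++ ((c ++ kids F) ++ Q) ++ t ∷ F          ∎
    whole′ : A ++ ((c ++ kids F) ++ Q) ++ t ∷ F ≡ (A′ ++ R ++ t ∷ []) ++ F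
    whole′ = trans (sym whole) (trans (cong (λ z → A′ ++ z ++ F) (sym (++-assoc (kids F) Q (t ∷ []))))
      (sym (++-assoc A′ (R ++ t ∷ []) F)))
    e₁ : w ≡ labels (A′ ++ R ++ t ∷ []) ++ labels F ++ v
    e₁ = trans e (trans (cong (_++ v) (trans (cong labels whole′) (labels-++ (A′ ++ R ++ t ∷ []) F)))
      (++-assoc (labels (A′ ++ R ++ t ∷ [])) (labels F) v))
    b₁ : length (A′ ++ R ++ t ∷ []) ≤ n
    b₁ = ℕₚ.≤-trans (length-++-≤ˡ (A′ ++ R ++ t ∷ [])) (subst (λ z → length z ≤ n) whole′ b)
    counter : suc (length A′ + length R) ≡ length (A′ ++ kids F ++ Q′)
    counter = sym (trans (cong length (trans (cong (A′ ++_) (sym (++-assoc (kids F) Q (t ∷ [])))) (sym (++-assoc A′ R (t ∷ [])))))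
      (trans (length-++-comm (A′ ++ R) (t ∷ [])) (cong suc (length-++ A′))))

  -- Between two levels the queue is the level just completed, so `areaFrom-unary` applies with `Q`
  -- empty.
  areaFrom-nodes : ∀ h F v p → descend h F ≡ [] → w ≡ labels (nodes h F) ++ v → length (nodes h F) ≤ n →
    areaFrom 0 0 (unary (nodes h F) ++ p) ≡ inv F + areaFrom (length (nodes h F)) (length (kids (nodes h F))) p
  areaFrom-nodes zero    F v p e we b rewrite e = refl
  areaFrom-nodes (suc h) F v p e we b = begin
    areaFrom 0 0 (unary (G ++ F) ++ p)
      ≡⟨ cong (areaFrom 0 0) (trans (cong (_++ p) (unary-++ G F)) (++-assoc (unary G) (unary F) p)) ⟩
    areaFrom 0 0 (unary G ++ unary F ++ p)
      ≡⟨ areaFrom-nodes h (kids F) (labels F ++ v) (unary F ++ p) e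
           (trans we (trans (cong (_++ v) (labels-++ G F)) (++-assoc (labels G) (labels F) v)))
           (ℕₚ.≤-trans (length-++-≤ˡ G) b) ⟩
    inv (kids F) + areaFrom (length G) (length (kids G)) (unary F ++ p)
      ≡⟨ cong₂ (λ y z → inv y + areaFrom (length z) (length (kids G)) (unary F ++ p))
           (sym (++-identityʳ (kids F))) (sym queue) ⟩
    inv (kids F ++ []) + areaFrom (length (kids G ++ kids F ++ [])) (length (kids G)) (unary F ++ p)
      ≡⟨ areaFrom-unary F (kids G) [] v p (trans we (cong (λ z → labels z ++ v) (sym whole)))
           (subst (λ z → length z ≤ n) (sym whole) b) ⟩
    inv F + areaFrom (length (kids G ++ (kids F ++ []) ++ F)) (length (kids G ++ kids F)) p
      ≡⟨ cong₂ (λ y z → inv F + areaFrom (length y) (length z) p) whole (sym (kids-++ G F)) ⟩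
    inv F + areaFrom (length (G ++ F)) (length (kids (G ++ F))) p ∎
    where
    open ≡-Reasoning
    G : List Tree
    G = nodes h (kids F)
    queue : kids G ++ kids F ++ [] ≡ G
    queue = trans (cong (kids G ++_) (++-identityʳ (kids F))) (kids-nodes h (kids F) e)
    whole : kids G ++ (kids F ++ []) ++ F ≡ G ++ F
    whole = trans (sym (++-assoc (kids G) (kids F ++ []) F)) (cong (_++ F) queue)

  -- A holds the trees popped by East steps, Z those whose North step has been drawn.
  areaFrom-letters : ∀ m A Z → w ≡ labels (A ++ roots m ++ Z) ++ negLabels (A ++ roots m ++ Z) →
    length (A ++ roots m ++ Z) ≡ n → areaFrom (n + length Z) (length A) (letters m) ≡ extra m
  areaFrom-letters []                A Z e b = refl
  areaFrom-letters ((true  , t) ∷ m) A Z e b = trans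
    (cong (λ z → areaFrom (n + length Z) z (letters m)) (sym (length-++-comm A (t ∷ []))))
    (areaFrom-letters m (A ++ t ∷ []) Z
      (trans e (cong (λ z → labels z ++ negLabels z) (sym (++-assoc A (t ∷ []) (roots m ++ Z)))))
      (trans (cong length (++-assoc A (t ∷ []) (roots m ++ Z))) b))
  areaFrom-letters ((false , t) ∷ m) A Z e b = begin
    column (suc (n + length Z)) (length A) + areaFrom (suc (n + length Z)) (length A) (letters m)
      ≡⟨ cong₂ _+_ window-column (trans (cong (λ z → areaFrom z (length A) (letters m)) (sym (ℕₚ.+-suc n (length Z))))
           (areaFrom-letters m A (t ∷ Z)
             (trans e (cong (λ z → labels z ++ negLabels z) whole)) (trans (cong length (sym whole)) b))) ⟩
    count ((- label t) <ᶻ_) (labels r) + extra m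
      ≡⟨ ℕₚ.+-comm _ (extra m) ⟩
    extra m + count ((- label t) <ᶻ_) (labels r) ∎
    where
    open ≡-Reasoning
    r G : List Tree
    r = roots m ++ t ∷ []
    G = A ++ r ++ Z
    whole : G ≡ A ++ roots m ++ t ∷ Z
    whole = cong (A ++_) (++-assoc (roots m) (t ∷ []) Z)
    top : length A + length (labels r) + length Z ≡ n
    top = trans (cong (λ z → length A + z + length Z) (length-labels r)) (trans (ℕₚ.+-assoc (length A) (length r) (length Z))
      (trans (cong (length A +_) (sym (length-++ r))) (trans (sym (length-++ A)) b)))
    negLabels-G : negLabels G ≡ negLabels Z ++ - label t ∷ negLabels (A ++ roots m)
    negLabels-G = begin
      negLabels G
        ≡⟨ cong negLabels (trans whole (trans (cong (A ++_) (sym (++-assoc (roots m) (t ∷ []) Z)))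
             (trans (sym (++-assoc A r Z)) (cong (_++ Z) (sym (++-assoc A (roots m) (t ∷ [])))))) ) ⟩
      negLabels (((A ++ roots m) ++ t ∷ []) ++ Z)
        ≡⟨ negLabels-++ ((A ++ roots m) ++ t ∷ []) Z ⟩
      negLabels Z ++ negLabels ((A ++ roots m) ++ t ∷ [])
        ≡⟨ cong (negLabels Z ++_) (negLabels-∷ʳ (A ++ roots m) t) ⟩
      negLabels Z ++ - label t ∷ negLabels (A ++ roots m) ∎
    label-at : at w (suc (n + length Z)) ≡ - label t
    label-at = begin
      at w (suc (n + length Z))
        ≡⟨ cong₂ (λ y z → at y (suc (z + length Z))) e (sym (trans (length-labels G) b)) ⟩
      at (labels G ++ negLabels G) (suc (length (labels G) + length Z))
        ≡⟨ at-++ʳ (labels G) (negLabels G) (length Z) ⟩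
      at (negLabels G) (suc (length Z))
        ≡⟨ cong₂ (λ y z → at y (suc z)) negLabels-G
             (trans (sym (ℕₚ.+-identityʳ (length Z))) (cong (_+ 0) (sym (length-negLabels Z)))) ⟩
      at (negLabels Z ++ - label t ∷ negLabels (A ++ roots m)) (suc (length (negLabels Z) + 0))
        ≡⟨ at-++ʳ (negLabels Z) _ 0 ⟩
      - label t ∎
    e₁ : w ≡ labels (A ++ r) ++ labels Z ++ negLabels G
    e₁ = trans e (trans (cong (_++ negLabels G) (trans (cong labels (sym (++-assoc A r Z))) (labels-++ (A ++ r) Z)))
      (++-assoc (labels (A ++ r)) (labels Z) (negLabels G)))
    a : ℕ
    a = length A + length (labels r)
    a≤n : a ≤ n
    a≤n = ℕₚ.≤-trans (ℕₚ.m≤m+n a (length Z)) (ℕₚ.≤-reflexive top)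
    -- The position of `t` among the nodes and that of its negative in the second half of the word
    -- add up to 2n + 1. The bound on i + j thus ends the window right after `t`.
    sum≡ : a + suc (n + length Z) ≡ M
    sum≡ = begin
      a + suc (n + length Z)      ≡⟨ ℕₚ.+-suc a _ ⟩
      suc (a + (n + length Z))    ≡⟨ cong (λ z → suc (a + z)) (ℕₚ.+-comm n (length Z)) ⟩
      suc (a + (length Z + n))    ≡⟨ cong suc (sym (ℕₚ.+-assoc a (length Z) n)) ⟩
      suc (a + length Z + n)      ≡⟨ cong (λ z → suc (z + n)) top ⟩
      suc (n + n)                 ∎
    window-column : column (suc (n + length Z)) (length A) ≡ count ((- label t) <ᶻ_) (labels r)
    window-column = column-window (suc (n + length Z)) (length A) (- label t) (labels r) label-at
      (window A r (labels Z ++ negLabels G) e₁)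
      (s≤s (ℕₚ.≤-trans a≤n (ℕₚ.m≤m+n n (length Z))))
      (ℕₚ.≤-reflexive sum≡) (inj₂ (ℕₚ.≤-reflexive (sym sum≡)))

area-ballot : ∀ m → area′ (size (roots m)) (ballot m , word m) ≡ inv (roots m) + extra m
area-ballot m = begin
  area′ n (ballot m , word m)
    ≡⟨ area-columns (ballot m) bound ⟩
  areaFrom 0 0 (unary (reading m) ++ letters m)
    ≡⟨ areaFrom-nodes n (word m) n (roots m) (negLabels (reading m)) (letters m) (roots-exhausted m) refl
         (ℕₚ.≤-reflexive (length-reading m)) ⟩
  inv (roots m) + areaFrom (length (reading m)) (length (kids (reading m))) (letters m)
    ≡⟨ cong (λ k → inv (roots m) + areaFrom k (length (kids (reading m))) (letters m))
         (trans (length-reading m) (sym (ℕₚ.+-identityʳ n))) ⟩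
  inv (roots m) + areaFrom (n + 0) (length (kids (reading m))) (letters m)
    ≡⟨ cong (inv (roots m) +_) (areaFrom-letters n (word m) m (kids (reading m)) []
         (cong (λ z → labels z ++ negLabels z) (sym whole)) (trans (cong length whole) (length-reading m))) ⟩
  inv (roots m) + extra m ∎
  where
  open ≡-Reasoning
  n : ℕ
  n = size (roots m)
  open Area n (word m)
  whole : kids (reading m) ++ roots m ++ [] ≡ reading m
  whole = trans (cong (kids (reading m) ++_) (++-identityʳ (roots m))) (kids-reading m)
  bound : length (nXs 0 (ballot m)) ≤ M
  bound = ℕₚ.≤-trans (ℕₚ.≤-reflexive (nXs-length 0 (ballot m)))
    (ℕₚ.≤-trans (ℕₚ.m≤m+n (numN (ballot m)) (numE (ballot m)))
      (ℕₚ.≤-trans (ℕₚ.≤-reflexive (trans (numN+numE (ballot m)) (length-ballot m))) (ℕₚ.n≤1+n _)))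

dinv-area : ∀ {n} π σ → IsVertLabelled n π σ → dinv′ n π σ ≡ area′ n (zeta n π σ)
dinv-area π σ v with vertLabelled-decomposition v
... | decomposition m refl refl refl = begin
  dinv′ n (steps (path m)) (catMaybes (path m))
    ≡⟨ cong (dinv′ n (steps (path m))) (labels-path m) ⟩
  dinv′ n (steps (path m)) (map proj₂ (rowsOf m))
    ≡⟨ dinv-rows (rowsOf m) (length-rowsOf m) (steps (path m)) (areaVec-path m) ⟩
  dinvRows (rowsOf m)
    ≡⟨ dinvRows-path m ⟩
  inv (roots m) + extra m
    ≡⟨ sym (area-ballot m) ⟩
  area′ n (ballot m , word m)
    ≡⟨ cong (area′ n) (sym (zeta-path m)) ⟩
  area′ n (zeta n (steps (path m)) (catMaybes (path m))) ∎
  where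
  open ≡-Reasoning
  n : ℕ
  n = size (roots m)

theorem4p2 : (n : ℕ) → 1 ≤ n →
    ((π : Path) (σ : List ℤ) → IsVertLabelled n π σ →
    Σ (List ℤ) λ τ → IsDiagLabelled n (proj₁ (zeta n π σ)) τ
    × proj₂ (zeta n π σ) ≡ wOf τ)
    × ((π π′ : Path) (σ σ′ : List ℤ) → IsVertLabelled n π σ → IsVertLabelled n π′ σ′ →
    zeta n π σ ≡ zeta n π′ σ′ → (π ≡ π′) × (σ ≡ σ′))
    × ((β : Path) (τ : List ℤ) → IsDiagLabelled n β τ →
    Σ Path λ π → Σ (List ℤ) λ σ → IsVertLabelled n π σ × (zeta n π σ ≡ (β , wOf τ)))
    × ((π : Path) (σ : List ℤ) → IsVertLabelled n π σ →
    dinv′ n π σ ≡ area′ n (zeta n π σ))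
theorem4p2 n _ = zeta-wellDefined , zeta-injective , zeta-surjective , dinv-area
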